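{- If $\mu\in N(\mathscr X)$ then $\{8\mu,9\mu\}\subseteq N(\mathscr X)$.
   Context: A Latin square of order $n$ is an $n\times n$ matrix with row indices, column indices and symbols in $[n]=\{1,\dots,n\}$, each symbol occurring once in each row and column; arithmetic on elements of $[n]$ is modulo $n$ (with representatives in $[n]$). A subsquare of order $k$ of a matrix is a $k\times k$ submatrix (on any $k$ rows and $k$ columns) that is a Latin square; an intercalate is a subsquare of order $2$; a Latin square of order $n$ is $N_\infty$ if it has no subsquare of order in $\{2,\dots,n-1\}$. For a matrix $L$, a cell $(i,j)$ and a symbol $\sigma\ne L[i,j]$, $\sigma\hookrightarrow L[i,j]$ denotes the matrix obtained from $L$ by replacing the symbol in cell $(i,j)$ by $\sigma$. For distinct rows $i,j$ of a Latin square $L$, the row permutation $\tau_{i,j}$ is the permutation of symbols with $\tau_{i,j}(L[i,k])=L[j,k]$ for all columns $k$; if $C$ is the set of columns in which the symbols of a cycle of $\tau_{i,j}$ occur in row $i$, the entries of $L$ in cells $\{i,j\}\times C$ form a row cycle of length $|C|$, involving rows $i,j$, the columns in $C$ and the symbols of that cycle. For a Latin square $L$ of order $\mu$ and $s\in[\mu-1]$, and a positive integer $\alpha$, say $s$ is a strong allowable shift for order $\alpha$ if for every cell $(i,j)$, $i,j\in[\mu]$, the matrix $(L[i,j]+s)\hookrightarrow L[i,j]$ contains no subsquare of order $\alpha$. Let $\mathscr X$ be the set of pairs $(L,s)$ where $L$ is an $N_\infty$ Latin square of order $\mu\ge 10$ (rows, columns, symbols $[\mu]$) and $s\in[\mu-1]$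 such that: (i) $s$ is a strong allowable shift for order $8$ and for order $9$; (ii) $L$ contains a row cycle of length $3$ involving rows $x_1,x_2$, columns $y_1,y_2,y_3$ and symbols $z_1,z_2,z_3$, with $1\notin\{x_1,x_2,y_1,y_2,y_3\}$ and $L[1,1]+s\notin\{z_1,z_2,z_3\}$, and the matrix $L[x_2,y_3]\hookrightarrow L[x_1,y_3]$ contains no intercalate; (iii) there exist rows $r_1,r_2$, columns $c_1,c_2,c_3$ and a symbol $\sigma$ with $1\notin\{r_1,r_2,c_1,c_2,c_3\}$ such that, writing $\tau=\tau_{r_1,r_2}$, $L$ contains the entries $(r_1,c_1,\sigma),(r_2,c_1,\tau(\sigma)),(r_1,c_2,\tau(\sigma)),(r_2,c_2,\tau^2(\sigma)),(r_1,c_3,\tau^2(\sigma)),(r_2,c_3,\sigma+s)$; moreover the matrix $L[r_2,c_3]\hookrightarrow L[r_1,c_3]$ contains no intercalate, and neither $L[1,1]$ nor $L[1,1]+s$ lies in $\{\sigma,\tau(\sigma),\tau^2(\sigma),\sigma+s\}$. Define $N(\mathscr X)=\{\mu\in\mathbb Z:$ there is $(L,s)\in\mathscr X$ with $L$ of order $\mu\}$. -}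

module Defs where

open import Data.Nat using (ℕ; zero; suc; _+_; _*_; _≤_; _<_)
open import Data.Nat.DivMod using (_mod_)
open import Data.Fin using (Fin; toℕ; _≟_)
open import Data.Product using (Σ; ∃; ∃-syntax; _×_; _,_)
open import Data.Sum using (_⊎_)
open import Data.Bool using (Bool; true; false; if_then_else_; _∧_)
open import Relation.Nullary using (¬_)
open import Relation.Nullary.Decidable using (⌊_⌋)
open import Relation.Binary.PropositionalEquality using (_≡_; _≢_)
open import Function using (id)
open import Function.Bundles using (_⇔_)
open import Function.Definitions using (Injective)

-- Convention: [n] = {1,…,n} is represented by Fin n via k ↦ k-1,
-- so the row/column/symbol "1" is Fin.zero.

Matrix : ℕ → Set
Matrix n = Fin n → Fin n → Fin n

-- Addition of a shift s modulo n (0-based representatives; corresponds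
-- exactly to addition mod n with representatives in [n] under k ↦ k-1).
_+ₛ_ : ∀ {n} → Fin n → ℕ → Fin n
_+ₛ_ {suc n} a s = (toℕ a + s) mod (suc n)

IsLatinOn : ∀ {k} {S : Set} → (Fin k → Fin k → S) → (Fin k → S) → Set
IsLatinOn {k} M sym =
  Injective _≡_ _≡_ sym ×
  (∀ i j → ∃[ t ] M i j ≡ sym t) ×
  (∀ i t → ∃[ j ] M i j ≡ sym t) ×
  (∀ i j j′ → M i j ≡ M i j′ → j ≡ j′) ×
  (∀ j t → ∃[ i ] M i j ≡ sym t) ×
  (∀ j i i′ → M i j ≡ M i′ j → i ≡ i′)

IsLatinSquare : ∀ {n} → Matrix n → Set
IsLatinSquare L = IsLatinOn L id

HasSubsquare : ∀ {n} → Matrix n → ℕ → Set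
HasSubsquare {n} M k =
  Σ (Fin k → Fin n) λ r → Σ (Fin k → Fin n) λ c → Σ (Fin k → Fin n) λ sym →
    Injective _≡_ _≡_ r × Injective _≡_ _≡_ c ×
    IsLatinOn (λ a b → M (r a) (c b)) sym

IsNinf : ∀ {n} → Matrix n → Set
IsNinf {n} L = ∀ k → 2 ≤ k → suc k ≤ n → ¬ HasSubsquare L k

replace : ∀ {n} → Matrix n → Fin n → Fin n → Fin n → Matrix n
replace M i j σ a b = if ⌊ a ≟ i ⌋ ∧ ⌊ b ≟ j ⌋ then σ else M a b

StrongAllowableShift : ∀ {n} → Matrix n → ℕ → ℕ → Set
StrongAllowableShift L s α =
  ∀ i j → ¬ HasSubsquare (replace L i j (L i j +ₛ s)) α

-- Graph of the row permutation τ_{i,j}:  τ_{i,j}(σ) ≡ σ′.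
RowPerm : ∀ {n} → Matrix n → Fin n → Fin n → Fin n → Fin n → Set
RowPerm L i j σ σ′ = ∃[ k ] (L i k ≡ σ × L j k ≡ σ′)

RowCycle3 : ∀ {n} → Matrix n → (x₁ x₂ y₁ y₂ y₃ z₁ z₂ z₃ : Fin n) → Set
RowCycle3 L x₁ x₂ y₁ y₂ y₃ z₁ z₂ z₃ =
  x₁ ≢ x₂ ×
  (z₁ ≢ z₂ × z₁ ≢ z₃ × z₂ ≢ z₃) ×
  (y₁ ≢ y₂ × y₁ ≢ y₃ × y₂ ≢ y₃) ×
  RowPerm L x₁ x₂ z₁ z₂ × RowPerm L x₁ x₂ z₂ z₃ × RowPerm L x₁ x₂ z₃ z₁ ×
  (∀ k → ((L x₁ k ≡ z₁ ⊎ L x₁ k ≡ z₂ ⊎ L x₁ k ≡ z₃) ⇔ (k ≡ y₁ ⊎ k ≡ y₂ ⊎ k ≡ y₃)))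

open Fin

CondII : ∀ {n} → Matrix n → ℕ → Set
CondII {zero} L s = Data.Empty.⊥ where import Data.Empty
CondII {suc n} L s =
  Σ (Fin (suc n)) λ x₁ → Σ (Fin (suc n)) λ x₂ →
  Σ (Fin (suc n)) λ y₁ → Σ (Fin (suc n)) λ y₂ → Σ (Fin (suc n)) λ y₃ →
  Σ (Fin (suc n)) λ z₁ → Σ (Fin (suc n)) λ z₂ → Σ (Fin (suc n)) λ z₃ →
    RowCycle3 L x₁ x₂ y₁ y₂ y₃ z₁ z₂ z₃ ×
    (x₁ ≢ zero × x₂ ≢ zero × y₁ ≢ zero × y₂ ≢ zero × y₃ ≢ zero) ×
    (L zero zero +ₛ s ≢ z₁ × L zero zero +ₛ s ≢ z₂ × L zero zero +ₛ s ≢ z₃) ×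
    ¬ HasSubsquare (replace L x₁ y₃ (L x₂ y₃)) 2

-- Condition (iii); τσ and τ²σ stand for τ(σ), τ²(σ) with τ = τ_{r₁,r₂}.
CondIII : ∀ {n} → Matrix n → ℕ → Set
CondIII {zero} L s = Data.Empty.⊥ where import Data.Empty
CondIII {suc n} L s =
  Σ (Fin (suc n)) λ r₁ → Σ (Fin (suc n)) λ r₂ →
  Σ (Fin (suc n)) λ c₁ → Σ (Fin (suc n)) λ c₂ → Σ (Fin (suc n)) λ c₃ →
  Σ (Fin (suc n)) λ σ → Σ (Fin (suc n)) λ τσ → Σ (Fin (suc n)) λ τ²σ →
    r₁ ≢ r₂ × (c₁ ≢ c₂ × c₁ ≢ c₃ × c₂ ≢ c₃) ×
    RowPerm L r₁ r₂ σ τσ × RowPerm L r₁ r₂ τσ τ²σ ×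
    (r₁ ≢ zero × r₂ ≢ zero × c₁ ≢ zero × c₂ ≢ zero × c₃ ≢ zero) ×
    (L r₁ c₁ ≡ σ × L r₂ c₁ ≡ τσ × L r₁ c₂ ≡ τσ × L r₂ c₂ ≡ τ²σ ×
     L r₁ c₃ ≡ τ²σ × L r₂ c₃ ≡ σ +ₛ s) ×
    ¬ HasSubsquare (replace L r₁ c₃ (L r₂ c₃)) 2 ×
    (L zero zero ≢ σ × L zero zero ≢ τσ × L zero zero ≢ τ²σ × L zero zero ≢ σ +ₛ s) ×
    (L zero zero +ₛ s ≢ σ × L zero zero +ₛ s ≢ τσ × L zero zero +ₛ s ≢ τ²σ ×
     L zero zero +ₛ s ≢ σ +ₛ s)

InX : (μ : ℕ) → Matrix μ → ℕ → Set
InX μ L s =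
  10 ≤ μ × IsLatinSquare L × IsNinf L ×
  (1 ≤ s × suc s ≤ μ) ×
  StrongAllowableShift L s 8 × StrongAllowableShift L s 9 ×
  CondII L s × CondIII L s

InNX : ℕ → Set
InNX μ = Σ (Matrix μ) λ L → Σ ℕ λ s → InX μ L s

{-# OPTIONS --safe #-}
-- For α ∈ {8, 9}, take the product of a fixed Latin square A of order α with L, replace one copy of A by a second square B,
-- add s in one copy of L, and exchange two rows in the three columns in which the near row cycle of (iii), combined with
-- suitable entries of A, has become a row cycle.  The new shift is μ; it moves the A-coordinate of a symbol by one.
--
-- A subsquare S of the result is a small Latin square whose rows, columns and symbols are labelled by those of A and of L.
-- A column v of S without faults forces each symbol Q u v to have the multiplicity of the row u in S, and likewise for rows.
-- For Q = L the rows, columns and symbols of maximal multiplicity form a subsquare, hence one row only or all rows, since L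
-- is N∞.  For Q = A or B, finite rigidity properties, checked by evaluation, say that few columns determine the
-- multiplicities and that a single fault is impossible.  If S meets both exchanged rows in an exchanged column then it
-- contains the whole row cycle, which can be switched back; otherwise all its exchanged cells lie in one row.
module Submission where

-- Every block of a plain product is a subsquare: each cell of A carries a copy of L, and each cell
-- of L a copy of A. The three changes are chosen to break all of these. The square B spoils one
-- cell in every copy of L but the corner one, where B has to agree with A or the result would not
-- be Latin. The shift by s spoils one cell in every copy of A, and in that of B. What survives is
-- the corner copy of L, shifted as a whole. The row exchange is there to break it, and this
-- explains the form of (iii): the shift turns σ into σ + s, exactly the symbol at which the near
-- row cycle fails to close, so that the product has a row cycle with one row inside the corner copy
-- and one outside. A subsquare that takes every row of A once, the corner included, projects to a
-- subsquare of L with one shifted cell; hence (i), for order 8 or 9. The new shift has to satisfy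
-- (i) again. As it changes the class in A only, it adds one more fault of the kind already treated,
-- and the order, at most 9, stays below μ.

open import Data.Nat using (ℕ; zero; suc; _+_; _*_; _∸_; _≤_; _<_; z≤n; s≤s; s≤s⁻¹; _≤?_; _≡ᵇ_; _≤ᵇ_; _%_; _<?_)
import Data.Nat.Properties as ℕ
open import Data.Fin using (Fin; zero; suc; toℕ; _≟_; combine; remQuot)
import Data.Fin.Properties as F
open import Data.Bool using (Bool; true; false; if_then_else_; _∧_; not; _∨_)
open import Data.Product using (∃; ∃-syntax; _×_; _,_; proj₁; proj₂)
open import Data.Sum using (_⊎_; inj₁; inj₂; [_,_]′)
open import Data.Empty using (⊥; ⊥-elim)
open import Data.Unit using (⊤; tt)
open import Data.Maybe using (Maybe; just; nothing)
open import Data.List using (List; []; _∷_; length; map; _++_)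
open import Data.List.Relation.Unary.Any using (here; there; any?)
open import Data.List.Membership.Propositional using (_∈_; _∉_)
open import Relation.Nullary using (¬_; Dec; yes; no; does)
open import Relation.Nullary.Decidable using (¬?; _×-dec_; _⊎-dec_; _→-dec_; from-yes; map′)
open import Relation.Nullary.Negation using (contradiction)
open import Relation.Unary using (Decidable)
open import Relation.Binary.PropositionalEquality using (_≡_; _≢_; refl; sym; trans; cong; cong₂; subst; subst₂; ≢-sym; module ≡-Reasoning)
open import Function using (_∘_; id; flip)
open import Defs
open import Data.Vec using (Vec; []; _∷_; lookup; replicate; _[_]≔_)
open import Data.Nat.DivMod using (m<n⇒m%n≡m; [m+n]%n≡m%n; m%n<n; %-distribˡ-+; n%n≡0)
open import Data.Fin.Patterns
open import Data.List.Membership.Propositional.Properties using (∈-++⁺ʳ)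
import Data.List.Properties as List
open import Function.Bundles using (mk⇔; Equivalence)
import Data.Bool.Properties as B

-- Counting

bit : {A : Set} → Dec A → ℕ
bit (yes _) = 1
bit (no _) = 0

abstract
  # : {k : ℕ} {P : Fin k → Set} → Decidable P → ℕ
  # {zero} P? = 0
  # {suc k} P? = bit (P? zero) + # (λ i → P? (suc i))

without : {n : ℕ} {P : Fin n → Set} → Decidable P → (x : Fin n) → Decidable (λ y → P y × y ≢ x)
without P? x y = P? y ×-dec ¬? (y ≟ x)

abstract
  #-mono : {k : ℕ} {P : Fin k → Set} {Q : Fin k → Set} (P? : Decidable P) (Q? : Decidable Q) → (∀ i → P i → Q i) → # P? ≤ # Q?
  #-mono {k = zero} P? Q? f = z≤n
  #-mono {k = suc k} P? Q? f with P? zero | Q? zero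
  ... | yes p | yes q = s≤s (#-mono _ _ (λ i → f (suc i)))
  ... | yes p | no ¬q = contradiction (f zero p) ¬q
  ... | no _ | yes q = ℕ.m≤n⇒m≤1+n (#-mono _ _ (λ i → f (suc i)))
  ... | no _ | no _ = #-mono _ _ (λ i → f (suc i))

abstract
  #-cong : {k : ℕ} {P : Fin k → Set} {Q : Fin k → Set} (P? : Decidable P) (Q? : Decidable Q) → (∀ i → P i → Q i) → (∀ i → Q i → P i) → # P? ≡ # Q?
  #-cong P? Q? f g = ℕ.≤-antisym (#-mono P? Q? f) (#-mono Q? P? g)

abstract
  #-remove : {n : ℕ} {P : Fin n → Set} (P? : Decidable P) (x : Fin n) → P x → # P? ≡ suc (# (without P? x))
  #-remove {n = suc n} P? zero px with P? zero
  ... | no ¬p = contradiction px ¬p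
  ... | yes _ = cong suc (#-cong (λ i → P? (suc i)) (λ i → without P? zero (suc i)) (λ i p → p , (λ ())) (λ i → proj₁))
  #-remove {n = suc n} P? (suc x) px with P? zero
  ... | yes p = cong suc (trans (#-remove (λ i → P? (suc i)) x px)
          (cong suc (#-cong (without (λ i → P? (suc i)) x) (λ i → without P? (suc x) (suc i)) (λ i (p , ne) → p , λ { refl → ne refl }) (λ i (p , ne) → p , λ { refl → ne refl }))))
  ... | no ¬p = trans (#-remove (λ i → P? (suc i)) x px)
          (cong suc (#-cong (without (λ i → P? (suc i)) x) (λ i → without P? (suc x) (suc i)) (λ i (p , ne) → p , λ { refl → ne refl }) (λ i (p , ne) → p , λ { refl → ne refl })))

abstract
  #-remove≤ : {n : ℕ} {P : Fin n → Set} (P? : Decidable P) (x : Fin n) → # P? ≤ suc (# (without P? x))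
  #-remove≤ P? x with P? x
  ... | yes p = ℕ.≤-reflexive (#-remove P? x p)
  ... | no ¬p = ℕ.m≤n⇒m≤1+n (#-mono P? (without P? x) (λ i p → p , λ { refl → ¬p p }))

abstract
  #-inj : {k n : ℕ} {P : Fin k → Set} {Q : Fin n → Set} (P? : Decidable P) (Q? : Decidable Q) (f : Fin k → Fin n) →
          (∀ i j → P i → P j → f i ≡ f j → i ≡ j) → (∀ i → P i → Q (f i)) → # P? ≤ # Q?
  #-inj {k = zero} P? Q? f inj pq = z≤n
  #-inj {k = suc k} P? Q? f inj pq with P? zero
  ... | no _ = #-inj _ Q? (f ∘ suc) (λ i j p p′ e → F.suc-injective (inj _ _ p p′ e)) (λ i → pq (suc i))
  ... | yes p = ℕ.≤-trans
        (s≤s (#-inj _ (without Q? (f zero)) (f ∘ suc) (λ i j p p′ e → F.suc-injective (inj _ _ p p′ e))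
                (λ i pi → pq (suc i) pi , λ e → F.0≢1+n (inj _ _ p pi (sym e)))))
        (ℕ.≤-reflexive (sym (#-remove Q? (f zero) (pq zero p))))

abstract
  #-compl : {k : ℕ} {P : Fin k → Set} (P? : Decidable P) → # P? + # (λ i → ¬? (P? i)) ≡ k
  #-compl {k = zero} P? = refl
  #-compl {k = suc k} P? with P? zero
  ... | yes _ = cong suc (#-compl (λ i → P? (suc i)))
  ... | no _ = trans (ℕ.+-suc _ _) (cong suc (#-compl (λ i → P? (suc i))))

abstract
  #-all : {k : ℕ} {P : Fin k → Set} (P? : Decidable P) → (∀ i → P i) → # {k} P? ≡ k
  #-all {k = zero} P? f = refl
  #-all {k = suc k} P? f with P? zero
  ... | yes _ = cong suc (#-all _ (λ i → f (suc i)))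
  ... | no ¬p = contradiction (f zero) ¬p

#≤ : {k : ℕ} {P : Fin k → Set} (P? : Decidable P) → # {k} P? ≤ k
#≤ P? = ℕ.≤-trans (ℕ.m≤m+n _ _) (ℕ.≤-reflexive (#-compl P?))

#-without-all : ∀ {n} (x : Fin (suc n)) → # (without (λ _ → yes tt) x) ≡ n
#-without-all {n} x = ℕ.suc-injective (trans (sym (#-remove (λ _ → yes tt) x tt)) (#-all {k = suc n} (λ _ → yes tt) (λ _ → tt)))

#-full : {k : ℕ} {P : Fin k → Set} (P? : Decidable P) → k ≤ # P? → ∀ i → P i
#-full {k = suc k} P? le i with P? i
... | yes p = p
... | no ¬p = contradiction (ℕ.≤-trans le (ℕ.≤-trans
                (#-mono P? (without (λ _ → yes tt) i) (λ j pj → tt , λ { refl → ¬p pj }))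
                (ℕ.≤-reflexive (#-without-all i)))) ℕ.1+n≰n

abstract
  #-none : {k : ℕ} {P : Fin k → Set} (P? : Decidable P) → (∀ i → ¬ P i) → # P? ≡ 0
  #-none {k = zero} P? f = refl
  #-none {k = suc k} P? f with P? zero
  ... | yes p = contradiction p (f zero)
  ... | no _ = #-none _ (λ i → f (suc i))

-- Composing with `π` can only lower the count of `P` and that of its complement; either pair of
-- counts adds up to `k`, so neither drops.
#-perm : {k : ℕ} {P : Fin k → Set} (P? : Decidable P) (π : Fin k → Fin k) → (∀ i j → π i ≡ π j → i ≡ j) → # (λ i → P? (π i)) ≡ # P?
#-perm {k = k} P? π inj = ℕ.≤-antisym le (ℕ.+-cancelʳ-≤ (# nP?π) (# P?) (# (λ i → P? (π i))) (begin
    # P? + # nP?π ≤⟨ ℕ.+-monoʳ-≤ (# P?) le′ ⟩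
    # P? + # (λ i → ¬? (P? i)) ≡⟨ #-compl P? ⟩
    k ≡⟨ #-compl (λ i → P? (π i)) ⟨
    # (λ i → P? (π i)) + # nP?π ∎))
  where
  open ℕ.≤-Reasoning
  nP?π = λ i → ¬? (P? (π i))
  le = #-inj (λ i → P? (π i)) P? π (λ i j _ _ → inj i j) (λ i p → p)
  le′ = #-inj nP?π (λ i → ¬? (P? i)) π (λ i j _ _ → inj i j) (λ i p → p)

#-cover : {k : ℕ} {P : Fin k → Set} (P? : Decidable P) (xs : List (Fin k)) → (∀ i → P i → i ∈ xs) → # P? ≤ length xs
#-cover P? [] f = ℕ.≤-reflexive (#-none P? (λ i p → contradiction (f i p) λ ()))
#-cover P? (x ∷ xs) f = ℕ.≤-trans (#-remove≤ P? x) (s≤s (#-cover (without P? x) xs λ i (p , ne) → go ne (f i p)))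
  where
  go : ∀ {i} → i ≢ x → i ∈ x ∷ xs → i ∈ xs
  go ne (here e) = contradiction e ne
  go ne (there m) = m

abstract
  #-pick : {k : ℕ} {P : Fin k → Set} (P? : Decidable P) → 1 ≤ # P? → ∃ P
  #-pick {k = suc k} P? le with P? zero
  ... | yes p = zero , p
  ... | no _ with #-pick (λ i → P? (suc i)) le
  ... | i , p = suc i , p

abstract
  #-fresh : {k : ℕ} {P : Fin k → Set} (P? : Decidable P) (xs : List (Fin k)) → length xs < # P? → ∃[ i ] (P i × i ∉ xs)
  #-fresh P? [] lt with #-pick P? lt
  ... | i , p = i , p , λ ()
  #-fresh P? (x ∷ xs) lt with #-fresh (without P? x) xs (s≤s⁻¹ (ℕ.≤-trans lt (#-remove≤ P? x)))
  ... | i , (p , ne) , ni = i , p , λ { (here e) → ne e ; (there m) → ni m }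

1≤# : {k : ℕ} {P : Fin k → Set} (P? : Decidable P) (i : Fin k) → P i → 1 ≤ # P?
1≤# P? i p = ℕ.≤-trans (s≤s z≤n) (ℕ.≤-reflexive (sym (#-remove P? i p)))

2≤# : {k : ℕ} {P : Fin k → Set} (P? : Decidable P) (i j : Fin k) → P i → P j → i ≢ j → 2 ≤ # P?
2≤# P? i j p q ne = ℕ.≤-trans (s≤s (1≤# (without P? i) j (q , ≢-sym ne))) (ℕ.≤-reflexive (sym (#-remove P? i p)))

abstract
  #-disj : {k : ℕ} {P : Fin k → Set} {Q : Fin k → Set} {R : Fin k → Set} (P? : Decidable P) (Q? : Decidable Q) (R? : Decidable R) → (∀ i → P i → Q i → ⊥) →
           (∀ i → P i → R i) → (∀ i → Q i → R i) → # P? + # Q? ≤ # R?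
  #-disj {k = zero} P? Q? R? d f g = z≤n
  #-disj {k = suc k} P? Q? R? d f g with #-disj (λ i → P? (suc i)) (λ i → Q? (suc i)) (λ i → R? (suc i)) (λ i → d (suc i)) (λ i → f (suc i)) (λ i → g (suc i))
  ... | ih with P? zero | Q? zero | R? zero
  ... | yes p | yes q | _ = ⊥-elim (d zero p q)
  ... | yes p | no _ | yes _ = s≤s ih
  ... | yes p | no _ | no ¬r = contradiction (f zero p) ¬r
  ... | no _ | yes q | yes _ = ℕ.≤-trans (ℕ.≤-reflexive (ℕ.+-suc _ _)) (s≤s ih)
  ... | no _ | yes q | no ¬r = contradiction (g zero q) ¬r
  ... | no _ | no _ | yes _ = ℕ.m≤n⇒m≤1+n ih
  ... | no _ | no _ | no _ = ih

abstract
  #-union : {k : ℕ} {P : Fin k → Set} {Q : Fin k → Set} {R : Fin k → Set} (P? : Decidable P) (Q? : Decidable Q) (R? : Decidable R) → (∀ i → R i → P i ⊎ Q i) → # R? ≤ # P? + # Q?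
  #-union {k = zero} P? Q? R? d = z≤n
  #-union {k = suc k} P? Q? R? d with #-union (λ i → P? (suc i)) (λ i → Q? (suc i)) (λ i → R? (suc i)) (λ i → d (suc i))
  ... | ih with P? zero | Q? zero | R? zero
  ... | yes p | yes q | yes _ = s≤s (ℕ.≤-trans ih (ℕ.+-monoʳ-≤ (# (λ i → P? (suc i))) (ℕ.n≤1+n _)))
  ... | yes p | yes q | no _ = ℕ.m≤n⇒m≤1+n (ℕ.≤-trans ih (ℕ.+-monoʳ-≤ (# (λ i → P? (suc i))) (ℕ.n≤1+n _)))
  ... | yes p | no _ | yes _ = s≤s ih
  ... | yes p | no _ | no ¬r = ℕ.m≤n⇒m≤1+n ih
  ... | no _ | yes q | yes _ = ℕ.≤-trans (s≤s ih) (ℕ.≤-reflexive (sym (ℕ.+-suc _ _)))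
  ... | no _ | yes q | no ¬r = ℕ.≤-trans ih (ℕ.+-monoʳ-≤ (# (λ i → P? (suc i))) (ℕ.n≤1+n _))
  ... | no ¬p | no ¬q | yes r = contradiction (d zero r) λ { (inj₁ p) → ¬p p ; (inj₂ q) → ¬q q }
  ... | no _ | no _ | no _ = ih

≤1⇒≡ : {k : ℕ} {P : Fin k → Set} (P? : Decidable P) → # P? ≤ 1 → ∀ i j → P i → P j → i ≡ j
≤1⇒≡ P? le i j p q with i ≟ j
... | yes e = e
... | no ne = contradiction (ℕ.≤-trans (2≤# P? i j p q ne) le) λ { (s≤s ()) }

≡⇒≤1 : {k : ℕ} {P : Fin k → Set} (P? : Decidable P) → (∀ i j → P i → P j → i ≡ j) → # P? ≤ 1
≡⇒≤1 {k = k} P? f with F.any? P?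
... | yes (i , p) = #-cover P? (i ∷ []) (λ j q → here (f j i q p))
... | no ¬e = ℕ.≤-trans (ℕ.≤-reflexive (#-none P? (λ i p → ¬e (i , p)))) z≤n

abstract
  #-pick2 : {k : ℕ} {P : Fin k → Set} (P? : Decidable P) → 2 ≤ # P? → ∃[ i ] ∃[ j ] (P i × P j × i ≢ j)
  #-pick2 P? le with #-pick P? (ℕ.≤-trans (s≤s z≤n) le)
  ... | i , p with #-fresh P? (i ∷ []) le
  ... | j , q , ne = i , j , p , q , λ e → ne (here (sym e))

abstract
  #-onto : {k n : ℕ} {P : Fin k → Set} (P? : Decidable P) (f : Fin k → Fin n) → (∀ i j → P i → P j → f i ≡ f j → i ≡ j) →
           n ≤ # P? → ∀ y → ∃[ i ] (P i × f i ≡ y)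
  #-onto {n = suc n} P? f inj le y with F.any? (λ i → P? i ×-dec (f i ≟ y))
  ... | yes e = e
  ... | no ¬e = contradiction (ℕ.≤-trans le (ℕ.≤-trans (#-inj P? (without (λ _ → yes tt) y) f inj (λ i p → tt , λ e → ¬e (i , p , e)))
          (ℕ.≤-reflexive (#-without-all y)))) ℕ.1+n≰n

#-image : {k n : ℕ} {P : Fin k → Set} (P? : Decidable P) (f : Fin k → Fin n) → (∀ i j → P i → P j → f i ≡ f j → i ≡ j) →
          # (λ y → F.any? (λ i → P? i ×-dec (f i ≟ y))) ≡ # P?
#-image {k = k} {n = n} {P = P} P? f inj = ℕ.≤-antisym le (#-inj P? _ f inj (λ i p → i , p , refl))
  where
  im? = λ y → F.any? (λ i → P? i ×-dec (f i ≟ y))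
  le : # im? ≤ # P?
  le with F.any? P?
  ... | no ¬e = ℕ.≤-trans (ℕ.≤-reflexive (#-none im? (λ { y (i , p , _) → ¬e (i , p) }))) z≤n
  ... | yes (i₀ , _) = #-inj im? P? pre inj′ sat
    where
    pre : Fin n → Fin k
    pre y with im? y
    ... | yes (i , _) = i
    -- A default value: `spec` speaks only of points in the image.
    ... | no _ = i₀
    spec : ∀ y → ∃[ i ] (P i × f i ≡ y) → P (pre y) × f (pre y) ≡ y
    spec y e with im? y
    ... | yes (i , r) = r
    ... | no ¬e = contradiction e ¬e
    inj′ = λ y y′ e e′ eq → trans (sym (proj₂ (spec y e))) (trans (cong f eq) (proj₂ (spec y′ e′)))
    sat = λ y e → proj₁ (spec y e)

-- Enumerating a decidable subset; pigeonhole arguments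

abstract
  enum : {n : ℕ} {P : Fin n → Set} (P? : Decidable P) → Fin (# P?) → Fin n
  enum {n = suc n} P? i with P? zero
  enum {n = suc n} P? zero | yes p = zero
  enum {n = suc n} P? (suc i) | yes p = suc (enum (λ j → P? (suc j)) i)
  enum {n = suc n} P? i | no _ = suc (enum (λ j → P? (suc j)) i)

abstract
  enum-sat : {n : ℕ} {P : Fin n → Set} (P? : Decidable P) → ∀ i → P (enum P? i)
  enum-sat {n = suc n} P? i with P? zero
  enum-sat {n = suc n} P? zero | yes p = p
  enum-sat {n = suc n} P? (suc i) | yes p = enum-sat (λ j → P? (suc j)) i
  enum-sat {n = suc n} P? i | no _ = enum-sat (λ j → P? (suc j)) i

abstract
  enum-inj : {n : ℕ} {P : Fin n → Set} (P? : Decidable P) → ∀ i j → enum P? i ≡ enum P? j → i ≡ j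
  enum-inj {n = suc n} P? i j e with P? zero
  enum-inj {n = suc n} P? zero zero e | yes p = refl
  enum-inj {n = suc n} P? (suc i) (suc j) e | yes p = cong suc (enum-inj (λ j → P? (suc j)) i j (F.suc-injective e))
  enum-inj {n = suc n} P? i j e | no _ = enum-inj (λ j → P? (suc j)) i j (F.suc-injective e)

abstract
  enum-onto : {n : ℕ} {P : Fin n → Set} (P? : Decidable P) → ∀ y → P y → ∃[ i ] enum P? i ≡ y
  enum-onto {n = suc n} P? y q with P? zero
  enum-onto {n = suc n} P? zero q | yes p = zero , refl
  enum-onto {n = suc n} P? (suc y) q | yes p with enum-onto (λ j → P? (suc j)) y q
  ... | i , e = suc i , cong suc e
  enum-onto {n = suc n} P? zero q | no ¬p = contradiction q ¬p
  enum-onto {n = suc n} P? (suc y) q | no ¬p with enum-onto (λ j → P? (suc j)) y q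
  ... | i , e = i , cong suc e

total : {k : ℕ} → # {k} {λ _ → ⊤} (λ _ → yes tt) ≡ k
total {k} = #-all {k} {λ _ → ⊤} (λ _ → yes tt) (λ _ → tt)

onto⇒≤ : {k n : ℕ} → (f : Fin k → Fin n) → (∀ y → ∃[ x ] f x ≡ y) → n ≤ k
onto⇒≤ f s = subst₂ _≤_ total total (#-inj {P = λ _ → ⊤} {Q = λ _ → ⊤} (λ _ → yes tt) (λ _ → yes tt) (λ y → proj₁ (s y))
  (λ y y′ _ _ e → trans (sym (proj₂ (s y))) (trans (cong f e) (proj₂ (s y′)))) (λ _ _ → tt))

inj⇒≤ : {k n : ℕ} → (f : Fin k → Fin n) → (∀ x x′ → f x ≡ f x′ → x ≡ x′) → k ≤ n
inj⇒≤ f inj = subst₂ _≤_ total total (#-inj {P = λ _ → ⊤} {Q = λ _ → ⊤} (λ _ → yes tt) (λ _ → yes tt) f (λ x x′ _ _ → inj x x′) (λ _ _ → tt))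

abstract
  inj⇒onto : {k n : ℕ} → n ≤ k → (f : Fin k → Fin n) → (∀ x x′ → f x ≡ f x′ → x ≡ x′) → ∀ y → ∃[ x ] f x ≡ y
  inj⇒onto {n = n} le f inj y with #-onto {P = λ _ → ⊤} (λ _ → yes tt) f (λ x x′ _ _ → inj x x′) (subst (n ≤_) (sym total) le) y
  ... | x , _ , e = x , e

abstract
  freshFin : {k : ℕ} → (xs : List (Fin k)) → length xs < k → ∃[ x ] x ∉ xs
  freshFin {k} xs lt with #-fresh {P = λ _ → ⊤} (λ _ → yes tt) xs (subst (length xs <_) (sym total) lt)
  ... | x , _ , ne = x , ne

-- Intercalates and labels of multiplicity two are handled through this: a symbol is pinned down by
-- differing from one other symbol of its class.
pairEq : {k : ℕ} {P : Fin k → Set} (P? : Decidable P) → # P? ≤ 2 → ∀ {t u v} → P t → P u → P v → u ≢ t → v ≢ t → u ≡ v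
pairEq P? le {t} {u} {v} pt pu pv u≢ v≢ = ≤1⇒≡ (without P? t) (s≤s⁻¹ (subst (_≤ 2) (#-remove P? t pt) le)) u v (pu , u≢) (pv , v≢)

abstract
  #-pick3 : {k : ℕ} {P : Fin k → Set} (P? : Decidable P) → 3 ≤ # P? → ∃[ a ] ∃[ b ] ∃[ c ] (P a × P b × P c × a ≢ b × a ≢ c × b ≢ c)
  #-pick3 P? le with #-pick2 P? (ℕ.≤-trans (s≤s (s≤s z≤n)) le)
  ... | a , b , pa , pb , ab with #-fresh P? (a ∷ b ∷ []) le
  ... | c , pc , nc = a , b , c , pa , pb , pc , ab , (λ e → nc (here (sym e))) , (λ e → nc (there (here (sym e))))

decide : {P X : Set} → Dec P → (P → X) → (¬ P → X) → X
decide (yes p) f g = f p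
decide (no ¬p) f g = g ¬p

stable : {P : Set} → Dec P → ¬ ¬ P → P
stable d nn = decide d id (λ ¬p → ⊥-elim (nn ¬p))

Uniq : {A : Set} → List A → Set
Uniq [] = ⊤
Uniq (x ∷ xs) = x ∉ xs × Uniq xs

countL : {k : ℕ} {P : Fin k → Set} → Decidable P → List (Fin k) → ℕ
countL P? [] = 0
countL P? (x ∷ xs) = bit (P? x) + countL P? xs

private
  countL-cong : {k : ℕ} {P : Fin k → Set} {Q : Fin k → Set} (P? : Decidable P) (Q? : Decidable Q) (xs : List (Fin k)) →
                (∀ i → i ∈ xs → P i → Q i) → (∀ i → i ∈ xs → Q i → P i) → countL P? xs ≡ countL Q? xs
  countL-cong P? Q? [] f g = refl
  countL-cong P? Q? (x ∷ xs) f g = cong₂ _+_ eq (countL-cong P? Q? xs (λ i m → f i (there m)) (λ i m → g i (there m)))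
    where
    eq : bit (P? x) ≡ bit (Q? x)
    eq with P? x | Q? x
    ... | yes _ | yes _ = refl
    ... | no _ | no _ = refl
    ... | yes p | no ¬q = contradiction (f x (here refl) p) ¬q
    ... | no ¬p | yes q = contradiction (g x (here refl) q) ¬p

-- Bridge to counts over an explicit list of columns, on which the finite checks can compute.
#-countL : {k : ℕ} {P : Fin k → Set} (P? : Decidable P) (xs : List (Fin k)) → Uniq xs → (∀ i → P i → i ∈ xs) → # P? ≡ countL P? xs
#-countL P? [] u f = #-none P? (λ i p → contradiction (f i p) λ ())
#-countL {P = P} P? (x ∷ xs) (x∉ , u) f with P? x
... | yes p = trans (#-remove P? x p) (cong suc (trans (#-countL (without P? x) xs u (λ i (q , ne) → tail (f i q) ne))
        (countL-cong (without P? x) P? xs (λ i _ → proj₁) (λ i m q → q , λ { refl → x∉ m }))))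
  where
  tail : ∀ {i} → i ∈ x ∷ xs → i ≢ x → i ∈ xs
  tail (here e) ne = contradiction e ne
  tail (there m) _ = m
... | no ¬p = #-countL P? xs u (λ i q → tail (f i q) λ { refl → ¬p q })
  where
  tail : ∀ {i} → i ∈ x ∷ xs → i ≢ x → i ∈ xs
  tail (here e) ne = contradiction e ne
  tail (there m) _ = m

#-list : {k : ℕ} {P : Fin k → Set} (P? : Decidable P) (xs : List (Fin k)) → Uniq xs → (∀ i → i ∈ xs → P i) → length xs ≤ # P?
#-list P? [] u f = z≤n
#-list P? (x ∷ xs) (x∉ , u) f = ℕ.≤-trans (s≤s (#-list (without P? x) xs u (λ i m → f i (there m) , λ { refl → x∉ m })))
  (ℕ.≤-reflexive (sym (#-remove P? x (f x (here refl)))))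

-- Latin squares labelled by a Latin square

-- Over a finite set cancellation alone makes a Latin square: injective rows and columns are onto by
-- counting, which gives `rowS` and `colS`.
record Cancel {n : ℕ} (Q : Matrix n) : Set where
  field
    row : ∀ i {j j′} → Q i j ≡ Q i j′ → j ≡ j′
    col : ∀ j {i i′} → Q i j ≡ Q i′ j → i ≡ i′

  abstract
    rowS : ∀ i c → ∃[ j ] Q i j ≡ c
    rowS i c with #-onto (λ _ → yes tt) (Q i) (λ _ _ _ _ → row i) (ℕ.≤-reflexive (sym (#-all {k = n} (λ _ → yes tt) (λ _ → tt)))) c
    ... | j , _ , e = j , e

    colS : ∀ j c → ∃[ i ] Q i j ≡ c
    colS j c with #-onto (λ _ → yes tt) (λ i → Q i j) (λ _ _ _ _ → col j) (ℕ.≤-reflexive (sym (#-all {k = n} (λ _ → yes tt) (λ _ → tt)))) c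
    ... | i , _ , e = i , e

flipC : {n : ℕ} {Q : Matrix n} → Cancel Q → Cancel (flip Q)
flipC C = record { row = λ i → Cancel.col C i ; col = λ j → Cancel.row C j }

cancel→latin : {k : ℕ} {S : Set} (M : Fin k → Fin k → S) (sy : Fin k → S) (m : Matrix k) → Cancel m →
               (∀ i j → sy i ≡ sy j → i ≡ j) → (∀ i j → M i j ≡ sy (m i j)) → IsLatinOn M sy
cancel→latin M sy m C si e =
  (λ {i} {j} → si i j) , (λ i j → m i j , e i j) ,
  (λ i t → let (j , q) = rowS i t in j , trans (e i j) (cong sy q)) ,
  (λ i j j′ q → row i (si _ _ (trans (sym (e i j)) (trans q (e i j′))))) ,
  (λ j t → let (i , q) = colS j t in i , trans (e i j) (cong sy q)) ,
  (λ j i i′ q → col j (si _ _ (trans (sym (e i j)) (trans q (e i′ j)))))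
  where open Cancel C

-- A Latin square m of order k whose rows, columns and symbols are labelled by those of Q; the labelling need not
-- be injective, and Ex a b says that it is exact at the cell (a , b).
record Hom {n : ℕ} (k : ℕ) (Q : Matrix n) : Set where
  field
    f g h : Fin k → Fin n
    m : Matrix k
    mC : Cancel m

  Ex : Fin k → Fin k → Set
  Ex a b = Q (f a) (g b) ≡ h (m a b)
  GoodR GoodC : Fin k → Set
  GoodR a = ∀ b → Ex a b
  GoodC b = ∀ a → Ex a b
  Nf Ng Nh : Fin n → ℕ
  Nf u = # (λ a → f a ≟ u)
  Ng v = # (λ b → g b ≟ v)
  Nh c = # (λ t → h t ≟ c)

  row# : {P : Fin k → Set} (P? : Decidable P) → ∀ a → # (λ b → P? (m a b)) ≡ # P?
  row# P? a = #-perm P? (m a) (λ _ _ → Cancel.row mC a)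
  col# : {P : Fin k → Set} (P? : Decidable P) → ∀ b → # (λ a → P? (m a b)) ≡ # P?
  col# P? b = #-perm P? (λ a → m a b) (λ _ _ → Cancel.col mC b)

  OnlyBad : (a₀ b₀ : Fin k) → Set
  OnlyBad a₀ b₀ = (∀ a → a ≢ a₀ → Ex a b₀) × ¬ Ex a₀ b₀

flipH : {n k : ℕ} {Q : Matrix n} → Hom k Q → Hom k (flip Q)
flipH H = record { f = g ; g = f ; h = h ; m = flip m ; mC = flipC mC } where open Hom H

module Counting {n k : ℕ} {Q : Matrix n} (C : Cancel Q) (H : Hom k Q) where
  open Hom H
  open Cancel C

  -- Each symbol occurs once in column `b`, and since `Q` cancels, those of class `Q u (g b)` stand
  -- exactly in the rows labelled `u`.
  goodC : ∀ {b} → GoodC b → ∀ u → Nh (Q u (g b)) ≡ Nf u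
  goodC {b} G u = trans (sym (col# (λ t → h t ≟ Q u (g b)) b))
    (#-cong _ _ (λ a e → col (g b) (trans (G a) e)) (λ a e → trans (sym (G a)) (cong (λ u → Q u (g b)) e)))

  goodR : ∀ {a} → GoodR a → ∀ v → Nh (Q (f a) v) ≡ Ng v
  goodR {a} G v = trans (sym (row# (λ t → h t ≟ Q (f a) v) a))
    (#-cong _ _ (λ b e → row (f a) (trans (G b) e)) (λ b e → trans (sym (G b)) (cong (Q (f a)) e)))

  onlyBad-off : ∀ {a₀ b₀} → OnlyBad a₀ b₀ → ∀ u → Q u (g b₀) ≢ Q (f a₀) (g b₀) → Q u (g b₀) ≢ h (m a₀ b₀) →
                Nh (Q u (g b₀)) ≡ Nf u
  onlyBad-off {a₀} {b₀} (ex , bad) u nx ny = trans (sym (col# (λ t → h t ≟ Q u (g b₀)) b₀)) (#-cong _ _ to from)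
    where
    to : ∀ a → h (m a b₀) ≡ Q u (g b₀) → f a ≡ u
    to a e with a ≟ a₀
    ... | yes refl = contradiction (sym e) ny
    ... | no ne = col (g b₀) (trans (ex a ne) e)
    from : ∀ a → f a ≡ u → h (m a b₀) ≡ Q u (g b₀)
    from a refl with a ≟ a₀
    ... | yes refl = contradiction refl nx
    ... | no ne = sym (ex a ne)

  -- Row `a₀` is the only row of its label that fails to supply a symbol of class `Q (f a₀) (g b₀)`,
  -- and no row of another label supplies one instead.
  onlyBad-at : ∀ {a₀ b₀} → OnlyBad a₀ b₀ → suc (Nh (Q (f a₀) (g b₀))) ≡ Nf (f a₀)
  onlyBad-at {a₀} {b₀} (ex , bad) = sym (trans (#-remove (λ a → f a ≟ f a₀) a₀ refl) (cong suc (sym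
      (trans (sym (col# (λ t → h t ≟ Q (f a₀) (g b₀)) b₀)) (#-cong _ _ to from)))))
    where
    to : ∀ a → h (m a b₀) ≡ Q (f a₀) (g b₀) → f a ≡ f a₀ × a ≢ a₀
    to a e with a ≟ a₀
    ... | yes refl = contradiction (sym e) bad
    ... | no ne = col (g b₀) (trans (ex a ne) e) , ne
    from : ∀ a → f a ≡ f a₀ × a ≢ a₀ → h (m a b₀) ≡ Q (f a₀) (g b₀)
    from a (e , ne) = trans (sym (ex a ne)) (cong (λ u → Q u (g b₀)) e)

  -- In the same block the good column would give the class `Q (f a₀) (g b₀)` the multiplicity of
  -- the row label `f a₀`, the faulty one gives it one less.
  good≢onlyBad : ∀ {b₁ a₀ b₀} → GoodC b₁ → OnlyBad a₀ b₀ → g b₁ ≢ g b₀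
  good≢onlyBad {b₁} {a₀} {b₀} G B e = ℕ.1+n≢n (trans (onlyBad-at B) (trans (sym (goodC G (f a₀))) (cong (λ v → Nh (Q (f a₀) v)) e)))

  -- One good row and one good column tie the three multiplicity functions together: `Q (f a₀)`
  -- matches the column labels of multiplicity `d` with the symbol labels of multiplicity `d`, and
  -- column `g b₀` of `Q` does the same for the row labels.
  module Common {a₀ b₀ : Fin k} (ga : GoodR a₀) (gb : GoodC b₀) where
    d : ℕ
    d = Nf (f a₀)

    Df? : Decidable (λ x → Nf x ≡ d)
    Df? x = Nf x ℕ.≟ d
    Dg? : Decidable (λ y → Ng y ≡ d)
    Dg? y = Ng y ℕ.≟ d
    Dh? : Decidable (λ z → Nh z ≡ d)
    Dh? z = Nh z ℕ.≟ d

    d-col : ∀ {b} → GoodC b → Ng (g b) ≡ d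
    d-col {b} G = trans (sym (goodR ga (g b))) (goodC G (f a₀))

    d-row : ∀ {a} → GoodR a → Nf (f a) ≡ d
    d-row {a} G = trans (sym (goodC gb (f a))) (trans (goodR G (g b₀)) (d-col gb))

    #Dh≡#Dg : # Dh? ≡ # Dg?
    #Dh≡#Dg = trans (sym (#-perm Dh? (Q (f a₀)) (λ _ _ → row (f a₀))))
      (#-cong _ _ (λ y e → trans (sym (goodR ga y)) e) (λ y e → trans (goodR ga y) e))

    #Dh≡#Df : # Dh? ≡ # Df?
    #Dh≡#Df = trans (sym (#-perm Dh? (λ x → Q x (g b₀)) (λ _ _ → col (g b₀))))
      (#-cong _ _ (λ x e → trans (sym (goodC gb x)) e) (λ x e → trans (goodC gb x) e))

-- N and M stand for the multiplicities of symbols and of rows in a subarray: a column without faults forces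
-- N (Q u v) ≡ M u for all u.
Rigid₃ : {n : ℕ} → Matrix n → Set
Rigid₃ {n} Q = ∀ (N M : Fin n → ℕ) {v₁ v₂ v₃} → v₁ ≢ v₂ → v₁ ≢ v₃ → v₂ ≢ v₃ →
  (∀ u → N (Q u v₁) ≡ M u) → (∀ u → N (Q u v₂) ≡ M u) → (∀ u → N (Q u v₃) ≡ M u) → ∀ c c′ → N c ≡ N c′

-- Two columns without faults, and a third one with a single fault, at (u₀ , v₀), where y takes the place of Q u₀ v₀.
Rigid₂ : {n : ℕ} → Matrix n → (Fin n → Fin n → Fin n → Set) → Set
Rigid₂ {n} Q Al = ∀ (N M : Fin n → ℕ) {v₀ v₁ v₂ u₀ y} → v₁ ≢ v₂ → v₁ ≢ v₀ → v₂ ≢ v₀ → Al u₀ v₀ y → y ≢ Q u₀ v₀ →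
  (∀ u → N (Q u v₁) ≡ M u) → (∀ u → N (Q u v₂) ≡ M u) →
  (∀ u → Q u v₀ ≢ Q u₀ v₀ → Q u v₀ ≢ y → N (Q u v₀) ≡ M u) → suc (N (Q u₀ v₀)) ≡ M u₀ → ⊥

module Rigidity {n k : ℕ} {Q : Matrix n} {Al : Fin n → Fin n → Fin n → Set} (C : Cancel Q) (R : Rigid₂ Q Al) (H : Hom k Q) where
  open Hom H
  open Cancel C
  open Counting C H

  -- Two good columns in different blocks, together with the faulty third, would satisfy the
  -- premises of `Rigid₂`.
  sameBlock : ∀ {a₀ b₀ b₁ b₂} → OnlyBad a₀ b₀ → Al (f a₀) (g b₀) (h (m a₀ b₀)) → GoodC b₁ → GoodC b₂ → g b₁ ≡ g b₂
  sameBlock {a₀} {b₀} {b₁} {b₂} B al G₁ G₂ with g b₁ ≟ g b₂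
  ... | yes e = e
  ... | no ne = ⊥-elim (R Nh Nf ne (good≢onlyBad G₁ B) (good≢onlyBad G₂ B) al (≢-sym (proj₂ B))
                          (goodC G₁) (goodC G₂) (onlyBad-off B) (onlyBad-at B))

  private
    two : (xs : List (Fin k)) → ¬ (∀ b → b ∉ [] → GoodC b) → (∀ b → b ∉ xs → GoodC b) → length xs + length xs < k → 1 < k
    two [] ngd gd lt = contradiction gd ngd
    two (_ ∷ _) _ _ lt = ℕ.≤-trans (s≤s (s≤s z≤n)) lt

  -- If most columns are good, then all of them lie in one block, hence so do all rows and symbols.
  fewBad : ∀ {a₀ b₀} → OnlyBad a₀ b₀ → Al (f a₀) (g b₀) (h (m a₀ b₀)) → (xs : List (Fin k)) →
           (∀ b → b ∉ xs → GoodC b) → length xs + length xs < k → ⊥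
  fewBad {a₀} {b₀} B al xs good lt = good≢onlyBad (good b₁ n₁) B v′≡
    where
    open ℕ.≤-Reasoning
    In? : Decidable (_∈ xs)
    In? b = any? (b ≟_) xs
    G = # (λ b → ¬? (In? b))
    k≤ : k ≤ length xs + G
    k≤ = begin
      k ≡⟨ #-compl In? ⟨
      # In? + G ≤⟨ ℕ.+-monoˡ-≤ G (#-cover In? xs (λ _ p → p)) ⟩
      length xs + G ∎
    len<k : length xs < k
    len<k = ℕ.≤-<-trans (ℕ.m≤m+n _ _) lt
    fr = #-fresh {k = k} (λ _ → yes tt) xs (subst (length xs <_) (sym (#-all (λ _ → yes tt) (λ _ → tt))) len<k)
    b₁ = proj₁ fr
    n₁ = proj₂ (proj₂ fr)
    G≤ : ∀ a → G ≤ Nf (f a)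
    G≤ a = begin
      G ≤⟨ #-mono _ _ (λ b nb → trans (sym (good b nb a)) (cong (Q (f a)) (sameBlock B al (good b nb) (good b₁ n₁)))) ⟩
      # (λ b → h (m a b) ≟ Q (f a) (g b₁)) ≡⟨ row# (λ t → h t ≟ Q (f a) (g b₁)) a ⟩
      Nh (Q (f a) (g b₁)) ≡⟨ goodC (good b₁ n₁) (f a) ⟩
      Nf (f a) ∎
    allf : ∀ a → f a ≡ f a₀
    allf a with f a ≟ f a₀
    ... | yes e = e
    -- Two different row labels would both have multiplicity at least `G`, so 2G ≤ k. With k ≤ |xs|
    -- + G this gives k ≤ 2|xs|, against `lt`.
    ... | no ne = contradiction (ℕ.+-cancelʳ-≤ k k (length xs + length xs) (begin
        k + k ≤⟨ ℕ.+-mono-≤ k≤ k≤ ⟩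
        length xs + G + (length xs + G) ≡⟨ ℕ.+-assoc (length xs) G _ ⟩
        length xs + (G + (length xs + G)) ≡⟨ cong (length xs +_) (ℕ.+-comm G _) ⟩
        length xs + (length xs + G + G) ≡⟨ cong (length xs +_) (ℕ.+-assoc (length xs) G G) ⟩
        length xs + (length xs + (G + G)) ≡⟨ ℕ.+-assoc (length xs) (length xs) _ ⟨
        length xs + length xs + (G + G) ≤⟨ ℕ.+-monoʳ-≤ (length xs + length xs) (ℕ.≤-trans (ℕ.+-mono-≤ (G≤ a) (G≤ a₀))
            (ℕ.≤-trans (#-disj _ _ (λ (_ : Fin k) → yes tt) (λ i e e′ → ne (trans (sym e) e′)) (λ _ _ → tt) (λ _ _ → tt)) (#≤ _))) ⟩
        length xs + length xs + k ∎)) (ℕ.<⇒≱ lt)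
    allh : ∀ t → h t ≡ Q (f a₀) (g b₁)
    allh = #-full (λ t → h t ≟ Q (f a₀) (g b₁)) (ℕ.≤-reflexive (sym (trans (goodC (good b₁ n₁) (f a₀)) (#-all _ allf))))
    other : ∃[ a ] (a ≢ a₀)
    other with #-fresh {k = k} (λ _ → yes tt) (a₀ ∷ []) (subst (1 <_) (sym (#-all (λ _ → yes tt) (λ _ → tt))) (two xs (λ gd → proj₂ B (gd b₀ (λ ()) a₀)) good lt))
    ... | a , _ , ne = a , λ e → ne (here e)
    -- All symbols have class `Q (f a₀) (g b₁)`, also the one in an exact cell of column `b₀`;
    -- cancellation puts `b₀` into the block of the good columns.
    v′≡ : g b₁ ≡ g b₀
    v′≡ with other
    ... | a , ne = row (f a₀) (sym (trans (cong (λ u → Q u (g b₀)) (sym (allf a))) (trans (proj₁ B a ne) (allh _))))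

-- Enumerating the three sets yields a subsquare of order `# X?`, and `IsNinf` excludes the orders
-- from 2 to n - 1.
closedSets : {n : ℕ} (L : Matrix n) → Cancel L → IsNinf L → {X Y Z : Fin n → Set}
  (X? : Decidable X) (Y? : Decidable Y) (Z? : Decidable Z) → # Y? ≡ # X? → # Z? ≡ # X? →
  (∀ x y → X x → Y y → Z (L x y)) → 2 ≤ # X? → n ≤ # X?
closedSets {n} L C N {X} {Y} {Z} X? Y? Z? eY eZ cl two with suc (# X?) ≤? n
... | no ≰ = s≤s⁻¹ (ℕ.≰⇒> ≰)
... | yes lt = ⊥-elim (N (# X?) two lt (r , c , sy , (λ {i} {j} → enum-inj X? i j) , (λ {i} {j} e → cast-inj eY (enum-inj Y? _ _ e)) ,
      cancel→latin _ sy m mC (λ i j e → cast-inj eZ (enum-inj Z? _ _ e)) (λ i j → sym (proj₂ (mm i j)))))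
  where
  cst : ∀ {p q : ℕ} → q ≡ p → Fin p → Fin q
  cst refl i = i
  cast-inj : ∀ {p q : ℕ} (e : q ≡ p) {i j} → cst e i ≡ cst e j → i ≡ j
  cast-inj refl e = e
  onto : ∀ {p q : ℕ} (e : q ≡ p) (i : Fin q) → ∃[ j ] cst e j ≡ i
  onto refl i = i , refl
  r c sy : Fin (# X?) → Fin n
  r = enum X?
  c j = enum Y? (cst eY j)
  sy t = enum Z? (cst eZ t)
  mm : ∀ i j → ∃[ t ] sy t ≡ L (r i) (c j)
  mm i j with enum-onto Z? (L (r i) (c j)) (cl _ _ (enum-sat X? i) (enum-sat Y? _))
  ... | t , e with onto eZ t
  ... | t′ , e′ = t′ , trans (cong (enum Z?) e′) e
  m : Matrix (# X?)
  m i j = proj₁ (mm i j)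
  mC : Cancel m
  mC = record
    { row = λ i {j} {j′} e → cast-inj eY (enum-inj Y? _ _ (Cancel.row C (r i) (trans (sym (proj₂ (mm i j))) (trans (cong sy e) (proj₂ (mm i j′))))))
    ; col = λ j {i} {i′} e → enum-inj X? _ _ (Cancel.col C (c j) (trans (sym (proj₂ (mm i j))) (trans (cong sy e) (proj₂ (mm i′ j))))) }

-- The rows, columns and symbols of maximal multiplicity form a subsquare.
module Dichotomy {n k : ℕ} {L : Matrix n} (C : Cancel L) (N : IsNinf L) (H : Hom k L)
  {a₀ b₀ : Fin k} (ga : Hom.GoodR H a₀) (gb : Hom.GoodC H b₀) where
  open Hom H
  open Counting C H
  open Common ga gb public

  dichotomy : (∀ x → Nf x ≡ d → ∃[ a ] (f a ≡ x × GoodR a)) → 2 ≤ # Df? → n ≤ # Df?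
  dichotomy sat = closedSets L C N Df? Dg? Dh? (trans (sym #Dh≡#Dg) #Dh≡#Df) #Dh≡#Df closed
    where
    closed : ∀ x y → Nf x ≡ d → Ng y ≡ d → Nh (L x y) ≡ d
    closed x y ex ey with sat x ex
    ... | a , refl , G = trans (goodR G y) ey

module InBox {n k : ℕ} {Q : Matrix n} (C : Cancel Q) (R : Rigid₃ Q) (H : Hom k Q)
  (f-inj : ∀ a a′ → Hom.f H a ≡ Hom.f H a′ → a ≡ a′) (g-inj : ∀ b b′ → Hom.g H b ≡ Hom.g H b′ → b ≡ b′)
  {b₁ b₂ b₃ : Fin k} (n₁₂ : b₁ ≢ b₂) (n₁₃ : b₁ ≢ b₃) (n₂₃ : b₂ ≢ b₃)
  (G₁ : Hom.GoodC H b₁) (G₂ : Hom.GoodC H b₂) (G₃ : Hom.GoodC H b₃) where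
  open Hom H
  open Counting C H

  -- `Rigid₃` makes all symbol multiplicities equal, hence also all row multiplicities, and that of
  -- `f b₁` is positive.
  f-onto : ∀ u → ∃[ a ] f a ≡ u
  f-onto u = #-pick (λ a → f a ≟ u) (ℕ.≤-trans (1≤# (λ a → f a ≟ f b₁) b₁ refl) (ℕ.≤-reflexive (trans (sym (goodC G₁ (f b₁)))
    (trans (R Nh Nf (λ e → n₁₂ (g-inj _ _ e)) (λ e → n₁₃ (g-inj _ _ e)) (λ e → n₂₃ (g-inj _ _ e)) (goodC G₁) (goodC G₂) (goodC G₃) _ _) (goodC G₁ u)))))

  g-onto : ∀ v → ∃[ b ] g b ≡ v
  g-onto v with #-onto {P = λ _ → ⊤} (λ _ → yes tt) g (λ b b′ _ _ → g-inj b b′) le v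
    where
    open ℕ.≤-Reasoning
    le : n ≤ # {k} {λ _ → ⊤} (λ _ → yes tt)
    le = begin
      n ≡⟨ #-all {k = n} {λ _ → ⊤} (λ _ → yes tt) (λ _ → tt) ⟨
      # {n} {λ _ → ⊤} (λ _ → yes tt) ≤⟨ #-inj _ _ (λ u → proj₁ (f-onto u)) (λ u u′ _ _ e → trans (sym (proj₂ (f-onto u))) (trans (cong f e) (proj₂ (f-onto u′)))) (λ _ _ → tt) ⟩
      # {k} {λ _ → ⊤} (λ _ → yes tt) ∎
  ... | b , _ , e = b , e

-- A homotopy into L that is exact except on the cells with i a ≡ j b ≡ 0, where symbols are moved by σ.
module LSide {n μ k : ℕ} {L : Matrix μ} (C : Cancel L) (H : Hom k L) (i j : Fin k → Fin (suc n))
  (σ : Fin μ → Fin μ) (σ-inj : ∀ z z′ → σ z ≡ σ z′ → z ≡ z′)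
  (rinj : ∀ a a′ → i a ≡ i a′ → Hom.f H a ≡ Hom.f H a′ → a ≡ a′) (cinj : ∀ b b′ → j b ≡ j b′ → Hom.g H b ≡ Hom.g H b′ → b ≡ b′)
  (ex : ∀ a b → ¬ (i a ≡ zero × j b ≡ zero) → Hom.Ex H a b)
  (sh : ∀ a b → i a ≡ zero → j b ≡ zero → Hom.h H (Hom.m H a b) ≡ σ (L (Hom.f H a) (Hom.g H b)))
  {a₀ b₀ : Fin k} (ga : Hom.GoodR H a₀) (gb : Hom.GoodC H b₀) where
  open Hom H
  open Cancel C
  open Counting C H
  open Common ga gb public

  goodRow : ∀ {a} → i a ≢ zero → GoodR a
  goodRow ne b = ex _ b (λ (e , _) → ne e)

  goodCol : ∀ {b} → j b ≢ zero → GoodC b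
  goodCol ne a = ex a _ (λ (_ , e) → ne e)

  -- Of two rows with the same label at most one lies in block row zero, by `rinj`; the other one is
  -- good.
  sat : 2 ≤ d → ∀ x → Nf x ≡ d → ∃[ a ] (f a ≡ x × GoodR a)
  sat two x e with #-pick2 (λ a → f a ≟ x) (subst (2 ≤_) (sym e) two)
  ... | a , a′ , p , p′ , ne with i a ≟ zero | i a′ ≟ zero
  ... | no q | _ = a , p , goodRow q
  ... | yes _ | no q = a′ , p′ , goodRow q
  ... | yes q | yes q′ = contradiction (rinj a a′ (trans q (sym q′)) (trans p (sym p′))) ne

  -- A row off block row zero is good, so its label has multiplicity `d` and is the only such label.
  -- A row in block row zero with another label would carry its `d` symbols of class
  -- `L (f a₀) (g b₀)` in block column zero only, where injectivity of `σ` and cancellation leave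
  -- room for just one.
  oneRow : 2 ≤ d → # Df? ≤ 1 → ∀ a → f a ≡ f a₀
  oneRow two le a with f a ≟ f a₀
  ... | yes e = e
  ... | no ne with i a ≟ zero
  ... | no q = ≤1⇒≡ Df? le (f a) (f a₀) (d-row (goodRow q)) refl
  ... | yes q with #-pick2 (λ b → h (m a b) ≟ L (f a₀) (g b₀)) (subst (2 ≤_) (sym (trans (row# (λ t → h t ≟ L (f a₀) (g b₀)) a) (goodC gb (f a₀)))) two)
  ... | b , b′ , p , p′ , b≢b′ = contradiction (cinj b b′ (trans (j0 b p) (sym (j0 b′ p′)))
          (row (f a) (σ-inj _ _ (trans (sym (sh a b q (j0 b p))) (trans p (trans (sym p′) (sh a b′ q (j0 b′ p′)))))))) b≢b′
    where
    j0 : ∀ b → h (m a b) ≡ L (f a₀) (g b₀) → j b ≡ zero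
    j0 b e with j b ≟ zero
    ... | yes r = r
    ... | no r = contradiction (col (g b₀) (trans (cong (L (f a)) (sym eq)) (trans (goodCol r a) e))) ne
      where
      eq : g b ≡ g b₀
      eq = ≤1⇒≡ Dg? (subst (_≤ 1) (trans (sym #Dh≡#Df) #Dh≡#Dg) le) (g b) (g b₀) (d-col (goodCol r)) (d-col gb)

  injRow : d ≤ 1 → ∀ a a′ → f a ≡ f a′ → a ≡ a′
  injRow le a a′ e with i a ≟ zero | i a′ ≟ zero
  ... | yes q | yes q′ = rinj a a′ (trans q (sym q′)) e
  ... | no q | _ = ≤1⇒≡ (λ x → f x ≟ f a) (subst (_≤ 1) (sym (d-row (goodRow q))) le) a a′ refl (sym e)
  ... | yes _ | no q = ≤1⇒≡ (λ x → f x ≟ f a′) (subst (_≤ 1) (sym (d-row (goodRow q))) le) a a′ e refl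

-- The finite data

nxt : Fin 3 → Fin 3
nxt zero = suc zero
nxt (suc zero) = suc (suc zero)
nxt (suc (suc zero)) = zero

NoIntercalate : {n : ℕ} → Matrix n → Set
NoIntercalate {n} Q = ∀ (i i′ j j′ : Fin n) → i ≢ i′ → Q i j ≡ Q i′ j′ → Q i j′ ≡ Q i′ j → ⊥

mask : Bool → Bool → Bool → Fin 3 → Bool
mask x y z zero = x
mask x y z (suc zero) = y
mask x y z (suc (suc zero)) = z

_==_ : {n : ℕ} → Fin n → Fin n → Bool
zero == zero = true
zero == suc _ = false
suc _ == zero = false
suc i == suc j = i == j

allB : (n : ℕ) → (Fin n → Bool) → Bool
allB zero p = true
allB (suc n) p = if p zero then allB n (p ∘ suc) else false

anyB : (n : ℕ) → (Fin n → Bool) → Bool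
anyB zero p = false
anyB (suc n) p = if p zero then true else anyB n (p ∘ suc)

cnt : {n : ℕ} → Fin n → List (Fin n) → ℕ
cnt c [] = 0
cnt c (x ∷ xs) = if x == c then suc (cnt c xs) else cnt c xs

same : {n : ℕ} → List (Fin n) → List (Fin n) → Bool
same {n} xs ys = allB n λ c → cnt c xs ≡ᵇ cnt c ys

up : {n : ℕ} → Fin n → Fin n
up c = c +ₛ 1

module Finite {n′ : ℕ} (A B : Matrix (suc n′)) (i₂ : Fin (suc n′)) (J : Fin 3 → Fin (suc n′)) where
  n : ℕ
  n = suc n′

  S : Fin 3 → Fin n
  S m = A zero (J m)

  -- true stands for the row p in block row 0, false for the row q in block row i₂.
  blk : Bool → Fin n
  blk true = zero
  blk false = i₂

  -- The class after the exchange: row `blk true` takes over `A i₂ (J m)`, which is `S (nxt m)` by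
  -- the design, and row `blk false` takes over `S m`.
  new : Bool → Fin 3 → Fin n
  new true m = S (nxt m)
  new false m = S m

  put : Bool → (Fin 3 → Bool) → Fin 3 → List (Fin n × Fin n) → List (Fin n × Fin n)
  put y t m xs = if t m then (J m , new y m) ∷ xs else xs

  switched : Bool → (Fin 3 → Bool) → List (Fin n × Fin n)
  switched y t = put y t zero (put y t (suc zero) (put y t (suc (suc zero)) []))

  plain : Bool → Maybe (Fin n) → List (Fin n × Fin n)
  plain y nothing = []
  plain y (just v) = (v , A (blk y) v) ∷ []

  boxed : Bool → Maybe (Fin n × Fin n) → List (Fin n × Fin n)
  boxed y nothing = []
  boxed y (just (_ , j)) = (j , A (blk y) j) ∷ []

  -- The exchanged row of a hypothetical subsquare as pairs of column block and class: the exchanged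
  -- columns marked by `t`, at most one clean column `V`, and the column of at most one box cell
  -- `X`. That no other columns occur is proved later.
  config : Bool → (Fin 3 → Bool) → Maybe (Fin n) → Maybe (Fin n × Fin n) → List (Fin n × Fin n)
  config y t V X = switched y t ++ plain y V ++ boxed y X

  exactRow : Fin n → List (Fin n × Fin n) → List (Fin n)
  exactRow i = map (λ e → A i (proj₁ e))

  -- The row through the box cell shows `B i j` there in place of `A i j`, so it needs a comparison
  -- of its own with the classes of the exchanged row.
  boxRow : Bool → (Fin 3 → Bool) → Maybe (Fin n) → Fin n × Fin n → List (Fin n)
  boxRow y t V (i , j) = exactRow i (switched y t ++ plain y V) ++ B i j ∷ []

  boxOK : Bool → (Fin 3 → Bool) → Maybe (Fin n) → Maybe (Fin n × Fin n) → Fin n → Bool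
  boxOK y t V nothing i = false
  boxOK y t V (just (i₀ , j)) i = (i == i₀) ∧ same (boxRow y t V (i₀ , j)) (map proj₂ (config y t V (just (i₀ , j))))

  -- Some symbol class of row y cannot be supplied, in a switched column, by any admissible row.
  stuck : Bool → (Fin 3 → Bool) → Maybe (Fin n) → Maybe (Fin n × Fin n) → Bool
  stuck y t V X = anyB 3 λ m → t m ∧ anyB n λ i →
    -- The exchanged row itself supplies one symbol of class `new y m` in this column, so a second
    -- one is required before another row labelled `i` must exist.
    ((if A i (J m) == new y m then 2 else 1) ≤ᵇ cnt (A i (J m)) classes) ∧
    (not (same (exactRow i (config y t V X)) classes) ∧ not (boxOK y t V X i))
    where
    classes = map proj₂ (config y t V X)

  free : (Fin 3 → Bool) → Fin n → Bool
  free t v = allB 3 λ m → not (t m ∧ (v == J m))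

  -- The configuration left to condition (iii) on L: row `true`, with the third exchanged column and
  -- one clean column off block column zero.
  exception : Bool → (Fin 3 → Bool) → Maybe (Fin n) → Maybe (Fin n × Fin n) → Bool
  exception true t (just (suc _)) nothing = not (t zero) ∧ (not (t (suc zero)) ∧ t (suc (suc zero)))
  exception _ _ _ _ = false

  -- Necessary conditions on a configuration: the order is at least two, a clean column avoids the
  -- exchanged blocks, and a box forces a clean column that repeats its class in the exchanged row.
  valid : Bool → (Fin 3 → Bool) → Maybe (Fin n) → Maybe (Fin n × Fin n) → Bool
  valid y t nothing nothing = 2 ≤ᵇ length (switched y t)
  valid y t nothing (just _) = false
  valid y t (just v) nothing = anyB 3 t ∧ free t v
  valid y t (just v) (just (i , j)) = anyB 3 t ∧ (free t v ∧ (not (j == v) ∧ ((B i j == A (blk y) v) ∧ not ((i == zero) ∧ (j == zero)))))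

  -- The classes that can occur in a cell of block (i , j) where the homotopy to A fails.
  data Al (i j : Fin n) : Fin n → Set where
    shifted : Al i j (up (A i j))
    box : ¬ (i ≡ zero × j ≡ zero) → Al i j (B i j)
    box↑ : ¬ (i ≡ zero × j ≡ zero) → Al i j (up (B i j))
    sw : ∀ y m → i ≡ blk y → j ≡ J m → Al i j (new y m)
    sw↑ : ∀ y m → i ≡ blk y → j ≡ J m → Al i j (up (new y m))

  G : Fin n → Fin 4 → Fin n
  G v zero = v
  G v (suc m) = J m

record Design : Set where
  field
    n′ : ℕ
    A B : Matrix (suc n′)
    i₂ : Fin (suc n′)
    J : Fin 3 → Fin (suc n′)
  open Finite A B i₂ J public
  field
    8≤n : 8 ≤ n
    AC : Cancel A
    BC : Cancel B
    -- Keeps the modified product Latin: it makes the shifted corner block consist of a single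
    -- class.
    AB₀ : B zero zero ≡ A zero zero
    AB : ∀ i j → ¬ (i ≡ zero × j ≡ zero) → A i j ≢ B i j
    i₂≢0 : i₂ ≢ zero
    J₀ : J zero ≡ zero
    J-inj : ∀ m m′ → J m ≡ J m′ → m ≡ m′
    A₂ : ∀ m → A i₂ (J m) ≡ S (nxt m)
    -- A raised cell remains a fault when it is also exchanged (`up-new`) or lies in the copy of B
    -- (`up-B`).
    up-new : ∀ y m → up (new y m) ≢ A (blk y) (J m)
    up-B : ∀ i j → ¬ (i ≡ zero × j ≡ zero) → up (B i j) ≢ A i j
    A-rigid₃ : Rigid₃ A
    Aᵀ-rigid₃ : Rigid₃ (flip A)
    B-rigid₃ : Rigid₃ B
    A-rigid₂ : Rigid₂ A Al
    Aᵀ-rigid₂ : Rigid₂ (flip A) (flip Al)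
    A-noInt : NoIntercalate A
    B-noInt : NoIntercalate B
    -- Rules out intercalates with one cell in the copy of B and three exact cells; the two
    -- disjunctions say that block row zero and block column zero are both met.
    nearInt : ∀ u₀ v₀ u v → ¬ (u₀ ≡ zero × v₀ ≡ zero) → u₀ ≡ zero ⊎ u ≡ zero → v₀ ≡ zero ⊎ v ≡ zero → u ≢ u₀ → v ≢ v₀ →
              A u v₀ ≡ A u₀ v → A u v ≢ B u₀ v₀
    isStuck : ∀ y b₀ b₁ b₂ V X → let t = mask b₀ b₁ b₂ in valid y t V X ≡ true → exception y t V X ≡ false → stuck y t V X ≡ true
    -- For subarrays whose columns occupy just the blocks `v` and `J m`: there two clean rows with
    -- different labels would have to show the same classes.
    fourCols : ∀ v i i′ → i ≢ i′ → (∀ m → v ≢ J m) → ∃[ e ] (∀ e′ → A i (G v e) ≢ A i′ (G v e′))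
    -- The block that supplies the row cycle of condition (ii) for the product.
    i₃ j₄ : Fin (suc n′)
    i₃-ok : ∀ y → i₃ ≢ blk y
    j₄-ok : ∀ m → j₄ ≢ J m
    c₃-ok : ∀ m → A i₃ j₄ ≢ S m
    c₃-box : ∀ i j → i ≢ i₃ → ¬ (i ≡ zero × j ≡ zero) → A i₃ j ≡ A i j₄ → B i j ≢ A i₃ j₄
    -- A near row cycle of A, which yields condition (iii) for the product.
    n₁ n₂ : Fin (suc n′)
    nk : Fin 3 → Fin (suc n′)
    n₁-ok : ∀ y → n₁ ≢ blk y
    n₂-ok : ∀ y → n₂ ≢ blk y
    n₁≢n₂ : n₁ ≢ n₂
    nk-ok : ∀ e m → nk e ≢ J m
    nk-inj : ∀ e e′ → nk e ≡ nk e′ → e ≡ e′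
    near₁ : A n₂ (nk zero) ≡ A n₁ (nk (suc zero))
    near₂ : A n₂ (nk (suc zero)) ≡ A n₁ (nk (suc (suc zero)))
    near₃ : A n₂ (nk (suc (suc zero))) ≡ up (A n₁ (nk zero))
    near-ok : ∀ m → A n₂ (nk (suc (suc zero))) ≢ S m
    near-noInt : ∀ i j → i ≢ n₁ → A n₁ j ≡ A i (nk (suc (suc zero))) → A i j ≢ A n₂ (nk (suc (suc zero)))

-- Soundness of the boolean tests

allB-sound : ∀ {n} (p : Fin n → Bool) → allB n p ≡ true → ∀ i → p i ≡ true
allB-sound {suc n} p e i with p zero in q
allB-sound {suc n} p e zero | true = q
allB-sound {suc n} p e (suc i) | true = allB-sound (p ∘ suc) e i
allB-sound {suc n} p () i | false

anyB-sound : ∀ {n} (p : Fin n → Bool) → anyB n p ≡ true → ∃[ i ] p i ≡ true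
anyB-sound {suc n} p e with p zero in q
... | true = zero , q
... | false with anyB-sound (p ∘ suc) e
... | i , r = suc i , r

==-sound : ∀ {n} (i j : Fin n) → (i == j) ≡ true → i ≡ j
==-sound zero zero e = refl
==-sound (suc i) (suc j) e = cong suc (==-sound i j e)

==-refl : ∀ {n} (i : Fin n) → (i == i) ≡ true
==-refl zero = refl
==-refl (suc i) = ==-refl i

≢⇒==false : ∀ {n} {i j : Fin n} → i ≢ j → (i == j) ≡ false
≢⇒==false {i = i} {j} ne with i == j in e
... | true = contradiction (==-sound i j e) ne
... | false = refl

∧-l : ∀ {x y} → x ∧ y ≡ true → x ≡ true
∧-l {true} e = refl

∧-r : ∀ {x y} → x ∧ y ≡ true → y ≡ true
∧-r {true} e = e

not-t : ∀ {x} → not x ≡ true → x ≡ false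
not-t {false} e = refl

-- Equal multiplicities by graph search

module Closure {n : ℕ} where
  -- An edge `(c , d)` stands for an equation `N c ≡ N d`. A marked vertex is one already known to
  -- have the value of the starting vertex.
  Edges : Set
  Edges = List (Fin n × Fin n)

  step : Edges → Vec Bool n → Vec Bool n
  step [] s = s
  step ((c , d) ∷ es) s = step es (if lookup s c then s [ d ]≔ true else (if lookup s d then s [ c ]≔ true else s))

  reach : ℕ → Edges → Fin n → Vec Bool n → Bool
  reach zero es x s = lookup s x
  reach (suc f) es x s = if lookup s x then true else reach f es x (step es s)

  grow : ℕ → Edges → Vec Bool n → Vec Bool n
  grow zero es s = s
  grow (suc f) es s = grow f es (step es s)

  start : Fin n → Vec Bool n
  start x = replicate n false [ x ]≔ true

  Compat : (Fin n → ℕ) → Edges → Set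
  Compat N [] = ⊤
  Compat N ((c , d) ∷ es) = N c ≡ N d × Compat N es

  module _ (N : Fin n → ℕ) (x : Fin n) where
    Inv : Vec Bool n → Set
    Inv s = ∀ c → lookup s c ≡ true → N c ≡ N x

    upd : ∀ s d → Inv s → N d ≡ N x → Inv (s [ d ]≔ true)
    upd s d I e c q with c ≟ d
    ... | yes refl = e
    ... | no ne = I c (trans (sym (V.lookup∘update′ ne s true)) q)
      where import Data.Vec.Properties as V

    step-inv : ∀ es s → Compat N es → Inv s → Inv (step es s)
    step-inv [] s _ I = I
    step-inv ((c , d) ∷ es) s (e , es≡) I with lookup s c in p
    ... | true = step-inv es _ es≡ (upd s d I (trans (sym e) (I c p)))
    ... | false with lookup s d in q
    ... | true = step-inv es _ es≡ (upd s c I (trans e (I d q)))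
    ... | false = step-inv es _ es≡ I

    start-inv : Inv (start x)
    start-inv c q with c ≟ x
    ... | yes refl = refl
    ... | no ne = contradiction (trans (sym q) (trans (V.lookup∘update′ ne (replicate n false) true) (V.lookup-replicate c false))) λ ()
      where import Data.Vec.Properties as V

    reach-sound : ∀ f es y s → Compat N es → Inv s → reach f es y s ≡ true → N y ≡ N x
    reach-sound zero es y s C I e = I y e
    reach-sound (suc f) es y s C I e with lookup s y in p
    ... | true = I y p
    ... | false = reach-sound f es y _ C (step-inv es s C I) e

    grow-sound : ∀ f es s → Compat N es → Inv s → Inv (grow f es s)
    grow-sound zero es s C I = I
    grow-sound (suc f) es s C I = grow-sound f es _ C (step-inv es s C I)

module Check {n : ℕ} (Q : Matrix n) where
  open Closure {n}
  open import Data.List using (allFin; tabulate)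

  pairs : Fin n → Fin n → List (Fin n) → Edges
  pairs v w [] = []
  pairs v w (u ∷ us) = (Q u v , Q u w) ∷ pairs v w us

  pairs-compat : ∀ N v w us → (∀ u → N (Q u v) ≡ N (Q u w)) → Compat N (pairs v w us)
  pairs-compat N v w [] e = tt
  pairs-compat N v w (u ∷ us) e = e u , pairs-compat N v w us e

  -- The equations of the faulty column that its fault cannot disturb: `x` is the class lost there
  -- and `y` the class gained.
  restr : Fin n → Fin n → Fin n → Fin n → List (Fin n) → Edges
  restr x y v w [] = []
  restr x y v w (u ∷ us) = if (Q u v == x) ∨ (Q u v == y) then restr x y v w us else (Q u v , Q u w) ∷ restr x y v w us

  restr-compat : ∀ N x y v w us → (∀ u → Q u v ≢ x → Q u v ≢ y → N (Q u v) ≡ N (Q u w)) → Compat N (restr x y v w us)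
  restr-compat N x y v w [] e = tt
  restr-compat N x y v w (u ∷ us) e with Q u v == x in p | Q u v == y in q
  ... | true | _ = restr-compat N x y v w us e
  ... | false | true = restr-compat N x y v w us e
  ... | false | false = e u (λ { r → contradiction (trans (sym p) (trans (cong (_== x) r) (==-refl x))) λ () })
                            (λ { r → contradiction (trans (sym q) (trans (cong (_== y) r) (==-refl y))) λ () }) , restr-compat N x y v w us e

  app-compat : ∀ N es fs → Compat N es → Compat N fs → Compat N (es ++ fs)
  app-compat N [] fs _ F = F
  app-compat N (_ ∷ es) fs (e , E) F = e , app-compat N es fs E F

  us : List (Fin n)
  us = allFin n

  full : Vec Bool n → Bool
  full s = allB n (lookup s)

  spans : Fin n → Fin n → Fin n → Bool
  spans v w x = full (grow n (pairs v w us) (start x))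

  connected : Fin n → Fin n → Bool
  connected v w = anyB n (spans v w)

  rigid₃ : Bool
  rigid₃ = allB n λ v₁ → allB n λ v₂ → (v₁ == v₂) ∨ allB n λ v₃ → (v₁ == v₃) ∨ ((v₂ == v₃) ∨
           anyB n (λ x → full (grow n (pairs v₁ v₂ us ++ pairs v₁ v₃ us) (start x))))

  ∨-f : ∀ {x y} → x ∨ y ≡ true → x ≡ false → y ≡ true
  ∨-f {false} e _ = e

  rigid₃-sound : rigid₃ ≡ true → Rigid₃ Q
  rigid₃-sound e N M {v₁} {v₂} {v₃} n₁₂ n₁₃ n₂₃ e₁ e₂ e₃ c c′
    with anyB-sound _ (∨-f (∨-f (allB-sound _ (∨-f (allB-sound _ (allB-sound _ e v₁) v₂) (≢⇒==false n₁₂)) v₃) (≢⇒==false n₁₃)) (≢⇒==false n₂₃))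
  ... | x , r = trans (val c) (sym (val c′))
    where
    C = app-compat N (pairs v₁ v₂ us) _ (pairs-compat N v₁ v₂ us (λ u → trans (e₁ u) (sym (e₂ u)))) (pairs-compat N v₁ v₃ us (λ u → trans (e₁ u) (sym (e₃ u))))
    val : ∀ c → N c ≡ N x
    val c = grow-sound N x n _ _ C (start-inv N x) c (allB-sound _ r c)

  each : (u₀ v₀ v₁ v₂ : Fin n) → List (Fin n) → Bool
  each u₀ v₀ v₁ v₂ [] = true
  each u₀ v₀ v₁ v₂ (y ∷ ys) =
    if (reach n (pairs v₁ v₂ us ++ restr (Q u₀ v₀) y v₀ v₁ us) (Q u₀ v₁) (start (Q u₀ v₀))) then each u₀ v₀ v₁ v₂ ys else false

  rigid₂ : (Fin n → Fin n → List (Fin n)) → Bool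
  rigid₂ al = allB n λ v₁ → allB n λ v₂ → (v₁ == v₂) ∨ (connected v₁ v₂ ∨
    allB n λ v₀ → (v₁ == v₀) ∨ ((v₂ == v₀) ∨ allB n λ u₀ → each u₀ v₀ v₁ v₂ (al u₀ v₀)))

  each-sound : ∀ {u₀ v₀ v₁ v₂ y} ys → each u₀ v₀ v₁ v₂ ys ≡ true → y ∈ ys →
    reach n (pairs v₁ v₂ us ++ restr (Q u₀ v₀) y v₀ v₁ us) (Q u₀ v₁) (start (Q u₀ v₀)) ≡ true
  each-sound {u₀} {v₀} {v₁} {v₂} (y ∷ ys) e m with reach n (pairs v₁ v₂ us ++ restr (Q u₀ v₀) y v₀ v₁ us) (Q u₀ v₁) (start (Q u₀ v₀)) in r
  each-sound (y ∷ ys) e (here refl) | true = r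
  each-sound (y ∷ ys) e (there m) | true = each-sound ys e m
  each-sound (y ∷ ys) () m | false

  -- A path from `Q u₀ v₀` to `Q u₀ v₁` gives `N (Q u₀ v₀) ≡ N (Q u₀ v₁) ≡ M u₀`, against the
  -- deficit of one in the faulty column. If the two good columns already connect all classes, `N`
  -- is constant and no path is searched.
  rigid₂-sound : (al : Fin n → Fin n → List (Fin n)) (Al : Fin n → Fin n → Fin n → Set) → (∀ {i j y} → Al i j y → y ∈ al i j) →
                 rigid₂ al ≡ true → Rigid₂ Q Al
  rigid₂-sound al Al cov e N M {v₀} {v₁} {v₂} {u₀} {y} n₁₂ n₁₀ n₂₀ a ne e₁ e₂ e₀ e₃ with connected v₁ v₂ in cn
  ... | true = ℕ.1+n≢n (trans e₃ (trans (sym (e₁ u₀)) (trans (val (Q u₀ v₁)) (sym (val (Q u₀ v₀))))))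
    where
    x = proj₁ (anyB-sound (spans v₁ v₂) cn)
    val : ∀ c → N c ≡ N x
    val c = grow-sound N x n _ (start x) (pairs-compat N v₁ v₂ us (λ u → trans (e₁ u) (sym (e₂ u)))) (start-inv N x) c (allB-sound (lookup (grow n (pairs v₁ v₂ us) (start x))) (proj₂ (anyB-sound (spans v₁ v₂) cn)) c)
  ... | false = ℕ.1+n≢n (trans e₃ (trans (sym (e₁ u₀)) (reach-sound N (Q u₀ v₀) n _ _ _
        (app-compat N (pairs v₁ v₂ us) _ (pairs-compat N v₁ v₂ us (λ u → trans (e₁ u) (sym (e₂ u)))) (restr-compat N (Q u₀ v₀) y v₀ v₁ us (λ u p q → trans (e₀ u p q) (sym (e₁ u)))))
        (start-inv N (Q u₀ v₀)) (each-sound (al u₀ v₀) ok (cov a)))))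
    where
    ok : each u₀ v₀ v₁ v₂ (al u₀ v₀) ≡ true
    ok = allB-sound _ (∨-f (∨-f (allB-sound _ (∨-f (∨-f (allB-sound _ (allB-sound _ e v₁) v₂) (≢⇒==false n₁₂)) cn) v₀) (≢⇒==false n₁₀)) (≢⇒==false n₂₀)) u₀

-- Addition of a shift

toℕ-+ₛ : ∀ {n} (a : Fin (suc n)) s → toℕ (a +ₛ s) ≡ (toℕ a + s) % suc n
toℕ-+ₛ {n} a s = F.toℕ-fromℕ< (m%n<n (toℕ a + s) (suc n))

+ₛ-injective : ∀ {n} s → s ≤ n → (a b : Fin (suc n)) → a +ₛ s ≡ b +ₛ s → a ≡ b
+ₛ-injective {n} s s≤n a b e = F.toℕ-injective (trans (sym (back a)) (trans (cong (λ x → (x + t) % suc n) eq) (back b)))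
  where
  t = suc n ∸ s
  eq : (toℕ a + s) % suc n ≡ (toℕ b + s) % suc n
  eq = trans (sym (toℕ-+ₛ a s)) (trans (cong toℕ e) (toℕ-+ₛ b s))
  back : ∀ (c : Fin (suc n)) → ((toℕ c + s) % suc n + t) % suc n ≡ toℕ c
  back c = begin
    ((toℕ c + s) % suc n + t) % suc n ≡⟨ %-distribˡ-+ ((toℕ c + s) % suc n) t (suc n) ⟩
    ((toℕ c + s) % suc n % suc n + t % suc n) % suc n ≡⟨ cong (λ x → (x + t % suc n) % suc n) (m<n⇒m%n≡m (m%n<n (toℕ c + s) (suc n))) ⟩
    ((toℕ c + s) % suc n + t % suc n) % suc n ≡⟨ %-distribˡ-+ (toℕ c + s) t (suc n) ⟨
    (toℕ c + s + t) % suc n ≡⟨ cong (_% suc n) (ℕ.+-assoc (toℕ c) s t) ⟩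
    (toℕ c + (s + t)) % suc n ≡⟨ cong (λ x → (toℕ c + x) % suc n) (ℕ.m+[n∸m]≡n (ℕ.m≤n⇒m≤1+n s≤n)) ⟩
    (toℕ c + suc n) % suc n ≡⟨ [m+n]%n≡m%n (toℕ c) (suc n) ⟩
    toℕ c % suc n ≡⟨ m<n⇒m%n≡m (F.toℕ<n c) ⟩
    toℕ c ∎
    where open ≡-Reasoning

+ₛ-moves : ∀ {n} s → 1 ≤ s → s ≤ n → (a : Fin (suc n)) → a +ₛ s ≢ a
+ₛ-moves {n} s 1≤s s≤n a e with toℕ a + s <? suc n
... | yes lt = contradiction (trans (sym (trans (toℕ-+ₛ a s) (m<n⇒m%n≡m lt))) (cong toℕ e)) (ℕ.<⇒≢ (ℕ.m<m+n (toℕ a) 1≤s) ∘′ sym)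
  where
  _∘′_ : {A B C : Set} → (B → C) → (A → B) → A → C
  (f ∘′ g) x = f (g x)
... | no ≮ = contradiction (trans (sym (trans (toℕ-+ₛ a s) wrap)) (cong toℕ e)) (ℕ.<⇒≢ less)
  where
  u = toℕ a + s ∸ suc n
  u+ : u + suc n ≡ toℕ a + s
  u+ = ℕ.m∸n+n≡m (ℕ.≮⇒≥ ≮)
  less : u < toℕ a
  less = ℕ.+-cancelʳ-< (suc n) u (toℕ a) (subst (_< toℕ a + suc n) (sym u+) (ℕ.+-monoʳ-< (toℕ a) (s≤s s≤n)))
  wrap : (toℕ a + s) % suc n ≡ u
  wrap = trans (cong (_% suc n) (sym u+)) (trans ([m+n]%n≡m%n u (suc n)) (m<n⇒m%n≡m (ℕ.<-trans less (F.toℕ<n a))))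

-- The position of `combine c z` is `M * c + z`, so a step of `M` raises `c` by one and keeps `z`,
-- with the same wrap-around as `c +ₛ 1`. Hence the choice of the new shift: a raised cell is a
-- fault in the A-coordinate alone.
combine-+ₛ : ∀ {n μ} (c : Fin (suc n)) (z : Fin (suc μ)) → combine c z +ₛ (1 * suc μ) ≡ combine (c +ₛ 1) z
combine-+ₛ {n} {μ} c z = F.toℕ-injective (trans (toℕ-+ₛ (combine c z) (1 * suc μ)) (trans step (sym (F.toℕ-combine (c +ₛ 1) z))))
  where
  open ≡-Reasoning
  M = suc μ
  N = suc n * M
  pos : toℕ (combine c z) + 1 * M ≡ M * (toℕ c + 1) + toℕ z
  pos = begin
    toℕ (combine c z) + 1 * M ≡⟨ cong₂ _+_ (F.toℕ-combine c z) (ℕ.*-identityˡ M) ⟩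
    M * toℕ c + toℕ z + M ≡⟨ ℕ.+-assoc (M * toℕ c) (toℕ z) M ⟩
    M * toℕ c + (toℕ z + M) ≡⟨ cong (M * toℕ c +_) (ℕ.+-comm (toℕ z) M) ⟩
    M * toℕ c + (M + toℕ z) ≡⟨ ℕ.+-assoc (M * toℕ c) M (toℕ z) ⟨
    M * toℕ c + M + toℕ z ≡⟨ cong (λ x → M * toℕ c + x + toℕ z) (sym (ℕ.*-identityʳ M)) ⟩
    M * toℕ c + M * 1 + toℕ z ≡⟨ cong (_+ toℕ z) (sym (ℕ.*-distribˡ-+ M (toℕ c) 1)) ⟩
    M * (toℕ c + 1) + toℕ z ∎
  step : (toℕ (combine c z) + 1 * M) % N ≡ M * toℕ (c +ₛ 1) + toℕ z
  step with toℕ c + 1 <? suc n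
  ... | yes lt = begin
    (toℕ (combine c z) + 1 * M) % N ≡⟨ cong (_% N) val ⟩
    toℕ (combine (c +ₛ 1) z) % N ≡⟨ m<n⇒m%n≡m (F.toℕ<n (combine (c +ₛ 1) z)) ⟩
    toℕ (combine (c +ₛ 1) z) ≡⟨ F.toℕ-combine (c +ₛ 1) z ⟩
    M * toℕ (c +ₛ 1) + toℕ z ∎
    where
    val = trans pos (trans (cong (λ x → M * x + toℕ z) (sym (trans (toℕ-+ₛ c 1) (m<n⇒m%n≡m lt)))) (sym (F.toℕ-combine (c +ₛ 1) z)))
  ... | no ≮ = begin
    (toℕ (combine c z) + 1 * M) % N ≡⟨ cong (_% N) (trans pos (cong (λ x → M * x + toℕ z) full)) ⟩
    (M * suc n + toℕ z) % N ≡⟨ cong (_% N) (trans (ℕ.+-comm _ (toℕ z)) (cong (toℕ z +_) (ℕ.*-comm M (suc n)))) ⟩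
    (toℕ z + N) % N ≡⟨ [m+n]%n≡m%n (toℕ z) N ⟩
    toℕ z % N ≡⟨ m<n⇒m%n≡m (ℕ.<-≤-trans (F.toℕ<n z) (ℕ.m≤m+n M (n * M))) ⟩
    toℕ z ≡⟨ cong (λ x → x + toℕ z) (sym (trans (cong (M *_) zero′) (ℕ.*-zeroʳ M))) ⟩
    M * toℕ (c +ₛ 1) + toℕ z ∎
    where
    full : toℕ c + 1 ≡ suc n
    full = ℕ.≤-antisym (subst (_≤ suc n) (ℕ.+-comm 1 (toℕ c)) (F.toℕ<n c)) (ℕ.≮⇒≥ ≮)
    zero′ : toℕ (c +ₛ 1) ≡ 0
    zero′ = trans (toℕ-+ₛ c 1) (trans (cong (_% suc n) full) (n%n≡0 (suc n)))

-- The product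

if₂ : {P X : Set} → Dec P → X → X → X
if₂ (yes _) u v = u
if₂ (no _) u v = v

if-yes : {P X : Set} (d : Dec P) {u v : X} → P → if₂ d u v ≡ u
if-yes (yes _) p = refl
if-yes (no ¬p) p = contradiction p ¬p

if-no : {P X : Set} (d : Dec P) {u v : X} → ¬ P → if₂ d u v ≡ v
if-no (yes p) ¬p = contradiction p ¬p
if-no (no _) ¬p = refl

_≟×_ : {m n : ℕ} (p q : Fin m × Fin n) → Dec (p ≡ q)
(a , b) ≟× (c , d) with a ≟ c | b ≟ d
... | yes refl | yes refl = yes refl
... | no ne | _ = no λ { refl → ne refl }
... | yes _ | no ne = no λ { refl → ne refl }

-- The N∞ square L with its shift s, and the near row cycle of condition (iii): rows R true = r₁, R false = r₂,
-- columns K m and symbols Z = (σ + s , τ σ , τ² σ).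
record Lat (D : Design) : Set where
  open Design D
  field
    μ′ : ℕ
    L : Matrix (suc μ′)
    LC : Cancel L
    L∞ : IsNinf L
    s : ℕ
    1≤s : 1 ≤ s
    s≤μ′ : s ≤ μ′
    10≤μ : 10 ≤ suc μ′
    strong : ∀ x y → ¬ HasSubsquare (replace L x y (L x y +ₛ s)) n
    R : Bool → Fin (suc μ′)
    K Z : Fin 3 → Fin (suc μ′)
    R≢0 : ∀ b → R b ≢ zero
    R≢ : R true ≢ R false
    K≢0 : ∀ m → K m ≢ zero
    K-inj : ∀ m m′ → K m ≡ K m′ → m ≡ m′
    Z₀ : Z zero ≡ L (R true) (K zero) +ₛ s
    Z₁ : Z (suc zero) ≡ L (R true) (K (suc zero))
    Z₂ : Z (suc (suc zero)) ≡ L (R true) (K (suc (suc zero)))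
    L₂ : ∀ m → L (R false) (K m) ≡ Z (nxt m)
    Z≢ : ∀ m → Z m ≢ L zero zero
    no2 : ¬ HasSubsquare (replace L (R true) (K (suc (suc zero))) (L (R false) (K (suc (suc zero))))) 2

module Base (D : Design) (Λ : Lat D) where
  open Design D public
  open Lat Λ public
  module AC = Cancel AC
  module LC = Cancel LC

  μ : ℕ
  μ = suc μ′

  σ : Fin μ → Fin μ
  σ z = z +ₛ s

  σ-inj : ∀ z z′ → σ z ≡ σ z′ → z ≡ z′
  σ-inj = +ₛ-injective s s≤μ′

  σ-moves : ∀ z → σ z ≢ z
  σ-moves = +ₛ-moves s 1≤s s≤μ′

  Pos : Set
  Pos = Fin n × Fin μ

  Az : Pos → Pos → Fin n
  Az (i , x) (j , y) = if₂ ((x ≟ zero) ×-dec (y ≟ zero)) (B i j) (A i j)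

  Lz : Pos → Pos → Fin μ
  Lz (i , x) (j , y) = if₂ ((i ≟ zero) ×-dec (j ≟ zero)) (σ (L x y)) (L x y)

  -- The product of A and L, with B in place of A in the copy x = y = 0 of A, and shifted by s in the copy i = j = 0 of L.
  P₀ : Pos → Pos → Pos
  P₀ ρ κ = Az ρ κ , Lz ρ κ

  Az-off : ∀ {i j x y} → ¬ (x ≡ zero × y ≡ zero) → Az (i , x) (j , y) ≡ A i j
  Az-off {x = x} {y} ne = if-no ((x ≟ zero) ×-dec (y ≟ zero)) ne

  Az-on : ∀ {i j x y} → x ≡ zero → y ≡ zero → Az (i , x) (j , y) ≡ B i j
  Az-on {x = x} {y} p q = if-yes ((x ≟ zero) ×-dec (y ≟ zero)) (p , q)

  Az-00 : ∀ {i j x y} → i ≡ zero → j ≡ zero → Az (i , x) (j , y) ≡ A i j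
  Az-00 {x = x} {y} refl refl with (x ≟ zero) ×-dec (y ≟ zero)
  ... | yes _ = AB₀
  ... | no _ = refl

  Lz-off : ∀ {i j x y} → ¬ (i ≡ zero × j ≡ zero) → Lz (i , x) (j , y) ≡ L x y
  Lz-off {i} {j} ne = if-no ((i ≟ zero) ×-dec (j ≟ zero)) ne

  Lz-on : ∀ {i j x y} → i ≡ zero → j ≡ zero → Lz (i , x) (j , y) ≡ σ (L x y)
  Lz-on {i} {j} p q = if-yes ((i ≟ zero) ×-dec (j ≟ zero)) (p , q)

  row : Bool → Pos
  row b = blk b , R b

  col : Fin 3 → Pos
  col m = J m , K m

  sy : Fin 3 → Pos
  sy m = S m , Z m

  -- Labels and Latin structure only. How the symbols relate to the product is stated separately,
  -- because exchanged and raised cells must be allowed.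
  record Sub : Set where
    field
      k : ℕ
      r c h : Fin k → Pos
      r-inj : ∀ a a′ → r a ≡ r a′ → a ≡ a′
      c-inj : ∀ b b′ → c b ≡ c b′ → b ≡ b′
      h-inj : ∀ t t′ → h t ≡ h t′ → t ≡ t′
      m : Matrix k
      mC : Cancel m

  module SubNotation (Σ₀ : Sub) where
    open Sub Σ₀ public
    i : Fin k → Fin n
    i a = proj₁ (r a)
    x : Fin k → Fin μ
    x a = proj₂ (r a)
    j : Fin k → Fin n
    j b = proj₁ (c b)
    y : Fin k → Fin μ
    y b = proj₂ (c b)
    cl : Fin k → Fin n
    cl t = proj₁ (h t)
    z : Fin k → Fin μ
    z t = proj₂ (h t)

    HA : Hom k A
    HA = record { f = i ; g = j ; h = cl ; m = m ; mC = mC }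
    HL : Hom k L
    HL = record { f = x ; g = y ; h = z ; m = m ; mC = mC }
    module HA = Hom HA
    module HL = Hom HL
    module CA = Counting AC HA
    module CL = Counting LC HL
    module mC = Cancel mC

    rinj : ∀ a a′ → i a ≡ i a′ → x a ≡ x a′ → a ≡ a′
    rinj a a′ p q = r-inj a a′ (cong₂ _,_ p q)
    cinj : ∀ b b′ → j b ≡ j b′ → y b ≡ y b′ → b ≡ b′
    cinj b b′ p q = c-inj b b′ (cong₂ _,_ p q)
    hinj : ∀ t t′ → cl t ≡ cl t′ → z t ≡ z t′ → t ≡ t′
    hinj t t′ p q = h-inj t t′ (cong₂ _,_ p q)

    -- The cells over the copy of B, without its corner, where `B` agrees with `A`: in the absence
    -- of exchanged and raised cells the only faults of `HA`.
    Box : Fin k → Fin k → Set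
    Box a b = (x a ≡ zero × y b ≡ zero) × ¬ (i a ≡ zero × j b ≡ zero)
    Box? : ∀ a b → Dec (Box a b)
    Box? a b = ((x a ≟ zero) ×-dec (y b ≟ zero)) ×-dec ¬? ((i a ≟ zero) ×-dec (j b ≟ zero))

    Az-plain : ∀ a b → ¬ Box a b → Az (r a) (c b) ≡ A (i a) (j b)
    Az-plain a b nb with (i a ≟ zero) ×-dec (j b ≟ zero)
    ... | yes (p , q) = Az-00 p q
    ... | no ne = Az-off (λ e → nb (e , ne))

    Az-box : ∀ a b → Box a b → Az (r a) (c b) ≡ B (i a) (j b)
    Az-box a b ((p , q) , _) = Az-on p q

-- Subsquares of the product without switched cells

record PlainSub (D : Design) (Λ : Lat D) : Set where
  open Base D Λ using (Sub; P₀; n; μ; row; col)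
  field
    Σ₀ : Sub
  open Sub Σ₀
  field
    val : ∀ a b → h (m a b) ≡ P₀ (r a) (c b)
    2≤k : 2 ≤ k
    k<nμ : k < n * μ
    -- What remains of the exchange after it has been switched back: either S met no exchanged cell,
    -- or it contains both exchanged rows.
    noBlock : (∃[ a ] r a ≡ row true) → (∃[ b ] c b ≡ col zero) → ∃[ a ] r a ≡ row false

module Plain (D : Design) (Λ : Lat D) (E : PlainSub D Λ) where
  open Base D Λ
  open PlainSub E
  open SubNotation Σ₀

  clA : ∀ a b → ¬ Box a b → HA.Ex a b
  clA a b nb = trans (sym (Az-plain a b nb)) (sym (cong proj₁ (val a b)))

  clB : ∀ a b → Box a b → cl (m a b) ≡ B (i a) (j b)
  clB a b bx = trans (cong proj₁ (val a b)) (Az-box a b bx)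

  zL : ∀ a b → ¬ (i a ≡ zero × j b ≡ zero) → HL.Ex a b
  zL a b ne = trans (sym (Lz-off ne)) (sym (cong proj₂ (val a b)))

  zσ : ∀ a b → i a ≡ zero → j b ≡ zero → z (m a b) ≡ σ (L (x a) (y b))
  zσ a b p q = trans (cong proj₂ (val a b)) (Lz-on p q)

  first : Fin k
  first = proj₁ (freshFin [] (ℕ.≤-trans (s≤s z≤n) 2≤k))

  other : ∀ (a : Fin k) → ∃[ a′ ] a′ ≢ a
  other a with freshFin (a ∷ []) 2≤k
  ... | a′ , ne = a′ , λ e → ne (here e)

  -- S lies in the shifted block, so it must be the whole block and meet the switched row cycle.
  inBlock : (∀ a → i a ≡ zero) → (∀ b → j b ≡ zero) → ⊥
  inBlock i0 j0 = i₂≢0 (trans (sym (cong proj₁ (proj₂ q))) (i0 (proj₁ q)))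
    where
    all? : (a : Fin k) → Dec ⊤
    all? _ = yes tt
    xinj : ∀ a a′ → x a ≡ x a′ → a ≡ a′
    xinj a a′ e = rinj a a′ (trans (i0 a) (sym (i0 a′))) e
    yinj : ∀ b b′ → y b ≡ y b′ → b ≡ b′
    yinj b b′ e = cinj b b′ (trans (j0 b) (sym (j0 b′))) e
    cl≡ : ∀ t → cl t ≡ A zero zero
    cl≡ t with mC.rowS first t
    ... | b , refl = trans (sym (clA first b (λ (_ , ne) → ne (i0 first , j0 b)))) (cong₂ A (i0 first) (j0 b))
    zinj : ∀ t t′ → z t ≡ z t′ → t ≡ t′
    zinj t t′ e = hinj t t′ (trans (cl≡ t) (sym (cl≡ t′))) e
    X? = λ u → F.any? (λ a → all? a ×-dec (x a ≟ u))
    Y? = λ v → F.any? (λ b → all? b ×-dec (y b ≟ v))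
    Im? = λ w → F.any? (λ t → all? t ×-dec (z t ≟ w))
    #X = trans (#-image all? x (λ a a′ _ _ → xinj a a′)) total
    #Y = trans (#-image all? y (λ a a′ _ _ → yinj a a′)) total
    #Z = trans (#-perm Im? σ σ-inj) (trans (#-image all? z (λ a a′ _ _ → zinj a a′)) total)
    μ≤k : μ ≤ k
    μ≤k = subst (μ ≤_) #X (closedSets L LC L∞ X? Y? (λ w → Im? (σ w)) (trans #Y (sym #X)) (trans #Z (sym #X))
            (λ { _ _ (a , _ , refl) (b , _ , refl) → m a b , tt , zσ a b (i0 a) (j0 b) }) (subst (2 ≤_) (sym #X) 2≤k))
    hit : (f : Fin k → Fin μ) → (∀ a a′ → f a ≡ f a′ → a ≡ a′) → ∀ u → ∃[ a ] f a ≡ u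
    hit f inj = inj⇒onto μ≤k f inj
    q : ∃[ a ] r a ≡ row false
    q = let (a , e) = hit x xinj (R true) ; (b , e′) = hit y yinj (K zero)
        in noBlock (a , cong₂ _,_ (i0 a) e) (b , cong₂ _,_ (trans (j0 b) (sym J₀)) e′)

  -- The column in block column zero shows that every symbol has class `A zero zero`. Every column
  -- has a cell outside the box, so it lies in block column zero as well.
  allRowsZero : (∀ a → i a ≡ zero) → ∀ b₀ → j b₀ ≡ zero → ⊥
  allRowsZero i0 b₀ q = inBlock i0 j0
    where
    cl≡ : ∀ t → cl t ≡ A zero zero
    cl≡ t with mC.colS b₀ t
    ... | a , refl = trans (sym (clA a b₀ (λ (_ , ne) → ne (i0 a , q)))) (cong₂ A (i0 a) q)
    j0 : ∀ b → j b ≡ zero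
    -- The column index `b` serves as a row index. If that row has L-label zero, any other row has
    -- not, since all rows share one block.
    j0 b with x b ≟ zero
    ... | no ne = AC.row zero (trans (cong (λ u → A u (j b)) (sym (i0 b))) (trans (clA b b (λ ((e , _) , _) → ne e)) (cl≡ _)))
    ... | yes e with other b
    ... | a , a≢b = AC.row zero (trans (cong (λ u → A u (j b)) (sym (i0 a)))
          (trans (clA a b (λ ((e′ , _) , _) → a≢b (rinj a b (trans (i0 a) (sym (i0 b))) (trans e′ (sym e))))) (cl≡ _)))

  allColsZero : (∀ b → j b ≡ zero) → ∀ a₀ → i a₀ ≡ zero → ⊥
  allColsZero j0 a₀ q = inBlock i0 j0
    where
    cl≡ : ∀ t → cl t ≡ A zero zero
    cl≡ t with mC.rowS a₀ t
    ... | b , refl = trans (sym (clA a₀ b (λ (_ , ne) → ne (q , j0 b)))) (cong₂ A q (j0 b))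
    i0 : ∀ a → i a ≡ zero
    i0 a with y a ≟ zero
    ... | no ne = AC.col zero (trans (cong (A (i a)) (sym (j0 a))) (trans (clA a a (λ ((_ , e) , _) → ne e)) (cl≡ _)))
    ... | yes e with other a
    ... | b , b≢a = AC.col zero (trans (cong (A (i a)) (sym (j0 b)))
          (trans (clA a b (λ ((_ , e′) , _) → b≢a (cinj b a (trans (j0 b) (sym (j0 a))) (trans e′ (sym e))))) (cl≡ _)))

  -- Rows, columns and symbols of L are constant on S, which therefore lies in a copy of A or B.
  inCopy : (∀ a b → HL.Ex a b) → (∀ a b → ¬ (i a ≡ zero × j b ≡ zero)) →
           (∀ a a′ → i a ≡ i a′ → a ≡ a′) → (∀ b b′ → j b ≡ j b′ → b ≡ b′) →
           {Q : Matrix n} → Cancel Q → Rigid₃ Q → NoIntercalate Q → (∀ a b → Q (i a) (j b) ≡ cl (m a b)) → ⊥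
  inCopy zex noCorner iinj jinj {Q} QC rig noInt ex with 3 ≤? k
  ... | no ≰ = small (proj₁ (other first)) (proj₂ (other first))
    where
    eq : ∀ {t u v} → u ≢ t → v ≢ t → u ≡ v
    eq = pairEq {P = λ _ → ⊤} (λ _ → yes tt) (subst (_≤ 2) (sym total) (s≤s⁻¹ (ℕ.≰⇒> ≰))) tt tt tt
    small : ∀ a → a ≢ first → ⊥
    small a ne = noInt (i first) (i a) (j first) (j a) (λ e → ne (sym (iinj _ _ e)))
          (trans (ex first first) (trans (cong cl (eq {t = m first a} (λ e → ne (sym (mC.row first e))) (λ e → ne (mC.col a e)))) (sym (ex a a))))
          (trans (ex first a) (trans (cong cl (eq {t = m first first} (λ e → ne (mC.row first e)) (λ e → ne (mC.col first e)))) (sym (ex a first))))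
  ... | yes 3≤k with #-pick3 {k = k} {P = λ _ → ⊤} (λ _ → yes tt) (subst (3 ≤_) (sym total) 3≤k)
  ... | _ , _ , _ , _ , _ , _ , n₁₂ , n₁₃ , n₂₃ = noCorner _ _ (proj₂ (I.f-onto zero) , proj₂ (I.g-onto zero))
    where
    HQ : Hom k Q
    HQ = record { f = i ; g = j ; h = cl ; m = m ; mC = mC }
    module I = InBox QC rig HQ iinj jinj n₁₂ n₁₃ n₂₃ (λ a → ex a _) (λ a → ex a _) (λ a → ex a _)

  -- The case of distinct L-labels, in which the box has at most one cell.
  module Thin {a₀ b₀ : Fin k} (ga : HL.GoodR a₀) (gb : HL.GoodC b₀)
              (xinj : ∀ a a′ → x a ≡ x a′ → a ≡ a′) (yinj : ∀ b b′ → y b ≡ y b′ → b ≡ b′) where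
    module Di = Dichotomy LC L∞ HL ga gb

    boxUnique : ∀ {a b a′ b′} → Box a b → Box a′ b′ → a′ ≡ a × b′ ≡ b
    boxUnique ((p , q) , _) ((p′ , q′) , _) = xinj _ _ (trans p′ (sym p)) , yinj _ _ (trans q′ (sym q))

    oneBox : 3 ≤ k → ∀ a b → Box a b → ⊥
    oneBox 3≤k a b bx = Rigidity.fewBad AC A-rigid₂ HA (only , bad) (subst (Al (i a) (j b)) (sym (clB a b bx)) (box (proj₂ bx))) (b ∷ []) good 3≤k
      where
      only : ∀ a′ → a′ ≢ a → HA.Ex a′ b
      only a′ ne = clA a′ b (λ bx′ → ne (proj₁ (boxUnique bx bx′)))
      bad : ¬ HA.Ex a b
      bad e = AB (i a) (j b) (proj₂ bx) (trans e (clB a b bx))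
      good : ∀ b′ → b′ ∉ b ∷ [] → HA.GoodC b′
      good b′ ni a′ = clA a′ b′ (λ bx′ → ni (here (proj₂ (boxUnique bx bx′))))

    -- Away from the corner block the L-labels are exact and fill L by `Di.dichotomy`. So label zero
    -- occurs among rows and columns and produces a single box cell, which `oneBox` excludes.
    noCorner⇒⊥ : (∀ a b → HL.Ex a b) → (∀ a b → ¬ (i a ≡ zero × j b ≡ zero)) → ⊥
    noCorner⇒⊥ zex nc with other first
    ... | a , ne = oneBox (ℕ.≤-trans (s≤s (s≤s (s≤s z≤n))) (ℕ.≤-trans 10≤μ (onto⇒≤ x xonto))) _ _
            ((proj₂ (xonto zero) , proj₂ (yonto zero)) , nc _ _)
      where
      one : 1 ≤ Di.d
      one = 1≤# (λ a → x a ≟ x a₀) a₀ refl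
      μ≤ : μ ≤ # Di.Df?
      μ≤ = Di.dichotomy (λ u e → let (a , p) = #-pick (λ a → x a ≟ u) (subst (1 ≤_) (sym e) one) in a , p , λ b → zex a b)
            (2≤# Di.Df? (x a) (x first) (Di.d-row (zex a)) (Di.d-row (zex first)) (λ e → ne (xinj _ _ e)))
      xonto : ∀ u → ∃[ a ] x a ≡ u
      xonto u = #-pick (λ a → x a ≟ u) (subst (1 ≤_) (sym (#-full Di.Df? μ≤ u)) one)
      yonto : ∀ v → ∃[ b ] y b ≡ v
      yonto v = #-pick (λ b → y b ≟ v) (subst (1 ≤_) (sym (#-full Di.Dg? (subst (μ ≤_) (trans (sym Di.#Dh≡#Df) Di.#Dh≡#Dg) μ≤) v)) one)

    module Corner (a⋆ b⋆ : Fin k) (ia⋆ : i a⋆ ≡ zero) (jb⋆ : j b⋆ ≡ zero) (ex : ∀ a b → HA.Ex a b) where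
      zinj : ∀ t t′ → z t ≡ z t′ → t ≡ t′
      zinj t t′ e with LC.rowS (x a₀) (z t)
      ... | v , q = ≤1⇒≡ (λ u → z u ≟ L (x a₀) v) (subst (_≤ 1) (sym (CL.goodR ga v))
              (≡⇒≤1 (λ b → y b ≟ v) (λ b b′ p p′ → yinj b b′ (trans p (sym p′))))) t t′ (sym q) (trans (sym e) (sym q))

      -- Three labels of A among the rows make all A-multiplicities equal to one number `e`.
      many : ∀ {a₁ a₂ a₃} → i a₁ ≢ i a₂ → i a₁ ≢ i a₃ → i a₂ ≢ i a₃ → ⊥
      many {a₁} {a₂} {a₃} n₁₂ n₁₃ n₂₃ with e ≤? 1
        where e = HA.Nh zero
      -- Each label of A occurs once, so the L-labels form a subsquare of order n in L with one
      -- shifted cell: here the strong allowable shift of L is used.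
      ... | yes e≤1 = strong (x a⋆) (y b⋆) (subst (HasSubsquare (replace L (x a⋆) (y b⋆) (L (x a⋆) (y b⋆) +ₛ s))) k≡n
              (x , y , z , (λ {a} {a′} → xinj a a′) , (λ {b} {b′} → yinj b b′) , cancel→latin _ z m mC zinj value))
        where
        const : ∀ c c′ → HA.Nh c ≡ HA.Nh c′
        const = Aᵀ-rigid₃ HA.Nh HA.Ng n₁₂ n₁₃ n₂₃ (CA.goodR (ex a₁)) (CA.goodR (ex a₂)) (CA.goodR (ex a₃))
        Nf≡ : ∀ u → HA.Nf u ≡ HA.Nh zero
        Nf≡ u = trans (sym (CA.goodC (λ a → ex a first) u)) (const _ _)
        Ng≡ : ∀ v → HA.Ng v ≡ HA.Nh zero
        Ng≡ v = trans (sym (CA.goodR (ex first) v)) (const _ _)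
        iinj : ∀ a a′ → i a ≡ i a′ → a ≡ a′
        iinj a a′ q = ≤1⇒≡ (λ a → i a ≟ i a′) (subst (_≤ 1) (sym (Nf≡ (i a′))) e≤1) a a′ q refl
        jinj : ∀ b b′ → j b ≡ j b′ → b ≡ b′
        jinj b b′ q = ≤1⇒≡ (λ b → j b ≟ j b′) (subst (_≤ 1) (sym (Ng≡ (j b′))) e≤1) b b′ q refl
        ionto : ∀ u → ∃[ a ] i a ≡ u
        ionto u = #-pick (λ a → i a ≟ u) (subst (1 ≤_) (trans (Nf≡ (i first)) (sym (Nf≡ u))) (1≤# (λ a → i a ≟ i first) first refl))
        k≡n : k ≡ n
        k≡n = ℕ.≤-antisym (inj⇒≤ i iinj) (onto⇒≤ i ionto)
        value : ∀ a b → replace L (x a⋆) (y b⋆) (L (x a⋆) (y b⋆) +ₛ s) (x a) (y b) ≡ z (m a b)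
        value a b with x a ≟ x a⋆ | y b ≟ y b⋆
        ... | yes p | yes q with refl ← xinj a a⋆ p | refl ← yinj b b⋆ q = sym (zσ a⋆ b⋆ ia⋆ jb⋆)
        ... | no p | _ = zL a b (λ (q , _) → p (cong x (iinj a a⋆ (trans q (sym ia⋆)))))
        ... | yes _ | no p = zL a b (λ (_ , q) → p (cong y (jinj b b⋆ (trans q (sym jb⋆)))))
      -- Otherwise the cells over `(i₂ , i₂)`, a block off the corner, give a subsquare of L of
      -- order at least two, hence all of L. Then the L-label of `a⋆` occurs again in block row
      -- `i₂`, against `xinj`.
      ... | no e≰1 = i₂≢0 (trans (sym (proj₁ (proj₂ again))) (trans (cong i (xinj _ _ (proj₂ (proj₂ again)))) ia⋆))
        where
        const : ∀ c c′ → HA.Nh c ≡ HA.Nh c′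
        const = Aᵀ-rigid₃ HA.Nh HA.Ng n₁₂ n₁₃ n₂₃ (CA.goodR (ex a₁)) (CA.goodR (ex a₂)) (CA.goodR (ex a₃))
        Nf≡ : ∀ u → HA.Nf u ≡ HA.Nh zero
        Nf≡ u = trans (sym (CA.goodC (λ a → ex a first) u)) (const _ _)
        Ng≡ : ∀ v → HA.Ng v ≡ HA.Nh zero
        Ng≡ v = trans (sym (CA.goodR (ex first) v)) (const _ _)
        I? = λ a → i a ≟ i₂
        J? = λ b → j b ≟ i₂
        S? = λ t → cl t ≟ A i₂ i₂
        X? = λ u → F.any? (λ a → I? a ×-dec (x a ≟ u))
        Y? = λ v → F.any? (λ b → J? b ×-dec (y b ≟ v))
        Z? = λ w → F.any? (λ t → S? t ×-dec (z t ≟ w))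
        #X : # X? ≡ HA.Nf i₂
        #X = #-image I? x (λ a a′ _ _ → xinj a a′)
        #Y : # Y? ≡ # X?
        #Y = trans (#-image J? y (λ b b′ _ _ → yinj b b′)) (trans (Ng≡ i₂) (sym (trans #X (Nf≡ i₂))))
        #Z : # Z? ≡ # X?
        #Z = trans (#-image S? z (λ t t′ _ _ → zinj t t′)) (trans (const _ _) (sym (trans #X (Nf≡ i₂))))
        μ≤ : μ ≤ # I?
        μ≤ = subst (μ ≤_) #X (closedSets L LC L∞ X? Y? Z? #Y #Z
          (λ { _ _ (a , p , refl) (b , q , refl) → m a b , trans (sym (ex a b)) (cong₂ A p q) , sym (zL a b (λ (r , _) → i₂≢0 (trans (sym p) r))) })
          (subst (2 ≤_) (sym (trans #X (Nf≡ i₂))) (ℕ.≰⇒> e≰1)))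
        again : ∃[ a ] (i a ≡ i₂ × x a ≡ x a⋆)
        again = #-onto I? x (λ a a′ _ _ → xinj a a′) μ≤ (x a⋆)

      two : ∀ u v → u ≢ v → (∃[ a ] i a ≡ u) → (∃[ a ] i a ≡ v) → (∀ a → i a ≡ u ⊎ i a ≡ v) → ⊥
      two u v u≢v (a₁ , refl) (a₂ , refl) all
        with b , p ← mC.rowS a₁ (m a₂ first) with a , q ← mC.colS first (m a₂ b) =
        A-noInt (i a₁) (i a₂) (j b) (j first) u≢v e (pick (all a))
        where
        e : A (i a₁) (j b) ≡ A (i a₂) (j first)
        e = trans (ex a₁ b) (trans (cong cl p) (sym (ex a₂ first)))
        e′ : A (i a) (j first) ≡ A (i a₂) (j b)
        e′ = trans (ex a first) (trans (cong cl q) (sym (ex a₂ b)))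
        pick : i a ≡ i a₁ ⊎ i a ≡ i a₂ → A (i a₁) (j first) ≡ A (i a₂) (j b)
        pick (inj₁ r) = trans (cong (λ u → A u (j first)) (sym r)) e′
        pick (inj₂ r) = contradiction (AC.col (j b) (trans e (cong (A (i a₂)) (AC.row (i a₂) (trans (cong (λ u → A u (j first)) (sym r)) e′))))) u≢v

      one : (∀ a → i a ≡ zero) → ⊥
      one i0 = inBlock i0 (λ b → AC.row zero (trans (cong (λ u → A u (j b)) (sym (i0 b)))
                 (trans (ex b b) (trans (cl≡ (m b b)) refl))))
        where
        cl≡ : ∀ t → cl t ≡ A zero zero
        cl≡ t with mC.colS b⋆ t
        ... | a , refl = trans (sym (ex a b⋆)) (cong₂ A (i0 a) jb⋆)

      exactA : ⊥
      exactA with F.any? (λ a → ¬? (i a ≟ zero))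
      ... | no none = one (λ a → dec0 (i a ≟ zero) (λ ne → none (a , ne)))
        where
        dec0 : ∀ {u : Fin n} → Dec (u ≡ zero) → (u ≢ zero → ⊥) → u ≡ zero
        dec0 (yes e) _ = e
        dec0 (no ne) f = ⊥-elim (f ne)
      ... | yes (a₁ , n₁) with F.any? (λ a → ¬? (i a ≟ zero) ×-dec ¬? (i a ≟ i a₁))
      ... | yes (a₂ , n₂ , n₂₁) = many {a⋆} {a₁} {a₂} (λ e → n₁ (trans (sym e) ia⋆)) (λ e → n₂ (trans (sym e) ia⋆)) (λ e → n₂₁ (sym e))
      ... | no none = two zero (i a₁) (≢-sym n₁) (a⋆ , ia⋆) (a₁ , refl) alt
        where
        alt : ∀ a → i a ≡ zero ⊎ i a ≡ i a₁
        alt a with i a ≟ zero | i a ≟ i a₁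
        ... | yes e | _ = inj₁ e
        ... | no _ | yes e = inj₂ e
        ... | no ne | no ne′ = contradiction (a , ne , ne′) none

    corner⇒⊥ : ∀ a⋆ b⋆ → i a⋆ ≡ zero → j b⋆ ≡ zero → ⊥
    corner⇒⊥ a⋆ b⋆ ia⋆ jb⋆ with F.any? (λ a → F.any? (Box? a))
    ... | no none = Corner.exactA a⋆ b⋆ ia⋆ jb⋆ (λ a b → clA a b (λ bx → none (a , b , bx)))
    ... | yes (a , b , bx) with 3 ≤? k
    ... | yes 3≤k = oneBox 3≤k a b bx
    ... | no ≰ with other a | other b
    ... | a′ , na | b′ , nb = nearInt (i a) (j b) (i a′) (j b′) (proj₂ bx) (ori a⋆ ia⋆) (orj b⋆ jb⋆) i≢ j≢ e₂ e₁
      where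
      eq : ∀ {t u v} → u ≢ t → v ≢ t → u ≡ v
      eq = pairEq {P = λ _ → ⊤} (λ _ → yes tt) (subst (_≤ 2) (sym total) (s≤s⁻¹ (ℕ.≰⇒> ≰))) tt tt tt
      ori : ∀ w → i w ≡ zero → i a ≡ zero ⊎ i a′ ≡ zero
      ori w p with w ≟ a
      ... | yes refl = inj₁ p
      ... | no ne = inj₂ (trans (cong i (eq {t = a} na ne)) p)
      orj : ∀ w → j w ≡ zero → j b ≡ zero ⊎ j b′ ≡ zero
      orj w p with w ≟ b
      ... | yes refl = inj₁ p
      ... | no ne = inj₂ (trans (cong j (eq {t = b} nb ne)) p)
      m₁ : m a b ≡ m a′ b′
      m₁ = eq {t = m a b′} (λ e → nb (sym (mC.row a e))) (λ e → na (mC.col b′ e))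
      m₂ : m a′ b ≡ m a b′
      m₂ = eq {t = m a b} (λ e → na (mC.col b e)) (λ e → nb (mC.row a e))
      exact : ∀ u v → (u ≢ a ⊎ v ≢ b) → HA.Ex u v
      exact u v alt = clA u v (λ bx′ → [ (λ ne → ne (proj₁ (boxUnique bx bx′))) , (λ ne → ne (proj₂ (boxUnique bx bx′))) ]′ alt)
      e₁ : A (i a′) (j b′) ≡ B (i a) (j b)
      e₁ = trans (exact a′ b′ (inj₁ na)) (trans (cong cl (sym m₁)) (clB a b bx))
      e₂ : A (i a′) (j b) ≡ A (i a) (j b′)
      e₂ = trans (exact a′ b (inj₁ na)) (trans (cong cl m₂) (sym (exact a b′ (inj₂ nb))))
      i≢ : i a′ ≢ i a
      i≢ e = AB (i a) (j b) (proj₂ bx) (trans (trans (cong (λ u → A u (j b)) (sym e)) (trans e₂ (cong (λ u → A u (j b′)) (sym e)))) e₁)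
      j≢ : j b′ ≢ j b
      j≢ e = AB (i a) (j b) (proj₂ bx) (trans (trans (cong (A (i a)) (sym e)) (trans (sym e₂) (cong (A (i a′)) (sym e)))) e₁)

  -- All labels of L occur, with equal multiplicity, so the columns over one label of L are told
  -- apart by their labels in A. `x₁`, `y₁`, `y₂` serve only as nonzero labels, the last two
  -- distinct.
  module Thick {d : ℕ} (2≤d : 2 ≤ d) (Nf≡ : ∀ u → HL.Nf u ≡ d) (Ng≡ : ∀ v → HL.Ng v ≡ d) (Nh≡ : ∀ w → HL.Nh w ≡ d) where
    x₁ y₁ y₂ : Fin μ
    x₁ = R true
    y₁ = K zero
    y₂ = K (suc zero)
    y₁≢y₂ : y₁ ≢ y₂
    y₁≢y₂ e with K-inj _ _ e
    ... | ()

    -- Rows labelled `u`, columns labelled `v` and symbols labelled `L u v` behave like a subarray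
    -- of A, as the three columns avoid the shifted block. `Rigid₃` gives all labels of A the same
    -- positive multiplicity among these rows.
    fullRow : ∀ u v → ¬ (u ≡ zero × v ≡ zero) → ∀ {b₁ b₂ b₃} → y b₁ ≡ v → y b₂ ≡ v → y b₃ ≡ v → j b₁ ≢ zero → j b₂ ≢ zero → j b₃ ≢ zero →
              b₁ ≢ b₂ → b₁ ≢ b₃ → b₂ ≢ b₃ → ∀ w → ∃[ a ] (x a ≡ u × i a ≡ w)
    fullRow u v nz {b₁} {b₂} {b₃} p₁ p₂ p₃ q₁ q₂ q₃ n₁₂ n₁₃ n₂₃ w = #-pick (M? w) (subst (1 ≤_) const (1≤# (M? (i a₁)) a₁ (xa₁ , refl)))
      where
      M? : ∀ w → Decidable (λ a → x a ≡ u × i a ≡ w)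
      M? w a = (x a ≟ u) ×-dec (i a ≟ w)
      N? : ∀ c → Decidable (λ t → z t ≡ L u v × cl t ≡ c)
      N? c t = (z t ≟ L u v) ×-dec (cl t ≟ c)
      a₁ = proj₁ (#-pick (λ a → x a ≟ u) (subst (1 ≤_) (sym (Nf≡ u)) (ℕ.≤-trans (s≤s z≤n) 2≤d)))
      xa₁ = proj₂ (#-pick (λ a → x a ≟ u) (subst (1 ≤_) (sym (Nf≡ u)) (ℕ.≤-trans (s≤s z≤n) 2≤d)))
      eqn : ∀ b → y b ≡ v → j b ≢ zero → ∀ w → # (N? (A w (j b))) ≡ # (M? w)
      eqn b p q w = trans (sym (HL.col# (N? (A w (j b))) b)) (#-cong _ _ to from)
        where
        ze : ∀ a → L (x a) v ≡ z (m a b)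
        ze a = trans (cong (L (x a)) (sym p)) (zL a b (λ (_ , e) → q e))
        ce : ∀ a → x a ≡ u → A (i a) (j b) ≡ cl (m a b)
        ce a e = clA a b (λ ((e₁ , e₂) , _) → nz (trans (sym e) e₁ , trans (sym p) e₂))
        to : ∀ a → z (m a b) ≡ L u v × cl (m a b) ≡ A w (j b) → x a ≡ u × i a ≡ w
        to a (e , e′) = let f = LC.col v (trans (ze a) e) in f , AC.col (j b) (trans (ce a f) e′)
        from : ∀ a → x a ≡ u × i a ≡ w → z (m a b) ≡ L u v × cl (m a b) ≡ A w (j b)
        from a (refl , refl) = sym (ze a) , sym (ce a refl)
      jne : ∀ {b b′} → y b ≡ v → y b′ ≡ v → b ≢ b′ → j b ≢ j b′
      jne p p′ ne e = ne (cinj _ _ e (trans p (sym p′)))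
      const : # (M? (i a₁)) ≡ # (M? w)
      const = trans (sym (eqn b₁ p₁ q₁ (i a₁))) (trans (A-rigid₃ (λ c → # (N? c)) (λ w → # (M? w)) (jne p₁ p₂ n₁₂) (jne p₁ p₃ n₁₃) (jne p₂ p₃ n₂₃)
                (eqn b₁ p₁ q₁) (eqn b₂ p₂ q₂) (eqn b₃ p₃ q₃) _ _) (eqn b₁ p₁ q₁ w))

    -- As `v` is nonzero, `fullRow` applies to every `u` and puts all `n * μ` rows of the product
    -- into S.
    no3 : ∀ {v} → v ≢ zero → ∀ {b₁ b₂ b₃} → y b₁ ≡ v → y b₂ ≡ v → y b₃ ≡ v → j b₁ ≢ zero → j b₂ ≢ zero → j b₃ ≢ zero →
          b₁ ≢ b₂ → b₁ ≢ b₃ → b₂ ≢ b₃ → ⊥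
    no3 {v} vz p₁ p₂ p₃ q₁ q₂ q₃ n₁₂ n₁₃ n₂₃ = ℕ.<⇒≱ k<nμ (onto⇒≤ {n = n * μ} (λ a → combine (i a) (x a)) onto)
      where
      onto : ∀ w → ∃[ a ] combine (i a) (x a) ≡ w
      onto w with fullRow (proj₂ (remQuot {n} μ w)) v (λ (_ , e) → vz e) p₁ p₂ p₃ q₁ q₂ q₃ n₁₂ n₁₃ n₂₃ (proj₁ (remQuot {n} μ w))
      ... | a , e , e′ = a , trans (cong₂ combine e′ e) (F.combine-remQuot {n} μ w)

    ne0 : ∀ a b u → x a ≡ u → u ≢ zero → ¬ Box a b
    ne0 a b u e nz ((p , _) , _) = nz (trans (sym e) p)

    module NoZero {v : Fin μ} (none : ¬ (∃[ b ] (y b ≡ v × j b ≡ zero))) where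
      ex : ∀ {a b} → x a ≡ x₁ → A (i a) (j b) ≡ cl (m a b)
      ex {a} {b} e = clA a b (ne0 a b x₁ e (R≢0 true))
      zz : ∀ {a b} → x a ≡ x₁ → y b ≡ v → z (m a b) ≡ L x₁ v
      zz {a} {b} e e′ = sym (trans (cong₂ L (sym e) (sym e′)) (zL a b (λ (_ , f) → none (b , e′ , f))))

      swap : d ≤ 2 → ∀ {a a′ b b′} → x a ≡ x₁ → x a′ ≡ x₁ → a ≢ a′ → y b ≡ v → y b′ ≡ v → b ≢ b′ → A (i a) (j b) ≡ A (i a′) (j b′)
      swap le {a} {a′} {b} {b′} q q′ na p p′ nb = trans (ex q) (trans (cong cl
        (pairEq (λ t → z t ≟ L x₁ v) (subst (_≤ 2) (sym (Nh≡ (L x₁ v))) le) (zz q p′) (zz q p) (zz q′ p′) (λ e → nb (mC.row a e)) (λ e → na (sym (mC.col b′ e))))) (sym (ex q′)))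

      absurd₂ : d ≤ 2 → ∃[ a ] ∃[ a′ ] (x a ≡ x₁ × x a′ ≡ x₁ × a ≢ a′) → ∃[ b ] ∃[ b′ ] (y b ≡ v × y b′ ≡ v × b ≢ b′) → ⊥
      absurd₂ le (a , a′ , q , q′ , na) (b , b′ , p , p′ , nb) = A-noInt (i a) (i a′) (j b) (j b′) (λ e → na (rinj a a′ e (trans q (sym q′))))
        (swap le q q′ na p p′ nb) (swap le q q′ na p′ p (≢-sym nb))

      absurd₃ : v ≢ zero → ∃[ b₁ ] ∃[ b₂ ] ∃[ b₃ ] (y b₁ ≡ v × y b₂ ≡ v × y b₃ ≡ v × b₁ ≢ b₂ × b₁ ≢ b₃ × b₂ ≢ b₃) → ⊥
      absurd₃ vz (b₁ , b₂ , b₃ , p₁ , p₂ , p₃ , n₁₂ , n₁₃ , n₂₃) =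
        no3 vz p₁ p₂ p₃ (λ e → none (b₁ , p₁ , e)) (λ e → none (b₂ , p₂ , e)) (λ e → none (b₃ , p₃ , e)) n₁₂ n₁₃ n₂₃

    abstract
      -- Without such a column the shift is not felt over `v`: `d ≥ 3` contradicts `no3`, and
      -- `d = 2` leaves two symbols for the four cells over `(x₁ , v)`, an intercalate of A.
      hasZero : ∀ v → v ≢ zero → ∃[ b ] (y b ≡ v × j b ≡ zero)
      hasZero v vz = stable (F.any? (λ b → (y b ≟ v) ×-dec (j b ≟ zero))) (λ none → decide (3 ≤? d)
        (λ 3≤d → NoZero.absurd₃ none vz (#-pick3 (λ b → y b ≟ v) (subst (3 ≤_) (sym (Ng≡ v)) 3≤d)))
        (λ ≰ → NoZero.absurd₂ none (s≤s⁻¹ (ℕ.≰⇒> ≰)) (#-pick2 (λ a → x a ≟ x₁) (subst (2 ≤_) (sym (Nf≡ x₁)) 2≤d)) (#-pick2 (λ b → y b ≟ v) (subst (2 ≤_) (sym (Ng≡ v)) 2≤d))))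

    goodRow : ∀ {a} → x a ≢ zero → HA.GoodR a
    goodRow ne b = clA _ b (λ ((p , _) , _) → ne p)
    goodCol : ∀ {b} → y b ≢ zero → HA.GoodC b
    goodCol ne a = clA a _ (λ ((_ , p) , _) → ne p)

    OffZero : Fin μ → Fin k → Set
    OffZero v b = y b ≡ v × j b ≢ zero
    offZero? : ∀ v → Decidable (OffZero v)
    offZero? v b = (y b ≟ v) ×-dec ¬? (j b ≟ zero)
    Hit : Fin μ → Fin n → Set
    Hit v w = ∃[ b ] (OffZero v b × j b ≡ w)
    hit? : ∀ v → Decidable (Hit v)
    hit? v w = F.any? (λ b → offZero? v b ×-dec (j b ≟ w))

    few : ∀ v → v ≢ zero → # (hit? v) ≤ 2
    few v vz = subst (_≤ 2) (sym (#-image (offZero? v) j (λ b b′ (p , _) (p′ , _) e → cinj b b′ e (trans p (sym p′)))))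
      (decide (3 ≤? # (offZero? v)) (λ 3≤ → ⊥-elim (absurd (#-pick3 (offZero? v) 3≤))) (λ ≰ → s≤s⁻¹ (ℕ.≰⇒> ≰)))
      where
      absurd : ∃[ b₁ ] ∃[ b₂ ] ∃[ b₃ ] (OffZero v b₁ × OffZero v b₂ × OffZero v b₃ × b₁ ≢ b₂ × b₁ ≢ b₃ × b₂ ≢ b₃) → ⊥
      absurd (b₁ , b₂ , b₃ , (p₁ , q₁) , (p₂ , q₂) , (p₃ , q₃) , n₁₂ , n₁₃ , n₂₃) = no3 vz p₁ p₂ p₃ q₁ q₂ q₃ n₁₂ n₁₃ n₂₃

    -- By rigidity of the transpose each label of A has as many columns as label zero, at least μ -
    -- 1 by `hasZero`. Columns with the same label of A have distinct L-labels, so they cannot miss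
    -- both `y₁` and `y₂`. But by `few` these two L-labels reach at most four nonzero labels of A.
    three : ∀ {a₁ a₂ a₃} → x a₁ ≢ zero → x a₂ ≢ zero → x a₃ ≢ zero → i a₁ ≢ i a₂ → i a₁ ≢ i a₃ → i a₂ ≢ i a₃ → ⊥
    three {a₁} {a₂} {a₃} z₁ z₂ z₃ n₁₂ n₁₃ n₂₃ = ℕ.<⇒≱ (ℕ.≤-trans (s≤s (s≤s (s≤s (s≤s (s≤s (s≤s z≤n)))))) 8≤n)
      (subst (_≤ 5) (trans (sym (#-remove {P = λ _ → ⊤} (λ _ → yes tt) (zero {n′}) tt)) total) (s≤s (ℕ.≤-trans
        (#-union (hit? y₁) (hit? y₂) (without (λ _ → yes tt) zero) hit)
        (ℕ.+-mono-≤ (few y₁ (K≢0 _)) (few y₂ (K≢0 _))))))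
      where
      Ng-const : ∀ w → HA.Ng w ≡ HA.Ng zero
      Ng-const w = trans (sym (CA.goodR (goodRow z₁) w)) (trans (Aᵀ-rigid₃ HA.Nh HA.Ng n₁₂ n₁₃ n₂₃ (CA.goodR (goodRow z₁)) (CA.goodR (goodRow z₂)) (CA.goodR (goodRow z₃)) _ _) (CA.goodR (goodRow z₁) zero))
      nz? : (v : Fin μ) → Dec (⊤ × v ≢ zero)
      nz? = without (λ _ → yes tt) zero
      choose : ∀ v → ∃[ b ] (v ≢ zero → y b ≡ v × j b ≡ zero)
      choose v = decide (v ≟ zero) (λ e → first , λ nz → contradiction e nz) (λ nz → proj₁ (hasZero v nz) , λ _ → proj₂ (hasZero v nz))
      at0 : Fin μ → Fin k
      at0 v = proj₁ (choose v)
      at0-spec : ∀ v → v ≢ zero → y (at0 v) ≡ v × j (at0 v) ≡ zero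
      at0-spec v = proj₂ (choose v)
      Ng0≥ : # nz? ≤ HA.Ng zero
      Ng0≥ = #-inj nz? (λ b → j b ≟ zero) at0 (λ v v′ (_ , p) (_ , p′) e → trans (sym (proj₁ (at0-spec v p))) (trans (cong y e) (proj₁ (at0-spec v′ p′))))
               (λ v (_ , p) → proj₂ (at0-spec v p))
      off₁ : (v : Fin μ) → Dec (⊤ × v ≢ y₁)
      off₁ = without (λ _ → yes tt) y₁
      missed : ∀ w → w ≢ zero → ¬ Hit y₁ w → ¬ Hit y₂ w → ⊥
      missed w wz n₁ n₂ = ℕ.1+n≰n (begin
        suc (# (without off₁ y₂)) ≡⟨ #-remove off₁ y₂ (tt , ≢-sym y₁≢y₂) ⟨
        # off₁ ≡⟨ ℕ.suc-injective (trans (sym (#-remove {P = λ _ → ⊤} (λ _ → yes tt) y₁ tt)) (#-remove {P = λ _ → ⊤} (λ _ → yes tt) zero tt)) ⟩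
        # nz? ≤⟨ Ng0≥ ⟩
        HA.Ng zero ≡⟨ Ng-const w ⟨
        HA.Ng w ≤⟨ #-inj (λ b → j b ≟ w) (without off₁ y₂) y (λ b b′ p p′ e → cinj b b′ (trans p (sym p′)) e)
           (λ b p → (tt , λ e → n₁ (b , (e , λ q → wz (trans (sym p) q)) , p)) , λ e → n₂ (b , (e , λ q → wz (trans (sym p) q)) , p)) ⟩
        # (without off₁ y₂) ∎)
        where open ℕ.≤-Reasoning
      hit : ∀ w → ⊤ × w ≢ zero → Hit y₁ w ⊎ Hit y₂ w
      hit w (_ , wz) = decide (hit? y₁ w) inj₁ (λ n₁ → decide (hit? y₂ w) inj₂ (λ n₂ → ⊥-elim (missed w wz n₁ n₂)))

    module Two {a₁ a₂ : Fin k} (xa₁ : x a₁ ≡ x₁) (xa₂ : x a₂ ≡ x₁) (ia₁ : i a₁ ≡ zero) (ia₂ : i a₂ ≢ zero)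
               (rows : ∀ a → x a ≢ zero → i a ≡ zero ⊎ i a ≡ i a₂) where
      d≤2 : d ≤ 2
      d≤2 = subst (_≤ 2) (Nf≡ x₁) (#-cover (λ a → x a ≟ x₁) (a₁ ∷ a₂ ∷ []) mem)
        where
        mem : ∀ a → x a ≡ x₁ → a ∈ a₁ ∷ a₂ ∷ []
        mem a e = [ (λ p → here (rinj a a₁ (trans p (sym ia₁)) (trans e (sym xa₁)))) , (λ p → there (here (rinj a a₂ p (trans e (sym xa₂))))) ]′
                    (rows a (λ q → R≢0 true (trans (sym e) q)))
      ex : ∀ a b → x a ≡ x₁ → A (i a) (j b) ≡ cl (m a b)
      ex a b e = clA a b (ne0 a b x₁ e (R≢0 true))
      module Partner (v : Fin μ) (b b′ : Fin k) (p : y b ≡ v) (q : j b ≡ zero) (p′ : y b′ ≡ v) (nb : b′ ≢ b) where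
        jb′ : j b′ ≢ zero
        jb′ e = nb (cinj b′ b (trans e (sym q)) (trans p′ (sym p)))
        zz : ∀ a b → x a ≡ x₁ → y b ≡ v → ¬ (i a ≡ zero × j b ≡ zero) → z (m a b) ≡ L x₁ v
        zz a b e e′ ne = sym (trans (cong₂ L (sym e) (sym e′)) (zL a b ne))
        m₁ : m a₁ b′ ≡ m a₂ b
        m₁ = pairEq (λ t → z t ≟ L x₁ v) (subst (_≤ 2) (sym (Nh≡ (L x₁ v))) d≤2)
               (zz a₂ b′ xa₂ p′ (λ (e , _) → ia₂ e)) (zz a₁ b′ xa₁ p′ (λ (_ , e) → jb′ e)) (zz a₂ b xa₂ p (λ (e , _) → ia₂ e))
               (λ e → ia₂ (trans (cong i (sym (mC.col b′ e))) ia₁)) (λ e → nb (sym (mC.row a₂ e)))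
        eqA : A zero (j b′) ≡ A (i a₂) zero
        eqA = begin
          A zero (j b′) ≡⟨ cong (λ u → A u (j b′)) ia₁ ⟨
          A (i a₁) (j b′) ≡⟨ ex a₁ b′ xa₁ ⟩
          cl (m a₁ b′) ≡⟨ cong cl m₁ ⟩
          cl (m a₂ b) ≡⟨ ex a₂ b xa₂ ⟨
          A (i a₂) (j b) ≡⟨ cong (A (i a₂)) q ⟩
          A (i a₂) zero ∎
          where open ≡-Reasoning

      abstract
        -- Comparing the two rows over `x₁` determines the block of the second column over `v`, and
        -- the answer does not depend on `v`.
        partner : ∀ v → v ≢ zero → ∃[ b ] (y b ≡ v × j b ≢ zero × A zero (j b) ≡ A (i a₂) zero)
        partner v vz = b′ , p′ , Pt.jb′ , Pt.eqA
          where
          h₀ : ∃[ b ] (y b ≡ v × j b ≡ zero)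
          h₀ = hasZero v vz
          b : Fin k
          b = proj₁ h₀
          h₁ : ∃[ b′ ] (y b′ ≡ v × b′ ∉ b ∷ [])
          h₁ = #-fresh (λ b → y b ≟ v) (b ∷ []) (subst (2 ≤_) (sym (Ng≡ v)) 2≤d)
          b′ : Fin k
          b′ = proj₁ h₁
          p′ : y b′ ≡ v
          p′ = proj₁ (proj₂ h₁)
          module Pt = Partner v b b′ (proj₁ (proj₂ h₀)) (proj₂ (proj₂ h₀)) p′ (λ e → proj₂ (proj₂ h₁) (here e))

      nonzero : ∀ {u} w w′ → i w ≡ u → i w′ ≡ u → w ≢ w′ → u ≡ zero ⊎ u ≡ i a₂
      nonzero {u} w w′ e e′ ne = decide (x w ≟ zero)
        (λ q → decide (x w′ ≟ zero) (λ q′ → contradiction (rinj w w′ (trans e (sym e′)) (trans q (sym q′))) ne) (over w′ e′))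
        (over w e)
        where
        over : ∀ w → i w ≡ u → x w ≢ zero → u ≡ zero ⊎ u ≡ i a₂
        over w e q = [ (λ f → inj₁ (trans (sym e) f)) , (λ f → inj₂ (trans (sym e) f)) ]′ (rows w q)

      -- The partners over `y₁` and `y₂` share a block, whose label thus has multiplicity at least
      -- two; through a good row and a good column so has the row label `u`. By `nonzero`, `u` is
      -- zero, which gives an intercalate of A, or `i a₂`, which puts the partner into block column
      -- zero.
      clash : ∀ b₀ b₁ b₂ → y b₀ ≡ y₁ → j b₀ ≡ zero → y b₁ ≡ y₁ → j b₁ ≢ zero → A zero (j b₁) ≡ A (i a₂) zero →
              y b₂ ≡ y₂ → A zero (j b₂) ≡ A (i a₂) zero → ∀ u → A u zero ≡ A (i a₂) (j b₁) → ⊥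
      clash b₀ b₁ b₂ p₀ q₀ p₁ q₁ e₁ p₂ e₂ u eu = fin (nonzero _ _ (proj₁ (proj₂ (proj₂ ws))) (proj₁ (proj₂ (proj₂ (proj₂ ws)))) (proj₂ (proj₂ (proj₂ (proj₂ ws)))))
        where
        2≤ : 2 ≤ HA.Nf u
        2≤ = begin
          2 ≤⟨ 2≤# (λ b → j b ≟ j b₁) b₁ b₂ refl (AC.row zero (trans e₂ (sym e₁))) (λ e → y₁≢y₂ (trans (sym p₁) (trans (cong y e) p₂))) ⟩
          HA.Ng (j b₁) ≡⟨ CA.goodR (goodRow {a₂} (λ q → R≢0 true (trans (sym xa₂) q))) (j b₁) ⟨
          HA.Nh (A (i a₂) (j b₁)) ≡⟨ cong HA.Nh (trans (sym eu) (cong (A u) (sym q₀))) ⟩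
          HA.Nh (A u (j b₀)) ≡⟨ CA.goodC (goodCol {b₀} (λ q → K≢0 zero (trans (sym p₀) q))) u ⟩
          HA.Nf u ∎
          where open ℕ.≤-Reasoning
        ws : ∃[ w ] ∃[ w′ ] (i w ≡ u × i w′ ≡ u × w ≢ w′)
        ws = #-pick2 (λ a → i a ≟ u) 2≤
        fin : u ≡ zero ⊎ u ≡ i a₂ → ⊥
        fin (inj₁ e) = A-noInt zero (i a₂) zero (j b₁) (≢-sym ia₂) (trans (cong (λ w → A w zero) (sym e)) eu) e₁
        fin (inj₂ e) = q₁ (sym (AC.row (i a₂) (trans (cong (λ w → A w zero) (sym e)) eu)))

      absurd : ⊥
      absurd = clash (proj₁ h₀) (proj₁ h₁) (proj₁ h₂) (proj₁ (proj₂ h₀)) (proj₂ (proj₂ h₀)) (proj₁ (proj₂ h₁)) (proj₁ (proj₂ (proj₂ h₁)))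
                 (proj₂ (proj₂ (proj₂ h₁))) (proj₁ (proj₂ h₂)) (proj₂ (proj₂ (proj₂ h₂))) (proj₁ cs) (proj₂ cs)
        where
        h₀ : ∃[ b ] (y b ≡ y₁ × j b ≡ zero)
        h₀ = hasZero y₁ (K≢0 _)
        h₁ : ∃[ b ] (y b ≡ y₁ × j b ≢ zero × A zero (j b) ≡ A (i a₂) zero)
        h₁ = partner y₁ (K≢0 _)
        h₂ : ∃[ b ] (y b ≡ y₂ × j b ≢ zero × A zero (j b) ≡ A (i a₂) zero)
        h₂ = partner y₂ (K≢0 _)
        cs : ∃[ u ] A u zero ≡ A (i a₂) (j (proj₁ h₁))
        cs = AC.colS zero _

    module Rows {a₁ a₂ : Fin k} (p₁ : x a₁ ≡ x₁) (p₂ : x a₂ ≡ x₁) (ne : a₁ ≢ a₂) where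
      i≢ : i a₁ ≢ i a₂
      i≢ e = ne (rinj _ _ e (trans p₁ (sym p₂)))
      nz : ∀ {a} → x a ≡ x₁ → x a ≢ zero
      nz p q = R≢0 true (trans (sym p) q)

      module Only (alt : ∀ a → x a ≢ zero → i a ≡ i a₁ ⊎ i a ≡ i a₂) where
        d≤2 : d ≤ 2
        d≤2 = subst (_≤ 2) (Nf≡ x₁) (#-cover (λ a → x a ≟ x₁) (a₁ ∷ a₂ ∷ [])
          (λ a e → [ (λ p → here (rinj a a₁ p (trans e (sym p₁)))) , (λ p → there (here (rinj a a₂ p (trans e (sym p₂))))) ]′ (alt a (nz e))))

        zz : ∀ {a b} → x a ≡ x₁ → i a ≢ zero → y b ≡ y₁ → z (m a b) ≡ L x₁ y₁
        zz {a} {b} e ni e′ = sym (trans (cong₂ L (sym e) (sym e′)) (zL a b (λ (f , _) → ni f)))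
        ex : ∀ {a b} → x a ≡ x₁ → A (i a) (j b) ≡ cl (m a b)
        ex {a} {b} e = clA a b (ne0 a b x₁ e (R≢0 true))

        swap : i a₁ ≢ zero → i a₂ ≢ zero → ∀ {b b′} → y b ≡ y₁ → y b′ ≡ y₁ → b ≢ b′ → A (i a₁) (j b) ≡ A (i a₂) (j b′)
        swap n₁ n₂ {b} {b′} q q′ nb = trans (ex p₁) (trans (cong cl (pairEq (λ t → z t ≟ L x₁ y₁) (subst (_≤ 2) (sym (Nh≡ (L x₁ y₁))) d≤2)
          (zz p₁ n₁ q′) (zz p₁ n₁ q) (zz p₂ n₂ q′) (λ e → nb (mC.row a₁ e)) (λ e → ne (sym (mC.col b′ e))))) (sym (ex p₂)))

        offZero : i a₁ ≢ zero → i a₂ ≢ zero → ∃[ b ] ∃[ b′ ] (y b ≡ y₁ × y b′ ≡ y₁ × b ≢ b′) → ⊥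
        offZero n₁ n₂ (b , b′ , q , q′ , nb) = A-noInt (i a₁) (i a₂) (j b) (j b′) i≢ (swap n₁ n₂ q q′ nb) (swap n₁ n₂ q′ q (≢-sym nb))

        split : Dec (i a₁ ≡ zero) → Dec (i a₂ ≡ zero) → ⊥
        split (yes e) _ = Two.absurd p₁ p₂ e (λ e′ → i≢ (trans e (sym e′))) (λ a xz → [ (λ f → inj₁ (trans f e)) , inj₂ ]′ (alt a xz))
        split (no _) (yes e) = Two.absurd p₂ p₁ e (λ e′ → i≢ (trans e′ (sym e))) (λ a xz → [ inj₂ , (λ f → inj₁ (trans f e)) ]′ (alt a xz))
        split (no n₁) (no n₂) = offZero n₁ n₂ (#-pick2 (λ b → y b ≟ y₁) (subst (2 ≤_) (sym (Ng≡ y₁)) 2≤d))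

      rows⇒⊥ : ⊥
      rows⇒⊥ = decide (F.any? (λ a → ¬? (x a ≟ zero) ×-dec (¬? (i a ≟ i a₁) ×-dec ¬? (i a ≟ i a₂))))
        (λ (a , xz , n₁ , n₂) → three {a₁} {a₂} {a} (nz p₁) (nz p₂) xz i≢ (≢-sym n₁) (≢-sym n₂))
        (λ none → Only.split (λ a xz → decide (i a ≟ i a₁) inj₁ (λ e → decide (i a ≟ i a₂) inj₂ (λ e′ → ⊥-elim (none (a , xz , e , e′))))) (i a₁ ≟ zero) (i a₂ ≟ zero))

    thick : ⊥
    thick = go (#-pick2 (λ a → x a ≟ x₁) (subst (2 ≤_) (sym (Nf≡ x₁)) 2≤d))
      where
      go : ∃[ a ] ∃[ a′ ] (x a ≡ x₁ × x a′ ≡ x₁ × a ≢ a′) → ⊥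
      go (a₁ , a₂ , p₁ , p₂ , ne) = Rows.rows⇒⊥ p₁ p₂ ne

  module Core {a₀ b₀ : Fin k} (ga : HL.GoodR a₀) (gb : HL.GoodC b₀) where
    module Di = Dichotomy LC L∞ HL ga gb
    module RS = LSide LC HL i j σ σ-inj rinj cinj zL zσ ga gb
    module CS = LSide (flipC LC) (flipH HL) j i σ σ-inj cinj rinj (λ b a ne → zL a b (λ (p , q) → ne (q , p))) (λ b a p q → zσ a b q p) gb ga

    d′≡d : HL.Ng (y b₀) ≡ Di.d
    d′≡d = Di.d-col gb

    #D′≡#D : # CS.Df? ≡ # Di.Df?
    #D′≡#D = trans (#-cong CS.Df? Di.Dg? (λ v e → trans e d′≡d) (λ v e → trans e (sym d′≡d))) (trans (sym Di.#Dh≡#Dg) Di.#Dh≡#Df)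

    -- All of S lies over one cell of L. If S meets the corner block, the shift contradicts the
    -- single symbol label; otherwise S lies in an unshifted part of a copy of A or B.
    copy : 2 ≤ Di.d → # Di.Df? ≤ 1 → ⊥
    copy two le with F.any? (λ a → F.any? (λ b → (i a ≟ zero) ×-dec (j b ≟ zero)))
    ... | yes (a , b , p , q) = σ-moves (L (x a) (y b)) (trans (sym (zσ a b p q)) (trans (allz (m a b)) (sym (cong₂ L (xall a) (yall b)))))
      where
      xall = RS.oneRow two le
      yall = CS.oneRow (subst (2 ≤_) (sym d′≡d) two) (subst (_≤ 1) (sym #D′≡#D) le)
      allz : ∀ t → z t ≡ L (x a₀) (y b₀)
      allz = #-full (λ t → z t ≟ L (x a₀) (y b₀)) (ℕ.≤-reflexive (sym (trans (CL.goodC gb (x a₀)) (#-all _ xall))))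
    ... | no none = pick ((x a₀ ≟ zero) ×-dec (y b₀ ≟ zero))
      where
      xall = RS.oneRow two le
      yall = CS.oneRow (subst (2 ≤_) (sym d′≡d) two) (subst (_≤ 1) (sym #D′≡#D) le)
      nc : ∀ a b → ¬ (i a ≡ zero × j b ≡ zero)
      nc a b e = none (a , b , e)
      iinj : ∀ a a′ → i a ≡ i a′ → a ≡ a′
      iinj a a′ e = rinj a a′ e (trans (xall a) (sym (xall a′)))
      jinj : ∀ b b′ → j b ≡ j b′ → b ≡ b′
      jinj b b′ e = cinj b b′ e (trans (yall b) (sym (yall b′)))
      pick : Dec (x a₀ ≡ zero × y b₀ ≡ zero) → ⊥
      pick (yes (p , q)) = inCopy (λ a b → zL a b (nc a b)) nc iinj jinj BC B-rigid₃ B-noInt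
        (λ a b → sym (clB a b ((trans (xall a) p , trans (yall b) q) , nc a b)))
      pick (no ne) = inCopy (λ a b → zL a b (nc a b)) nc iinj jinj AC A-rigid₃ A-noInt
        (λ a b → clA a b (λ ((p , q) , _) → ne (trans (sym (xall a)) p , trans (sym (yall b)) q)))

    module T = Thin ga gb
    -- Cases by `d` and the number of labels of multiplicity `d`: if `d ≤ 1` the L-labels are
    -- distinct; one label means a copy of A or B; two labels mean all labels, because L is N∞.
    core : (∀ a⋆ b⋆ → ¬ (i a⋆ ≡ zero × j b⋆ ≡ zero)) ⊎ (∃[ a⋆ ] ∃[ b⋆ ] (i a⋆ ≡ zero × j b⋆ ≡ zero)) → ⊥
    core alt with 2 ≤? Di.d
    ... | no ≰ = [ (λ nc → T.noCorner⇒⊥ xinj yinj (λ a b → zL a b (nc a b)) nc) , (λ (a , b , p , q) → T.corner⇒⊥ xinj yinj a b p q) ]′ alt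
      where
      xinj = RS.injRow (s≤s⁻¹ (ℕ.≰⇒> ≰))
      yinj = CS.injRow (subst (_≤ 1) (sym d′≡d) (s≤s⁻¹ (ℕ.≰⇒> ≰)))
    ... | yes two with 2 ≤? # Di.Df?
    ... | no ≰ = copy two (s≤s⁻¹ (ℕ.≰⇒> ≰))
    ... | yes 2≤D = Thick.thick two (#-full Di.Df? μ≤) (#-full Di.Dg? (subst (μ ≤_) (trans (sym Di.#Dh≡#Df) Di.#Dh≡#Dg) μ≤)) (#-full Di.Dh? (subst (μ ≤_) (sym Di.#Dh≡#Df) μ≤))
      where
      μ≤ : μ ≤ # Di.Df?
      μ≤ = Di.dichotomy (RS.sat two) 2≤D

  absurd₀ : ⊥
  absurd₀ = decide (F.any? (λ a → F.any? (λ b → (i a ≟ zero) ×-dec (j b ≟ zero))))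
    (λ (a , b , p , q) → decide (F.any? (λ a → ¬? (i a ≟ zero)))
      (λ (a₀ , na) → decide (F.any? (λ b → ¬? (j b ≟ zero)))
        (λ (b₀ , nb) → Core.core {a₀} {b₀} (λ b → zL a₀ b (λ (e , _) → na e)) (λ a → zL a b₀ (λ (_ , e) → nb e)) (inj₂ (a , b , p , q)))
        (λ none → allColsZero (λ b′ → stable (j b′ ≟ zero) (λ ne → none (b′ , ne))) a p))
      (λ none → allRowsZero (λ a′ → stable (i a′ ≟ zero) (λ ne → none (a′ , ne))) b q))
    (λ none → Core.core {first} {first} (λ b → zL first b (λ e → none (first , b , e))) (λ a → zL a first (λ e → none (a , first , e)))
      (inj₁ (λ a b e → none (a , b , e))))

-- Subarrays with switched cells in one row

-- A subarray whose L-coordinates agree with P₀ outside the cells W, all of which lie in one row.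
record LConf (D : Design) (Λ : Lat D) : Set₁ where
  open Base D Λ
  field
    Σ₀ : Sub
  open SubNotation Σ₀
  field
    W : Fin k → Fin k → Set
    W? : ∀ a b → Dec (W a b)
    zP : ∀ a b → ¬ W a b → z (m a b) ≡ Lz (r a) (c b)
    W-x : ∀ {a b} → W a b → x a ≢ zero
    W-y : ∀ {a b} → W a b → y b ≢ zero
    W-z : ∀ {a b} → W a b → z (m a b) ≢ L zero zero
    W-row : ∀ {a b a′ b′} → W a b → W a′ b′ → a ≡ a′

module LCoordinates (D : Design) (Λ : Lat D) (E : LConf D Λ) where
  open Base D Λ
  open LConf E
  open SubNotation Σ₀

  w₀ : Fin μ
  w₀ = L zero zero

  exL : ∀ {a b} → ¬ W a b → ¬ (i a ≡ zero × j b ≡ zero) → HL.Ex a b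
  exL nw ne = trans (sym (Lz-off ne)) (sym (zP _ _ nw))

  shL : ∀ {a b} → ¬ W a b → i a ≡ zero → j b ≡ zero → z (m a b) ≡ σ (L (x a) (y b))
  shL nw p q = trans (zP _ _ nw) (Lz-on p q)

  goodR₀ : ∀ {a} → i a ≢ zero → x a ≡ zero → HL.GoodR a
  goodR₀ ni e b = exL (λ w → W-x w e) (λ (p , _) → ni p)

  goodC₀ : ∀ {b} → j b ≢ zero → y b ≡ zero → HL.GoodC b
  goodC₀ nj e a = exL (λ w → W-y w e) (λ (_ , p) → nj p)

  Nh≡Ng : ∀ {a} → i a ≢ zero → x a ≡ zero → HL.Nh w₀ ≡ HL.Ng zero
  Nh≡Ng {a} ni e = trans (cong (λ u → HL.Nh (L u zero)) (sym e)) (CL.goodR (goodR₀ ni e) zero)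

  Nh≡Nf : ∀ {b} → j b ≢ zero → y b ≡ zero → HL.Nh w₀ ≡ HL.Nf zero
  Nh≡Nf {b} nj e = trans (cong (λ u → HL.Nh (L zero u)) (sym e)) (CL.goodC (goodC₀ nj e) zero)

  Thin₀ : Set
  Thin₀ = ∀ {a₁ b₁} → i a₁ ≢ zero → x a₁ ≡ zero → j b₁ ≢ zero → y b₁ ≡ zero → HL.Nf zero ≤ 1

  abstract
    -- If a row and a column with L-label zero leave the zero blocks, `Thin₀` bounds the
    -- multiplicities. If all columns with label zero lie in block column zero, there is only one of
    -- them, and where a row leaves the zero block this allows one symbol of class `w₀`, hence one
    -- row in the box; likewise with rows.
    boxUnique : Thin₀ → ∀ {a b a′ b′} → Box a b → Box a′ b′ → a ≡ a′ × b ≡ b′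
    boxUnique thin {a} {b} {a′} {b′} ((p , q) , ne) ((p′ , q′) , ne′) =
      decide (F.any? (λ u → ¬? (i u ≟ zero) ×-dec (x u ≟ zero)))
        (λ (u , ni , ex) → decide (F.any? (λ v → ¬? (j v ≟ zero) ×-dec (y v ≟ zero)))
          (λ (v , nj , ey) → let t = thin ni ex nj ey in
             ≤1⇒≡ (λ a → x a ≟ zero) t a a′ p p′ ,
             ≤1⇒≡ (λ b → y b ≟ zero) (subst (_≤ 1) (trans (sym (Nh≡Nf nj ey)) (Nh≡Ng ni ex)) t) b b′ q q′)
          (λ none →
             let j0 = λ v e → stable (j v ≟ zero) (λ nj → none (v , nj , e))
                 b≡ = cinj b b′ (trans (j0 b q) (sym (j0 b′ q′))) (trans q (sym q′))
                 ni₁ = λ e → ne (e , j0 b q)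
                 ni₂ = λ e → ne′ (e , j0 b′ q′)
             in mC.col b (≤1⇒≡ (λ t → z t ≟ w₀)
                  (subst (_≤ 1) (sym (Nh≡Ng ni ex)) (≡⇒≤1 (λ b → y b ≟ zero) (λ v v′ e e′ → cinj v v′ (trans (j0 v e) (sym (j0 v′ e′))) (trans e (sym e′)))))
                  (m a b) (m a′ b) (val p q (λ (e , _) → ni₁ e)) (val p′ q (λ (e , _) → ni₂ e))) , b≡))
        (λ none →
           let i0 = λ u e → stable (i u ≟ zero) (λ ni → none (u , ni , e))
               nj₁ = λ e → ne (i0 a p , e)
               nj₂ = λ e → ne′ (i0 a′ p′ , e)
           in rinj a a′ (trans (i0 a p) (sym (i0 a′ p′))) (trans p (sym p′)) ,
              mC.row a (≤1⇒≡ (λ t → z t ≟ w₀)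
                (subst (_≤ 1) (sym (Nh≡Nf nj₁ q)) (≡⇒≤1 (λ a → x a ≟ zero) (λ u u′ e e′ → rinj u u′ (trans (i0 u e) (sym (i0 u′ e′))) (trans e (sym e′)))))
                (m a b) (m a b′) (val p q (λ (_ , e) → nj₁ e)) (val p q′ (λ (_ , e) → nj₂ e))))
      where
      val : ∀ {a b} → x a ≡ zero → y b ≡ zero → ¬ (i a ≡ zero × j b ≡ zero) → z (m a b) ≡ w₀
      val p q ne = sym (trans (cong₂ L (sym p) (sym q)) (exL (λ w → W-x w p) ne))

  module Wide {a₁ b₁ : Fin k} (ni : i a₁ ≢ zero) (xa : x a₁ ≡ zero) (nj : j b₁ ≢ zero) (yb : y b₁ ≡ zero) where
    module Di = Dichotomy LC L∞ HL (goodR₀ ni xa) (goodC₀ nj yb)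

    d≡ : Di.d ≡ HL.Nf zero
    d≡ = cong HL.Nf xa

    Ng₀ : HL.Ng zero ≡ Di.d
    Ng₀ = trans (cong HL.Ng (sym yb)) (Di.d-col (goodC₀ nj yb))

    Nh₀ : HL.Nh w₀ ≡ Di.d
    Nh₀ = trans (Nh≡Nf nj yb) (sym d≡)

    abstract
      -- Among rows with one label at most one lies in block row zero, and at most one meets `W`. So
      -- three rows contain a good one, and two are enough if `W` lies in block row zero.
      sat : 2 ≤ Di.d → (∀ {a b} → W a b → i a ≡ zero) ⊎ 3 ≤ Di.d → ∀ u → HL.Nf u ≡ Di.d → ∃[ a ] (x a ≡ u × HL.GoodR a)
      sat two (inj₁ Wi) u e = go (#-pick2 (λ a → x a ≟ u) (subst (2 ≤_) (sym e) two))
        where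
        good : ∀ {a} → i a ≢ zero → HL.GoodR a
        good ne b = exL (λ w → ne (Wi w)) (λ (p , _) → ne p)
        go : ∃[ a ] ∃[ a′ ] (x a ≡ u × x a′ ≡ u × a ≢ a′) → ∃[ a ] (x a ≡ u × HL.GoodR a)
        go (a , a′ , p , p′ , ne) = decide (i a ≟ zero)
          (λ q → decide (i a′ ≟ zero) (λ q′ → contradiction (rinj a a′ (trans q (sym q′)) (trans p (sym p′))) ne) (λ q′ → a′ , p′ , good q′))
          (λ q → a , p , good q)
      sat two (inj₂ 3≤d) u e = go (#-pick3 (λ a → x a ≟ u) (subst (3 ≤_) (sym e) 3≤d))
        where
        Out : Set
        Out = ∃[ a ] (x a ≡ u × HL.GoodR a)
        good : ∀ a → x a ≡ u → (i a ≡ zero ⊎ (∃[ b ] W a b)) ⊎ Out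
        good a p = decide (i a ≟ zero) (λ q → inj₁ (inj₁ q)) (λ q → decide (F.any? (W? a)) (λ w → inj₁ (inj₂ w))
          (λ nw → inj₂ (a , p , λ b → exL (λ w → nw (b , w)) (λ (e , _) → q e))))
        same₁ : ∀ {a a′} → x a ≡ u → x a′ ≡ u → i a ≡ zero → i a′ ≡ zero → a ≡ a′
        same₁ p p′ q q′ = rinj _ _ (trans q (sym q′)) (trans p (sym p′))
        go : ∃[ a ] ∃[ b ] ∃[ c ] (x a ≡ u × x b ≡ u × x c ≡ u × a ≢ b × a ≢ c × b ≢ c) → Out
        go (a , b , c , p , q , s , ab , ac , bc) = [ (λ
          { (inj₁ ia) → [ (λ { (inj₁ ib) → contradiction (same₁ p q ia ib) ab
                             ; (inj₂ (_ , wb)) → [ (λ { (inj₁ ic) → contradiction (same₁ p s ia ic) ac ; (inj₂ (_ , wc)) → contradiction (W-row wb wc) bc }) , id ]′ (good c s) }) , id ]′ (good b q)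
          ; (inj₂ (_ , wa)) → [ (λ { (inj₂ (_ , wb)) → contradiction (W-row wa wb) ab
                             ; (inj₁ ib) → [ (λ { (inj₂ (_ , wc)) → contradiction (W-row wa wc) ac ; (inj₁ ic) → contradiction (same₁ q s ib ic) bc }) , id ]′ (good c s) }) , id ]′ (good b q) })
          , id ]′ (good a p)

      -- The row of W contains d symbols of class w₀, which force a second column of L of multiplicity d.
      spread : 2 ≤ Di.d → (∀ {a b} → W a b → i a ≡ zero) ⊎ 3 ≤ Di.d → ∀ {u v} → W u v → (∀ v → HL.Ng v ≡ Di.d)
      spread two alt {u} wuv v = #-full Di.Dg? (subst (μ ≤_) (trans (sym Di.#Dh≡#Df) Di.#Dh≡#Dg) (Di.dichotomy (sat two alt) two′)) v
        where
        cells : ∃[ b ] ∃[ b′ ] (z (m u b) ≡ w₀ × z (m u b′) ≡ w₀ × b ≢ b′)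
        cells = #-pick2 (λ b → z (m u b) ≟ w₀) (subst (2 ≤_) (sym (trans (HL.row# (λ t → z t ≟ w₀) u) Nh₀)) two)
        second : ∀ b → z (m u b) ≡ w₀ → j b ≢ zero → 2 ≤ # Di.Dg?
        second b e nj′ = 2≤# Di.Dg? zero (y b) Ng₀ (Di.d-col colG) (λ y0 → W-x wuv (LC.col zero (trans (cong (L (x u)) y0) (trans (colG u) e))))
          where
          colG : HL.GoodC b
          colG a = exL (λ w → W-z (subst (λ a → W a b) (W-row w wuv) w) e) (λ (_ , p) → nj′ p)
        two″ : 2 ≤ # Di.Dg?
        two″ = let (b , b′ , e , e′ , ne) = cells in decide (j b ≟ zero) (λ q → decide (j b′ ≟ zero)
            (λ q′ → contradiction (cinj b b′ (trans q (sym q′)) (eqy b b′ e e′ q q′)) ne) (second b′ e′)) (second b e)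
          where
          eqy : ∀ b b′ → z (m u b) ≡ w₀ → z (m u b′) ≡ w₀ → j b ≡ zero → j b′ ≡ zero → y b ≡ y b′
          eqy b b′ e e′ q q′ = decide (i u ≟ zero)
            (λ p → LC.row (x u) (σ-inj _ _ (trans (sym (shL (λ w → W-z w e) p q)) (trans e (trans (sym e′) (shL (λ w → W-z w e′) p q′))))))
            (λ p → LC.row (x u) (trans (exL (λ w → W-z w e) (λ (f , _) → p f)) (trans e (trans (sym e′) (sym (exL (λ w → W-z w e′) (λ (f , _) → p f)))))))
        two′ : 2 ≤ # Di.Df?
        two′ = subst (2 ≤_) (trans (sym Di.#Dh≡#Dg) Di.#Dh≡#Df) two″

-- A subarray of P in which only one row, blk yb, is switched (in the cells W), and in which the class of the cell E is raised by one.
record GConf (D : Design) (Λ : Lat D) : Set₁ where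
  open Base D Λ
  field
    Σ₀ : Sub
    yb : Bool
  open SubNotation Σ₀
  newZ : Fin 3 → Fin μ
  newZ m′ = if yb then Z (nxt m′) else Z m′
  field
    W E : Fin k → Fin k → Set
    W? : ∀ a b → Dec (W a b)
    E? : ∀ a b → Dec (E a b)
    E-uniq : ∀ {a b a′ b′} → E a b → E a′ b′ → a ≡ a′ × b ≡ b′
    zP : ∀ a b → ¬ W a b → z (m a b) ≡ Lz (r a) (c b)
    clP : ∀ a b → ¬ W a b → ¬ E a b → cl (m a b) ≡ Az (r a) (c b)
    clE : ∀ a b → ¬ W a b → E a b → cl (m a b) ≡ up (Az (r a) (c b))
    W-row : ∀ {a b} → W a b → r a ≡ row yb
    W-col : ∀ {a b} → W a b → ∃[ m′ ] c b ≡ col m′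
    W-full : ∀ {a b} → W a b → ∀ b′ m′ → c b′ ≡ col m′ → W a b′
    W-z : ∀ {a b m′} → W a b → c b ≡ col m′ → z (m a b) ≡ newZ m′
    W-cl : ∀ {a b m′} → W a b → c b ≡ col m′ → ¬ E a b → cl (m a b) ≡ new yb m′
    W-clE : ∀ {a b m′} → W a b → c b ≡ col m′ → E a b → cl (m a b) ≡ up (new yb m′)

module Cells (D : Design) (Λ : Lat D) (𝔾 : GConf D Λ) where
  open Base D Λ
  open GConf 𝔾
  open SubNotation Σ₀

  nxt≢ : ∀ m′ → nxt m′ ≢ m′
  nxt≢ 0F ()
  nxt≢ 1F ()
  nxt≢ 2F ()

  S-inj : ∀ m₁ m₂ → S m₁ ≡ S m₂ → m₁ ≡ m₂
  S-inj m₁ m₂ e = J-inj m₁ m₂ (AC.row zero e)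

  new≢ : ∀ y m′ → new y m′ ≢ A (blk y) (J m′)
  new≢ true m′ e = nxt≢ m′ (S-inj _ _ e)
  new≢ false m′ e = nxt≢ m′ (S-inj _ _ (sym (trans e (A₂ m′))))

  up-moves : ∀ (c : Fin n) → up c ≢ c
  up-moves = +ₛ-moves 1 (s≤s z≤n) (s≤s⁻¹ (ℕ.≤-trans (s≤s (s≤s z≤n)) 8≤n))

  newZ≢ : ∀ m′ → newZ m′ ≢ L zero zero
  newZ≢ m′ with yb
  ... | true = Z≢ (nxt m′)
  ... | false = Z≢ m′

  W-x : ∀ {a b} → W a b → x a ≢ zero
  W-x w e = R≢0 yb (trans (sym (cong proj₂ (W-row w))) e)

  W-y : ∀ {a b} → W a b → y b ≢ zero
  W-y w e = let (m′ , q) = W-col w in K≢0 m′ (trans (sym (cong proj₂ q)) e)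

  W-z≢ : ∀ {a b} → W a b → z (m a b) ≢ L zero zero
  W-z≢ w e = let (m′ , q) = W-col w in newZ≢ m′ (trans (sym (W-z w q)) e)

  W-same : ∀ {a b a′ b′} → W a b → W a′ b′ → a ≡ a′
  W-same w w′ = r-inj _ _ (trans (W-row w) (sym (W-row w′)))

  lconf : LConf D Λ
  lconf = record { Σ₀ = Σ₀ ; W = W ; W? = W? ; zP = zP ; W-x = W-x ; W-y = W-y ; W-z = W-z≢ ; W-row = W-same }

  Dirty : Fin k → Fin k → Set
  Dirty a b = W a b ⊎ (E a b ⊎ Box a b)

  dirty? : ∀ a b → Dec (Dirty a b)
  dirty? a b = W? a b ⊎-dec (E? a b ⊎-dec Box? a b)

  clean : ∀ {a b} → ¬ Dirty a b → HA.Ex a b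
  clean {a} {b} nd = trans (sym (Az-plain a b (λ bx → nd (inj₂ (inj₂ bx))))) (sym (clP a b (λ w → nd (inj₁ w)) (λ e → nd (inj₂ (inj₁ e)))))

  Fault : Fin k → Fin k → Set
  Fault a b = ¬ HA.Ex a b × Al (i a) (j b) (cl (m a b))

  fault : ∀ {a b c′} → cl (m a b) ≡ c′ → c′ ≢ A (i a) (j b) → Al (i a) (j b) c′ → Fault a b
  fault e ne al = (λ ex → ne (trans (sym e) (sym ex))) , subst (Al _ _) (sym e) al

  faultW : ∀ {a b} → W a b → Fault a b
  faultW {a} {b} w = go (W-col w) (E? a b)
    where
    ia : i a ≡ blk yb
    ia = cong proj₁ (W-row w)
    go : ∃[ m′ ] c b ≡ col m′ → Dec (E a b) → Fault a b
    go (m′ , q) (yes e) = fault (W-clE w q e) (λ f → up-new yb m′ (trans f (cong₂ A ia (cong proj₁ q)))) (sw↑ yb m′ ia (cong proj₁ q))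
    go (m′ , q) (no ne) = fault (W-cl w q ne) (λ f → new≢ yb m′ (trans f (cong₂ A ia (cong proj₁ q)))) (sw yb m′ ia (cong proj₁ q))

  -- A cell can be raised and exchanged, or raised and in the box, at once. That the effects never
  -- cancel is the content of `up-new`, `up-B` and `AB`.
  dirty : ∀ {a b} → Dirty a b → Fault a b
  dirty {a} {b} d = decide (W? a b) faultW (λ nw → decide (E? a b)
    (λ e → decide (Box? a b)
      (λ bx → fault (trans (clE a b nw e) (cong up (Az-box a b bx))) (up-B (i a) (j b) (proj₂ bx)) (box↑ (proj₂ bx)))
      (λ nb → fault (trans (clE a b nw e) (cong up (Az-plain a b nb))) (up-moves _) shifted))
    (λ ne → [ (λ w → contradiction w nw) , [ (λ e → contradiction e ne) ,
      (λ bx → fault (trans (clP a b nw ne) (Az-box a b bx)) (≢-sym (AB (i a) (j b) (proj₂ bx))) (box (proj₂ bx))) ]′ ]′ d))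

  CleanC CleanR : Fin k → Set
  CleanC b = ∀ a → ¬ Dirty a b
  CleanR a = ∀ b → ¬ Dirty a b

  cleanC? : Decidable CleanC
  cleanC? b = F.all? (λ a → ¬? (dirty? a b))
  cleanR? : Decidable CleanR
  cleanR? a = F.all? (λ b → ¬? (dirty? a b))

  goodC : ∀ {b} → CleanC b → HA.GoodC b
  goodC cc a = clean (cc a)
  goodR : ∀ {a} → CleanR a → HA.GoodR a
  goodR cr b = clean (cr b)

  OneC : Fin k → Fin k → Set
  OneC a₀ b₀ = Dirty a₀ b₀ × (∀ a → a ≢ a₀ → ¬ Dirty a b₀)

  onlyC : ∀ {a₀ b₀} → OneC a₀ b₀ → HA.OnlyBad a₀ b₀
  onlyC (d , o) = (λ a ne → clean (o a ne)) , proj₁ (dirty d)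

  module RC = Rigidity AC A-rigid₂ HA
  module RR = Rigidity (flipC AC) Aᵀ-rigid₂ (flipH HA)

  sameC : ∀ {a₀ b₀ b₁ b₂} → OneC a₀ b₀ → CleanC b₁ → CleanC b₂ → j b₁ ≡ j b₂
  sameC o c₁ c₂ = RC.sameBlock (onlyC o) (proj₂ (dirty (proj₁ o))) (goodC c₁) (goodC c₂)

  OneR : Fin k → Fin k → Set
  OneR a₀ b₀ = Dirty a₀ b₀ × (∀ b → b ≢ b₀ → ¬ Dirty a₀ b)

  onlyR : ∀ {a₀ b₀} → OneR a₀ b₀ → Hom.OnlyBad (flipH HA) b₀ a₀
  onlyR (d , o) = (λ b ne → clean (o b ne)) , proj₁ (dirty d)

  sameR : ∀ {a₀ b₀ a₁ a₂} → OneR a₀ b₀ → CleanR a₁ → CleanR a₂ → i a₁ ≡ i a₂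
  sameR o c₁ c₂ = RR.sameBlock (onlyR o) (proj₂ (dirty (proj₁ o))) (goodR c₁) (goodR c₂)

  fewC : ∀ {a₀ b₀} → OneC a₀ b₀ → (xs : List (Fin k)) → (∀ b → b ∉ xs → CleanC b) → length xs + length xs < k → ⊥
  fewC o xs g = RC.fewBad (onlyC o) (proj₂ (dirty (proj₁ o))) xs (λ b ni → goodC (g b ni))

  fewR : ∀ {a₀ b₀} → OneR a₀ b₀ → (xs : List (Fin k)) → (∀ a → a ∉ xs → CleanR a) → length xs + length xs < k → ⊥
  fewR o xs g = RR.fewBad (onlyR o) (proj₂ (dirty (proj₁ o))) xs (λ a ni → goodR (g a ni))

  -- No clean column lies in the block of a switched column: one fault is impossible, and two faults would have to
  -- exchange their classes, which up-new rules out.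
  apart : ∀ {a b b₁} → W a b → CleanC b₁ → j b₁ ≢ j b
  apart {a} {b} {b₁} w cc eq = decide (F.any? (λ a′ → E? a′ b ×-dec ¬? (a′ ≟ a)))
    (λ (a′ , e , ne) → two a′ e ne)
    (λ none → CA.good≢onlyBad (goodC cc) (onlyC (inj₁ w , λ a′ ne → [ (λ w′ → ne (W-same w′ w)) ,
        [ (λ e → none (a′ , e , ne)) , (λ ((_ , p) , _) → W-y w p) ]′ ]′)) eq)
    where
    two : ∀ a′ → E a′ b → a′ ≢ a → ⊥
    two a′ e ne = up-new yb m′ (trans (sym y₁) (trans swap (cong₂ A ia jb)))
      where
      m′ = proj₁ (W-col w)
      q = proj₂ (W-col w)
      ia : i a ≡ blk yb
      ia = cong proj₁ (W-row w)
      jb : j b ≡ J m′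
      jb = cong proj₁ q
      ¬Ea : ¬ E a b
      ¬Ea e′ = ne (proj₁ (E-uniq e e′))
      ¬Wa′ : ¬ W a′ b
      ¬Wa′ w′ = ne (W-same w′ w)
      ¬Box : ∀ u → ¬ Box u b
      ¬Box u ((_ , p) , _) = W-y w p
      x₁ y₀ x₀ : Fin n
      x₀ = A (i a) (j b)
      y₀ = cl (m a b)
      x₁ = A (i a′) (j b)
      y₀≡ : y₀ ≡ new yb m′
      y₀≡ = W-cl w q ¬Ea
      y₁≡ : cl (m a′ b) ≡ up x₁
      y₁≡ = trans (clE a′ b ¬Wa′ e) (cong up (Az-plain a′ b (¬Box a′)))
      exact : ∀ u → u ≢ a → u ≢ a′ → HA.Ex u b
      exact u n₁ n₂ = clean [ (λ w′ → n₁ (W-same w′ w)) , [ (λ e′ → n₂ (proj₁ (E-uniq e′ e))) , ¬Box u ]′ ]′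
      y₀≢x₀ : y₀ ≢ x₀
      y₀≢x₀ f = new≢ yb m′ (trans (sym y₀≡) (trans f (cong₂ A ia jb)))
      -- The clean column over the same block fixes the symbol counts, so in column `b` the shown
      -- and the exact classes occur equally often. With two faults, each must therefore gain what
      -- the other loses.
      count : ∀ c′ → # (λ u → cl (m u b) ≟ c′) ≡ # (λ u → A (i u) (j b) ≟ c′)
      count c′ with AC.colS (j b) c′
      ... | u₀ , refl = trans (HA.col# (λ t → cl t ≟ A u₀ (j b)) b) (trans (cong (λ v → HA.Nh (A u₀ v)) (sym eq))
              (trans (CA.goodC (goodC cc) u₀) (#-cong _ _ (λ u f → cong (λ v → A v (j b)) f) (λ u f → AC.col (j b) f))))
      swap₁ : x₁ ≡ y₀
      swap₁ = stable (x₁ ≟ y₀) (λ nx → ℕ.1+n≰n (ℕ.≤-trans (s≤s (#-mono (λ u → A (i u) (j b) ≟ y₀) (without (λ u → cl (m u b) ≟ y₀) a) (sub nx)))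
        (ℕ.≤-reflexive (trans (sym (#-remove (λ u → cl (m u b) ≟ y₀) a refl)) (count y₀)))))
        where
        sub : x₁ ≢ y₀ → ∀ u → A (i u) (j b) ≡ y₀ → cl (m u b) ≡ y₀ × u ≢ a
        sub nx u f = trans (sym (exact u ne₁ ne₂)) f , ne₁
          where
          ne₁ : u ≢ a
          ne₁ refl = y₀≢x₀ (sym f)
          ne₂ : u ≢ a′
          ne₂ refl = nx f
      swap : cl (m a′ b) ≡ x₀
      swap = stable (cl (m a′ b) ≟ x₀) (λ ny → ℕ.1+n≰n (ℕ.≤-trans (s≤s (#-mono (λ u → cl (m u b) ≟ x₀) (without (λ u → A (i u) (j b) ≟ x₀) a) (sub ny)))
        (ℕ.≤-reflexive (trans (sym (#-remove (λ u → A (i u) (j b) ≟ x₀) a refl)) (sym (count x₀))))))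
        where
        sub : cl (m a′ b) ≢ x₀ → ∀ u → cl (m u b) ≡ x₀ → A (i u) (j b) ≡ x₀ × u ≢ a
        sub ny u f = trans (exact u ne₁ ne₂) f , ne₁
          where
          ne₁ : u ≢ a
          ne₁ refl = y₀≢x₀ f
          ne₂ : u ≢ a′
          ne₂ refl = ny f
      y₁ : cl (m a′ b) ≡ up (new yb m′)
      y₁ = trans y₁≡ (cong up (trans swap₁ y₀≡))

record YConf (D : Design) (Λ : Lat D) : Set₁ where
  field
    𝔾 : GConf D Λ
  open GConf 𝔾
  open Base.Sub Σ₀
  field
    noE : ∀ a b → ¬ E a b
    ya bκ : Fin k
    wκ : W ya bκ
    2≤k : 2 ≤ k

module Partial (D : Design) (Λ : Lat D) (ℂ : YConf D Λ) where
  open Base D Λ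
  open YConf ℂ
  open GConf 𝔾
  open SubNotation Σ₀
  open Cells D Λ 𝔾
  open LCoordinates D Λ lconf using (w₀; exL; shL; goodR₀; goodC₀; Nh≡Ng; Nh≡Nf; Thin₀; boxUnique; module Wide)

  iy : i ya ≡ blk yb
  iy = cong proj₁ (W-row wκ)
  xy : x ya ≡ R yb
  xy = cong proj₂ (W-row wκ)
  xy≢0 : x ya ≢ zero
  xy≢0 = W-x wκ

  oneW : ∀ {a b} → W a b → OneC a b
  oneW w = inj₁ w , λ a ne → [ (λ w′ → ne (W-same w′ w)) , [ noE _ _ , (λ ((_ , p) , _) → W-y w p) ]′ ]′

  clean≡ : ∀ {b b′} → CleanC b → CleanC b′ → j b ≡ j b′
  clean≡ = sameC (oneW wκ)

  noW : ∀ {b} → z (m ya b) ≡ w₀ → ∀ a → ¬ W a b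
  noW e a w = W-z≢ (subst (λ a → W a _) (W-same w wκ) w) e

  cleanCol : ∀ {b} → (∀ a → ¬ W a b) → y b ≢ zero → CleanC b
  cleanCol nw ny a = [ nw a , [ noE a _ , (λ ((_ , p) , _) → ny p) ]′ ]′

  abstract
    -- An exchanged cell is the only fault of its column, so all clean columns lie in one block. A
    -- multiplicity of two would yield two clean columns with equal L-label: over a label other than
    -- zero and the `K m′` if the row is `true`, among the symbols of class `w₀` in row `ya` if it
    -- is `false`.
    thin : Thin₀
    thin {a₁} {b₁} ni xa nj yb₀ = decide (2 ≤? HL.Nf zero) (λ two → ⊥-elim (byRow yb refl two)) (λ ≰ → s≤s⁻¹ (ℕ.≰⇒> ≰))
      where
      module Wd = Wide ni xa nj yb₀
      byRow : ∀ y′ → yb ≡ y′ → 2 ≤ HL.Nf zero → ⊥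
      byRow true e two = absurd (#-pick2 (λ b → y b ≟ v) (subst (2 ≤_) (sym (spread′ v)) two′))
        where
        two′ : 2 ≤ Wd.Di.d
        two′ = subst (2 ≤_) (sym Wd.d≡) two
        spread′ : ∀ v → HL.Ng v ≡ Wd.Di.d
        spread′ = Wd.spread two′ (inj₁ (λ w → trans (cong proj₁ (W-row w)) (cong blk e))) wκ
        fr : ∃[ v ] v ∉ zero ∷ K 0F ∷ K 1F ∷ K 2F ∷ []
        fr = freshFin _ (ℕ.≤-trans (s≤s (s≤s (s≤s (s≤s (s≤s z≤n))))) 10≤μ)
        v : Fin μ
        v = proj₁ fr
        notK : ∀ m′ → v ≢ K m′
        notK 0F q = proj₂ fr (there (here q))
        notK 1F q = proj₂ fr (there (there (here q)))
        notK 2F q = proj₂ fr (there (there (there (here q))))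
        cc : ∀ {b} → y b ≡ v → CleanC b
        cc p = cleanCol (λ a w → let (m′ , q) = W-col w in notK m′ (trans (sym p) (cong proj₂ q))) (λ q → proj₂ fr (here (trans (sym p) q)))
        absurd : ∃[ b ] ∃[ b′ ] (y b ≡ v × y b′ ≡ v × b ≢ b′) → ⊥
        absurd (b , b′ , p , p′ , ne) = ne (cinj b b′ (clean≡ (cc p) (cc p′)) (trans p (sym p′)))
      byRow false e two = absurd (#-pick2 (λ b → z (m ya b) ≟ w₀) (subst (2 ≤_) (sym (trans (HL.row# (λ t → z t ≟ w₀) ya) (Nh≡Nf nj yb₀))) two))
        where
        iy≢0 : i ya ≢ zero
        iy≢0 q = i₂≢0 (trans (sym (cong blk e)) (trans (sym iy) q))
        ex : ∀ {b} → z (m ya b) ≡ w₀ → L (x ya) (y b) ≡ w₀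
        ex p = trans (exL (noW p ya) (λ (q , _) → iy≢0 q)) p
        cc : ∀ {b} → z (m ya b) ≡ w₀ → CleanC b
        cc p = cleanCol (noW p) (λ q → xy≢0 (LC.col zero (trans (cong (L (x ya)) (sym q)) (ex p))))
        absurd : ∃[ b ] ∃[ b′ ] (z (m ya b) ≡ w₀ × z (m ya b′) ≡ w₀ × b ≢ b′) → ⊥
        absurd (b , b′ , p , p′ , ne) = ne (cinj b b′ (clean≡ (cc p) (cc p′)) (LC.row (x ya) (trans (ex p) (sym (ex p′)))))

  boxU : ∀ {a b a′ b′} → Box a b → Box a′ b′ → a ≡ a′ × b ≡ b′
  boxU = boxUnique thin

  -- Two clean columns share the block `v` and make every occurring row label occur twice. In the
  -- presence of a clean row with another label than `ya`, an exchanged block then needs a second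
  -- column, which only the box can provide; so all columns lie in two blocks, where two rows give
  -- an intercalate of A.
  module TwoClean {g₁ g₂ : Fin k} (c₁ : CleanC g₁) (c₂ : CleanC g₂) (g≢ : g₁ ≢ g₂) where
    v : Fin n
    v = j g₁

    2≤Nf : ∀ a → 2 ≤ HA.Nf (i a)
    2≤Nf a = subst (2 ≤_) (trans (HA.row# (λ t → cl t ≟ A (i a) v) a) (CA.goodC (goodC c₁) (i a)))
      (2≤# (λ b → cl (m a b) ≟ A (i a) v) g₁ g₂ (sym (clean (c₁ a))) (trans (sym (clean (c₂ a))) (cong (A (i a)) (clean≡ c₂ c₁))) g≢)

    allSame : (∀ a → i a ≡ i ya) → ⊥
    allSame same = apart wκ c₁ (AC.row (i ya) (sym (trans (cong (λ u → A u (j bκ)) (sym (same a))) (trans (clean (proj₂ (oneW wκ) a ne)) (allcl _)))))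
      where
      fr = freshFin (ya ∷ []) 2≤k
      a = proj₁ fr
      ne : a ≢ ya
      ne e = proj₂ fr (here e)
      allcl : ∀ t → cl t ≡ A (i ya) v
      allcl = #-full (λ t → cl t ≟ A (i ya) v) (ℕ.≤-reflexive (sym (trans (CA.goodC (goodC c₁) (i ya)) (#-all _ same))))

    module Row {u : Fin k} (cu : CleanR u) (u≢ : i u ≢ i ya) where
      Ng≡ : ∀ w → HA.Nh (A (i u) w) ≡ HA.Ng w
      Ng≡ = CA.goodR (goodR cu)

      abstract
        extra : ∀ {a b} → W a b → ∃[ b′ ] (j b′ ≡ j b × ∃[ a′ ] Box a′ b′)
        extra {a} {b} w = b′ , proj₁ (proj₂ fr) , box′
          where
          cs : ∃[ w′ ] A w′ v ≡ A (i u) (j b)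
          cs = AC.colS v (A (i u) (j b))
          Nf≡ : HA.Nf (proj₁ cs) ≡ HA.Ng (j b)
          Nf≡ = trans (sym (CA.goodC (goodC c₁) (proj₁ cs))) (trans (cong HA.Nh (proj₂ cs)) (Ng≡ (j b)))
          row′ : ∃[ a′ ] i a′ ≡ proj₁ cs
          row′ = #-pick (λ a → i a ≟ proj₁ cs) (subst (1 ≤_) (sym Nf≡) (1≤# (λ b′ → j b′ ≟ j b) b refl))
          two : 2 ≤ HA.Ng (j b)
          two = subst (2 ≤_) (trans (cong HA.Nf (proj₂ row′)) Nf≡) (2≤Nf (proj₁ row′))
          fr : ∃[ b′ ] (j b′ ≡ j b × b′ ∉ b ∷ [])
          fr = #-fresh (λ b′ → j b′ ≟ j b) (b ∷ []) two
          b′ : Fin k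
          b′ = proj₁ fr
          notW : ∀ a′ → ¬ W a′ b′
          notW a′ w′ = proj₂ (proj₂ fr) (here (c-inj _ _ (trans (proj₂ (W-col w′)) (trans (cong col (J-inj _ _
            (trans (sym (cong proj₁ (proj₂ (W-col w′)))) (trans (proj₁ (proj₂ fr)) (cong proj₁ (proj₂ (W-col w))))))) (sym (proj₂ (W-col w)))))))
          box′ : ∃[ a′ ] Box a′ b′
          box′ = stable (F.any? (λ a′ → Box? a′ b′)) (λ none → apart w (λ a′ → [ notW a′ , [ noE a′ b′ , (λ bx → none (a′ , bx)) ]′ ]′) (proj₁ (proj₂ fr)))

      bx : ∃[ b′ ] (j b′ ≡ j bκ × ∃[ a′ ] Box a′ b′)
      bx = extra wκ
      b″ = proj₁ bx

      cols : ∀ b → j b ≡ v ⊎ j b ≡ j bκ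
      cols b = decide (F.any? (λ a → W? a b))
        (λ (a , w) → let (b′ , e , a′ , bx′) = extra w in inj₂ (trans (sym e) (trans (cong j (proj₂ (boxU bx′ (proj₂ (proj₂ (proj₂ bx)))))) (proj₁ (proj₂ bx)))))
        (λ nw → decide (F.any? (λ a → Box? a b))
          (λ (a , bx′) → inj₂ (trans (cong j (proj₂ (boxU bx′ (proj₂ (proj₂ (proj₂ bx)))))) (proj₁ (proj₂ bx))))
          (λ nb → inj₁ (clean≡ (λ a → [ (λ w → nw (a , w)) , [ noE a b , (λ bx′ → nb (a , bx′)) ]′ ]′) c₁)))

      hit : ∀ b → HA.Ex ya b → ∃[ b′ ] A (i u) (j b′) ≡ A (i ya) (j b)
      hit b e = let (b′ , q) = mC.rowS u (m ya b) in b′ , trans (clean (cu b′)) (trans (cong cl q) (sym e))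

      other : ∀ {p q b} → A (i u) (j b) ≡ A (i ya) p → j b ≡ p ⊎ j b ≡ q → A (i u) q ≡ A (i ya) p
      other e (inj₁ f) = contradiction (AC.col _ (trans (cong (A (i u)) (sym f)) e)) u≢
      other e (inj₂ f) = trans (cong (A (i u)) (sym f)) e

      absurd : ⊥
      absurd = A-noInt (i u) (i ya) (j bκ) v u≢
        (let (b , e) = hit g₁ (clean (c₁ ya)) in other e (cols b))
        (let (b , e) = hit b″ (clean [ (λ w → W-y w yb″) , [ noE _ _ , (λ ((p , _) , _) → xy≢0 p) ]′ ]′)
             e′ = trans e (cong (A (i ya)) (proj₁ (proj₂ bx)))
         in other e′ (swap (cols b)))
        where
        yb″ : y b″ ≡ zero
        yb″ = proj₂ (proj₁ (proj₂ (proj₂ (proj₂ bx))))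
        swap : ∀ {X Y : Set} → X ⊎ Y → Y ⊎ X
        swap (inj₁ p) = inj₂ p
        swap (inj₂ p) = inj₁ p

    twoClean : ⊥
    twoClean = decide (F.any? (λ a → ¬? (i a ≟ i ya))) (λ (a , ne) → go a ne (#-pick2 (λ u → i u ≟ i a) (2≤Nf a)))
      (λ none → allSame (λ a → stable (i a ≟ i ya) (λ ne → none (a , ne))))
      where
      cr : ∀ {u a} → i u ≡ i a → i a ≢ i ya → (∀ b → ¬ Box u b) → CleanR u
      cr e ne nb b = [ (λ w → ne (trans (sym e) (cong i (W-same w wκ)))) , [ noE _ _ , nb b ]′ ]′
      go : ∀ a → i a ≢ i ya → ∃[ u ] ∃[ u′ ] (i u ≡ i a × i u′ ≡ i a × u ≢ u′) → ⊥
      go a ne (u , u′ , p , p′ , u≢u′) = decide (F.any? (λ b → Box? u b))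
        (λ (b , bx) → Row.absurd (cr p′ ne (λ b′ bx′ → u≢u′ (proj₁ (boxU bx bx′)))) (λ e → ne (trans (sym p′) e)))
        (λ none → Row.absurd (cr p ne (λ b bx → none (b , bx))) (λ e → ne (trans (sym p) e)))

  cleanUnique : ∀ {b b′} → CleanC b → CleanC b′ → b ≡ b′
  cleanUnique {b} {b′} c c′ = stable (b ≟ b′) (TwoClean.twoClean c c′)

  abstract
    -- The symbol of the box cell recurs in row `ya`. Its L-label `w₀` is not that of an exchanged
    -- symbol, and since `ya` has a nonzero L-label, a column with label zero could carry it only in
    -- the shifted block; `thin` and cancellation in `B` exclude this. So it stands in a clean
    -- column.
    boxClass : ∀ {a₀ b₀} → Box a₀ b₀ → ∃[ b ] (CleanC b × A (i ya) (j b) ≡ B (i a₀) (j b₀))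
    boxClass {a₀} {b₀} bx@((xa , yb₀) , ne) = b , cc , trans (clean (cc ya)) (trans (cong cl tb) clt)
      where
      nwb : ∀ {a} → ¬ W a b₀
      nwb w = W-y w yb₀
      tz : z (m a₀ b₀) ≡ w₀
      tz = trans (sym (exL nwb ne)) (cong₂ L xa yb₀)
      clt : cl (m a₀ b₀) ≡ B (i a₀) (j b₀)
      clt = trans (clP a₀ b₀ nwb (noE a₀ b₀)) (Az-box a₀ b₀ bx)
      rs : ∃[ b ] m ya b ≡ m a₀ b₀
      rs = mC.rowS ya (m a₀ b₀)
      b : Fin k
      b = proj₁ rs
      tb : m ya b ≡ m a₀ b₀
      tb = proj₂ rs
      zb : z (m ya b) ≡ w₀
      zb = trans (cong z tb) tz
      corner : y b ≡ zero → i ya ≡ zero → j b ≡ zero → ⊥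
      corner q p p′ = ne (stable (i a₀ ≟ zero) (λ ni → nearby ni) , stable (j b₀ ≟ zero) nearby′)
        where
        clb : A zero zero ≡ B (i a₀) (j b₀)
        clb = trans (sym (cong₂ A p p′)) (trans (clean [ noW zb ya , [ noE _ _ , (λ ((r , _) , _) → xy≢0 r) ]′ ]′) (trans (cong cl tb) clt))
        b≢ : j b₀ ≢ zero → b₀ ≢ b
        b≢ nj e = nj (trans (cong j e) p′)
        both : i a₀ ≢ zero → j b₀ ≢ zero → ⊥
        both ni nj = ℕ.<⇒≱ (2≤# (λ b → y b ≟ zero) b₀ b yb₀ q (b≢ nj))
          (subst (_≤ 1) (trans (sym (Nh≡Nf nj yb₀)) (Nh≡Ng ni xa)) (thin ni xa nj yb₀))
        nearby : i a₀ ≢ zero → ⊥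
        nearby ni = decide (j b₀ ≟ zero)
          (λ e → ni (Cancel.col BC zero (trans (cong (B (i a₀)) (sym e)) (trans (sym clb) (sym AB₀)))))
          (both ni)
        nearby′ : j b₀ ≢ zero → ⊥
        nearby′ nj = decide (i a₀ ≟ zero)
          (λ e → nj (Cancel.row BC zero (trans (cong (λ u → B u (j b₀)) (sym e)) (trans (sym clb) (sym AB₀)))))
          (λ ni → both ni nj)
      ny : y b ≢ zero
      ny q = decide ((i ya ≟ zero) ×-dec (j b ≟ zero)) (λ (p , p′) → corner q p p′)
        (λ nc → xy≢0 (LC.col zero (trans (cong (L (x ya)) (sym q)) (trans (exL (noW zb ya) nc) zb))))
      cc : CleanC b
      cc = cleanCol (noW zb) ny

-- Excluding subsquares with switched cells in one row

-- Used to list the columns of S by kind: each kind turns out to have at most one member, so one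
-- witness lists it completely.
add : {k : ℕ} {P : Fin k → Set} → Dec (∃ P) → List (Fin k) → List (Fin k)
add (yes (b , _)) xs = b ∷ xs
add (no _) xs = xs

add-∈ : {k : ℕ} {P : Fin k → Set} (d : Dec (∃ P)) {xs : List (Fin k)} {b : Fin k} → b ∈ add d xs → P b ⊎ b ∈ xs
add-∈ {P = P} (yes (_ , p)) (here e) = inj₁ (subst P (sym e) p)
add-∈ (yes _) (there m) = inj₂ m
add-∈ (no _) m = inj₂ m

add-there : {k : ℕ} {P : Fin k → Set} (d : Dec (∃ P)) {xs : List (Fin k)} {b : Fin k} → b ∈ xs → b ∈ add d xs
add-there (yes _) m = there m
add-there (no _) m = m

add-here : {k : ℕ} {P : Fin k → Set} (d : Dec (∃ P)) {xs : List (Fin k)} → (∀ b b′ → P b → P b′ → b ≡ b′) → ∀ {b} → P b → b ∈ add d xs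
add-here (yes (b′ , q)) u p = here (u _ b′ p q)
add-here (no none) u p = ⊥-elim (none (_ , p))

add-uniq : {k : ℕ} {P : Fin k → Set} (d : Dec (∃ P)) {xs : List (Fin k)} → (∀ b → P b → b ∉ xs) → Uniq xs → Uniq (add d xs)
add-uniq (yes (b , p)) f u = f b p , u
add-uniq (no _) f u = u

add-++ : {k : ℕ} {P : Fin k → Set} (d : Dec (∃ P)) (xs ys : List (Fin k)) → add d xs ++ ys ≡ add d (xs ++ ys)
add-++ (yes _) xs ys = refl
add-++ (no _) xs ys = refl

countL-cnt : {k n : ℕ} (f : Fin k → Fin n) (d : Fin n) (xs : List (Fin k)) → countL (λ b → f b ≟ d) xs ≡ cnt d (map f xs)
countL-cnt f d [] = refl
countL-cnt f d (x ∷ xs) = go (f x ≟ d)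
  where
  go : (e : Dec (f x ≡ d)) → bit e + countL (λ b → f b ≟ d) xs ≡ (if f x == d then suc (cnt d (map f xs)) else cnt d (map f xs))
  go (yes e) = trans (cong suc (countL-cnt f d xs)) (cong (λ b → if b then suc (cnt d (map f xs)) else cnt d (map f xs)) (sym (trans (cong (_== d) e) (==-refl d))))
  go (no ne) = trans (countL-cnt f d xs) (cong (λ b → if b then suc (cnt d (map f xs)) else cnt d (map f xs)) (sym (≢⇒==false ne)))

map-cong∈ : {X Y : Set} {f g : X → Y} (xs : List X) → (∀ x → x ∈ xs → f x ≡ g x) → map f xs ≡ map g xs
map-cong∈ [] e = refl
map-cong∈ (x ∷ xs) e = cong₂ _∷_ (e x (here refl)) (map-cong∈ xs (λ y m → e y (there m)))

allB-complete : ∀ n (p : Fin n → Bool) → (∀ i → p i ≡ true) → allB n p ≡ true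
allB-complete zero p f = refl
allB-complete (suc n) p f = trans (cong (λ b → if b then allB n (p ∘ suc) else false) (f zero)) (allB-complete n (p ∘ suc) (λ i → f (suc i)))

anyB-complete : ∀ n (p : Fin n → Bool) i → p i ≡ true → anyB n p ≡ true
anyB-complete (suc n) p i e = go (p zero) refl i e
  where
  go : ∀ b → p zero ≡ b → ∀ i → p i ≡ true → (if b then true else anyB n (p ∘ suc)) ≡ true
  go true _ _ _ = refl
  go false q zero e = contradiction (trans (sym q) e) λ ()
  go false q (suc i) e = anyB-complete n (p ∘ suc) i e

≡ᵇ-complete : ∀ {m n} → m ≡ n → (m ≡ᵇ n) ≡ true
≡ᵇ-complete {zero} refl = refl
≡ᵇ-complete {suc m} refl = ≡ᵇ-complete {m} refl

≤ᵇ-complete : ∀ {m n} → m ≤ n → (m ≤ᵇ n) ≡ true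
≤ᵇ-complete {zero} _ = refl
≤ᵇ-complete {suc zero} (s≤s _) = refl
≤ᵇ-complete {suc (suc m)} (s≤s le) = ≤ᵇ-complete {suc m} le

≤ᵇ-sound : ∀ m n → (m ≤ᵇ n) ≡ true → m ≤ n
≤ᵇ-sound zero n e = z≤n
≤ᵇ-sound (suc zero) (suc n) e = s≤s z≤n
≤ᵇ-sound (suc (suc m)) (suc n) e = s≤s (≤ᵇ-sound (suc m) n e)

same-complete : {n : ℕ} (xs ys : List (Fin n)) → (∀ c → cnt c xs ≡ cnt c ys) → same xs ys ≡ true
same-complete xs ys e = allB-complete _ _ (λ c → ≡ᵇ-complete (e c))

∧-intro : ∀ {x y} → x ≡ true → y ≡ true → x ∧ y ≡ true
∧-intro refl refl = refl

not-intro : ∀ {x} → x ≡ false → not x ≡ true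
not-intro refl = refl

does-sound : {P : Set} (d : Dec P) → does d ≡ true → P
does-sound (yes p) _ = p

replace-elim : {n : ℕ} (Q : Matrix n) (r c v : Fin n) (P : Fin n → Set) {a b : Fin n} →
               (a ≡ r → b ≡ c → P v) → (¬ (a ≡ r × b ≡ c) → P (Q a b)) → P (replace Q r c v a b)
replace-elim Q r c v P {a} {b} f g with a ≟ r | b ≟ c
... | yes p | yes q = f p q
... | yes _ | no nq = g (λ (_ , q) → nq q)
... | no np | _ = g (λ (p , _) → np p)

module Finish (D : Design) (Λ : Lat D) (ℂ : YConf D Λ) where
  open Base D Λ
  open YConf ℂ
  open GConf 𝔾
  open SubNotation Σ₀
  open Cells D Λ 𝔾
  open LCoordinates D Λ lconf using (exL)
  open Partial D Λ ℂ

  At : Fin 3 → Fin k → Set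
  At m′ b = c b ≡ col m′
  AnyBox : Fin k → Set
  AnyBox b = ∃[ a ] Box a b

  at? : ∀ m′ → Dec (∃ (At m′))
  at? m′ = F.any? (λ b → c b ≟× col m′)
  some? : Dec (∃ CleanC)
  some? = F.any? cleanC?
  anyBox? : Dec (∃ AnyBox)
  anyBox? = F.any? (λ b → F.any? (λ a → Box? a b))

  t : Fin 3 → Bool
  t = mask (does (at? 0F)) (does (at? 1F)) (does (at? 2F))

  vOf : Dec (∃ CleanC) → Maybe (Fin n)
  vOf (yes (b , _)) = just (j b)
  vOf (no _) = nothing
  xOf : Dec (∃ AnyBox) → Maybe (Fin n × Fin n)
  xOf (yes (b , a , _)) = just (i a , j b)
  xOf (no _) = nothing

  V : Maybe (Fin n)
  V = vOf some?
  X : Maybe (Fin n × Fin n)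
  X = xOf anyBox?

  -- The box column is kept apart at the end, being the only one in which the row of the box is not
  -- exact.
  ℓ₀ ℓ : List (Fin k)
  ℓ₀ = add (at? 0F) (add (at? 1F) (add (at? 2F) (add some? [])))
  ℓ = ℓ₀ ++ add anyBox? []

  ℓ≡ : ℓ ≡ add (at? 0F) (add (at? 1F) (add (at? 2F) (add some? (add anyBox? []))))
  ℓ≡ = trans (add-++ (at? 0F) _ _) (cong (add (at? 0F)) (trans (add-++ (at? 1F) _ _) (cong (add (at? 1F)) (trans (add-++ (at? 2F) _ _)
    (cong (add (at? 2F)) (add-++ some? [] _))))))

  wAt : ∀ {m′ b} → At m′ b → W ya b
  wAt q = W-full wκ _ _ q

  at-uniq : ∀ m′ b b′ → At m′ b → At m′ b′ → b ≡ b′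
  at-uniq m′ b b′ p q = c-inj b b′ (trans p (sym q))

  at≢ : ∀ {m₁ m₂ b} → At m₁ b → At m₂ b → m₁ ≡ m₂
  at≢ p q = J-inj _ _ (cong proj₁ (trans (sym p) q))

  at-clean : ∀ {m′ b} → At m′ b → ¬ CleanC b
  at-clean p cc = cc ya (inj₁ (wAt p))

  at-box : ∀ {m′ b} → At m′ b → ¬ AnyBox b
  at-box p (_ , (_ , q) , _) = W-y (wAt p) q

  box-uniq : ∀ b b′ → AnyBox b → AnyBox b′ → b ≡ b′
  box-uniq b b′ (_ , p) (_ , q) = proj₂ (boxU p q)

  ∉-[] : {b : Fin k} → b ∉ []
  ∉-[] ()

  abstract
    uniq : Uniq ℓ
    uniq = subst Uniq (sym ℓ≡)
      (add-uniq (at? 0F) (λ b p m₁ → [ (λ q → 0≢1 (at≢ p q)) , [ (λ q → 0≢2 (at≢ p q)) , tail p ]′ ∘ add-∈ (at? 2F) ]′ (add-∈ (at? 1F) m₁))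
      (add-uniq (at? 1F) (λ b p m₁ → [ (λ q → 1≢2 (at≢ p q)) , tail p ]′ (add-∈ (at? 2F) m₁))
      (add-uniq (at? 2F) (λ b p → tail p)
      (add-uniq some? (λ b cc m₁ → [ (λ (a , bx) → cc a (inj₂ (inj₂ bx))) , ∉-[] ]′ (add-∈ anyBox? m₁))
      (add-uniq anyBox? (λ b _ → ∉-[]) tt)))))
      where
      0≢1 : _≢_ {A = Fin 3} 0F 1F
      0≢1 ()
      0≢2 : _≢_ {A = Fin 3} 0F 2F
      0≢2 ()
      1≢2 : _≢_ {A = Fin 3} 1F 2F
      1≢2 ()
      tail : ∀ {m′ b} → At m′ b → b ∉ add some? (add anyBox? [])
      tail p m₁ = [ at-clean p , [ at-box p , ∉-[] ]′ ∘ add-∈ anyBox? ]′ (add-∈ some? m₁)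

    kinds : ∀ b → (∃[ m′ ] At m′ b) ⊎ (CleanC b ⊎ AnyBox b)
    kinds b = decide (cleanC? b) (λ cc → inj₂ (inj₁ cc)) (λ nc → decide (F.any? (λ a → Box? a b)) (λ bx → inj₂ (inj₂ bx))
      (λ nb → decide (F.any? (λ a → W? a b)) (λ (a , w) → inj₁ (W-col w))
        (λ nw → ⊥-elim (nc (λ a → [ (λ w → nw (a , w)) , [ noE a b , (λ bx → nb (a , bx)) ]′ ]′)))))

    cover : ∀ b → b ∈ ℓ
    cover b = subst (b ∈_) (sym ℓ≡) (go (kinds b))
      where
      go : (∃[ m′ ] At m′ b) ⊎ (CleanC b ⊎ AnyBox b) → b ∈ add (at? 0F) (add (at? 1F) (add (at? 2F) (add some? (add anyBox? []))))
      go (inj₁ (0F , q)) = add-here (at? 0F) (at-uniq 0F) q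
      go (inj₁ (1F , q)) = add-there (at? 0F) (add-here (at? 1F) (at-uniq 1F) q)
      go (inj₁ (2F , q)) = add-there (at? 0F) (add-there (at? 1F) (add-here (at? 2F) (at-uniq 2F) q))
      go (inj₂ (inj₁ cc)) = add-there (at? 0F) (add-there (at? 1F) (add-there (at? 2F) (add-here some? (λ _ _ → cleanUnique) cc)))
      go (inj₂ (inj₂ bx)) = add-there (at? 0F) (add-there (at? 1F) (add-there (at? 2F) (add-there some? (add-here anyBox? box-uniq bx))))

    rowCount : ∀ a d → cnt d (map (λ b → cl (m a b)) ℓ) ≡ HA.Nh d
    rowCount a d = trans (sym (countL-cnt (λ b → cl (m a b)) d ℓ)) (trans (sym (#-countL (λ b → cl (m a b) ≟ d) ℓ uniq (λ b _ → cover b))) (HA.row# (λ u → cl u ≟ d) a))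

  entry : Fin k → Fin n × Fin n
  entry b = j b , cl (m ya b)

  entryAt : ∀ {m′ b} → At m′ b → entry b ≡ (J m′ , new yb m′)
  entryAt q = cong₂ _,_ (cong proj₁ q) (W-cl (wAt q) q (noE _ _))

  entryEx : ∀ {b} → ¬ Dirty ya b → entry b ≡ (j b , A (blk yb) (j b))
  entryEx {b} nd = cong (j b ,_) (trans (sym (clean nd)) (cong (λ u → A u (j b)) iy))

  boxClean : ∀ {b} → AnyBox b → ¬ Dirty ya b
  boxClean (_ , (_ , q) , _) = [ (λ w → W-y w q) , [ noE _ _ , (λ ((p , _) , _) → xy≢0 p) ]′ ]′

  entries-at : ∀ m′ (d : Dec (∃ (At m′))) (xs : List (Fin k)) {ys} → map entry xs ≡ ys →
    map entry (add d xs) ≡ (if does d then (J m′ , new yb m′) ∷ ys else ys)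
  entries-at m′ (yes (b , q)) xs e = cong₂ _∷_ (entryAt q) e
  entries-at m′ (no _) xs e = e

  entries-clean : (d : Dec (∃ CleanC)) → map entry (add d []) ≡ plain yb (vOf d)
  entries-clean (yes (b , cc)) = cong (_∷ []) (entryEx (cc ya))
  entries-clean (no _) = refl

  entries-box : (d : Dec (∃ AnyBox)) → map entry (add d []) ≡ boxed yb (xOf d)
  entries-box (yes (b , bx)) = cong (_∷ []) (entryEx (boxClean bx))
  entries-box (no _) = refl

  put-++ : ∀ (b : Bool) (e : Fin n × Fin n) xs ys → (if b then e ∷ xs else xs) ++ ys ≡ (if b then e ∷ (xs ++ ys) else (xs ++ ys))
  put-++ true e xs ys = refl
  put-++ false e xs ys = refl

  abstract
    entries₀ : map entry ℓ₀ ≡ switched yb t ++ plain yb V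
    entries₀ = sym (trans (put-++ (t 0F) _ _ _) (trans (cong (λ zs → if t 0F then (J 0F , new yb 0F) ∷ zs else zs)
      (trans (put-++ (t 1F) _ _ _) (cong (λ zs → if t 1F then (J 1F , new yb 1F) ∷ zs else zs) (put-++ (t 2F) _ _ _))))
      (sym (entries-at 0F (at? 0F) _ (entries-at 1F (at? 1F) _ (entries-at 2F (at? 2F) _ (entries-clean some?)))))))

    entries : map entry ℓ ≡ config yb t V X
    entries = trans (List.map-++ entry ℓ₀ (add anyBox? [])) (trans (cong₂ _++_ entries₀ (entries-box anyBox?)) (List.++-assoc (switched yb t) (plain yb V) (boxed yb X)))

  classes : List (Fin n)
  classes = map proj₂ (config yb t V X)

  abstract
    -- A row contains every symbol once, so the classes computed from the configuration are those of
    -- all symbols of S.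
    classCount : ∀ d → cnt d classes ≡ HA.Nh d
    classCount d = trans (cong (λ zs → cnt d (map proj₂ zs)) (sym entries)) (trans (cong (cnt d) (sym (List.map-∘ ℓ))) (rowCount ya d))

    exactOK : ∀ {a} → CleanR a → same (exactRow (i a) (config yb t V X)) classes ≡ true
    exactOK {a} cr = same-complete (exactRow (i a) (config yb t V X)) classes (λ d → trans (cong (λ zs → cnt d (exactRow (i a) zs)) (sym entries))
      (trans (cong (cnt d) (trans (sym (List.map-∘ ℓ)) (map-cong∈ ℓ (λ b _ → clean (cr b))))) (trans (rowCount a d) (sym (classCount d)))))

    boxOKt : ∀ {a} → (∃[ b ] Box a b) → a ≢ ya → boxOK yb t V X (i a) ≡ true
    boxOKt {a} (b , bx) ne = go anyBox? refl
      where
      go : (d : Dec (∃ AnyBox)) → d ≡ anyBox? → boxOK yb t V (xOf d) (i a) ≡ true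
      go (no none) _ = ⊥-elim (none (b , a , bx))
      go (yes (b₀ , a₀ , bx₀)) eq = ∧-intro (trans (cong (i a ==_) (cong i (sym a≡))) (==-refl (i a)))
          (same-complete (boxRow yb t V (i a₀ , j b₀)) (map proj₂ (config yb t V (just (i a₀ , j b₀)))) (λ d → trans (cong (cnt d) lists) (trans (rowCount a d) (trans (sym (classCount d)) (cong (λ e → cnt d (map proj₂ (config yb t V (xOf e)))) (sym eq))))))
        where
        a≡ : a ≡ a₀
        a≡ = proj₁ (boxU bx bx₀)
        nw : ∀ b′ → ¬ W a b′
        nw b′ w = ne (W-same w wκ)
        off : ∀ b′ → b′ ∈ ℓ₀ → ¬ AnyBox b′
        off b′ m₁ bx′ = [ (λ p → at-box p bx′) , [ (λ p → at-box p bx′) , [ (λ p → at-box p bx′) , [ (λ cc → cc _ (inj₂ (inj₂ (proj₂ bx′)))) , ∉-[] ]′ ∘ add-∈ some? ]′ ∘ add-∈ (at? 2F) ]′ ∘ add-∈ (at? 1F) ]′ (add-∈ (at? 0F) m₁)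
        first : map (λ b′ → cl (m a b′)) ℓ₀ ≡ exactRow (i a₀) (switched yb t ++ plain yb V)
        first = trans (map-cong∈ ℓ₀ (λ b′ m₁ → trans (sym (clean [ nw b′ , [ noE a b′ , (λ bx′ → off b′ m₁ (a , bx′)) ]′ ]′)) (cong (λ u → A (i u) (j b′)) a≡)))
          (trans (List.map-∘ ℓ₀) (cong (exactRow (i a₀)) entries₀))
        last : cl (m a b₀) ≡ B (i a₀) (j b₀)
        last = trans (cong (λ u → cl (m u b₀)) a≡) (trans (clP a₀ b₀ (λ w → W-y w (proj₂ (proj₁ bx₀))) (noE a₀ b₀)) (Az-box a₀ b₀ bx₀))
        lists : boxRow yb t V (i a₀ , j b₀) ≡ map (λ b′ → cl (m a b′)) ℓ
        lists = sym (trans (List.map-++ _ ℓ₀ (add anyBox? [])) (cong₂ _++_ first (trans (cong (λ e → map (λ b′ → cl (m a b′)) (add e [])) (sym eq)) (cong (_∷ []) last))))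

    present : ∀ m′ → t m′ ≡ true → ∃ (At m′)
    present 0F e = does-sound (at? 0F) e
    present 1F e = does-sound (at? 1F) e
    present 2F e = does-sound (at? 2F) e

    absent : ∀ m′ → t m′ ≡ false → ¬ ∃ (At m′)
    absent m′ e p = contradiction (trans (sym (tt′ m′ p)) e) λ ()
      where
      yes-does : {P : Set} (d : Dec P) → P → does d ≡ true
      yes-does (yes _) _ = refl
      yes-does (no np) p = ⊥-elim (np p)
      tt′ : ∀ m′ → ∃ (At m′) → t m′ ≡ true
      tt′ 0F = yes-does (at? 0F)
      tt′ 1F = yes-does (at? 1F)
      tt′ 2F = yes-does (at? 2F)

    hit : t (proj₁ (W-col wκ)) ≡ true
    hit = go (t (proj₁ (W-col wκ))) refl
      where
      go : ∀ b → t (proj₁ (W-col wκ)) ≡ b → t (proj₁ (W-col wκ)) ≡ true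
      go true e = e
      go false e = ⊥-elim (absent _ e (bκ , proj₂ (W-col wκ)))

    isFree : ∀ {b} → CleanC b → free t (j b) ≡ true
    isFree {b} cc = allB-complete 3 _ (λ m′ → not-intro (go m′ (t m′) refl))
      where
      go : ∀ m′ b′ → t m′ ≡ b′ → b′ ∧ (j b == J m′) ≡ false
      go m′ false e = refl
      go m′ true e = ≢⇒==false (λ f → apart (wAt (proj₂ (present m′ e))) cc (trans f (sym (cong proj₁ (proj₂ (present m′ e))))))

    enough : 2 ≤ length (config yb t V X)
    enough = ℕ.≤-trans 2≤k (ℕ.≤-trans (subst (_≤ length ℓ) total (#-cover {P = λ _ → ⊤} (λ _ → yes tt) ℓ (λ b _ → cover b)))
      (ℕ.≤-reflexive (trans (sym (List.length-map entry ℓ)) (cong length entries))))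

    isValid : valid yb t V X ≡ true
    isValid = go some? anyBox? enough refl
      where
      go : (d : Dec (∃ CleanC)) (e : Dec (∃ AnyBox)) → 2 ≤ length (config yb t (vOf d) (xOf e)) → d ≡ some? → valid yb t (vOf d) (xOf e) ≡ true
      go (no _) (no _) len _ = ≤ᵇ-complete (subst (2 ≤_) (cong length (List.++-identityʳ (switched yb t))) len)
      go (no none) (yes (_ , _ , bx)) _ _ = ⊥-elim (none (let (b , cc , _) = boxClass bx in b , cc))
      go (yes (b , cc)) (no _) _ _ = ∧-intro (anyB-complete 3 t _ hit) (isFree cc)
      go (yes (b , cc)) (yes (b₀ , a₀ , bx)) _ _ = ∧-intro (anyB-complete 3 t _ hit) (∧-intro (isFree cc) (∧-intro
          (not-intro (≢⇒==false (λ e → CA.good≢onlyBad (goodC cc) (onlyC (inj₂ (inj₂ bx) , alone)) (sym e))))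
          (∧-intro (trans (cong (B (i a₀) (j b₀) ==_) (sym cls)) (==-refl (B (i a₀) (j b₀)))) (not-intro (off (proj₂ bx))))))
        where
        alone : ∀ a → a ≢ a₀ → ¬ Dirty a b₀
        alone a ne = [ (λ w → W-y w (proj₂ (proj₁ bx))) , [ noE a b₀ , (λ bx′ → ne (proj₁ (boxU bx′ bx))) ]′ ]′
        cls : B (i a₀) (j b₀) ≡ A (blk yb) (j b)
        cls = let (b′ , cc′ , e) = boxClass bx in trans (sym e) (cong₂ A iy (clean≡ cc′ cc))
        off : {u v : Fin n} → ¬ (u ≡ zero × v ≡ zero) → (u == zero) ∧ (v == zero) ≡ false
        off {u} {v} ne = decide (u ≟ zero) (λ e → trans (cong (λ w → (w == zero) ∧ (v == zero)) e) (≢⇒==false (λ f → ne (e , f))))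
          (λ f → cong (_∧ (v == zero)) (≢⇒==false f))

    -- Some class of row ya can be supplied in a switched column only by a row that the remaining columns exclude.
    notStuck : stuck yb t V X ≡ true → ⊥
    notStuck e = step (anyB-sound _ e)
      where
      needed : Fin 3 → Fin n → Bool
      needed m′ u = (if A u (J m′) == new yb m′ then 2 else 1) ≤ᵇ cnt (A u (J m′)) classes
      unlike : Fin n → Bool
      unlike u = not (same (exactRow u (config yb t V X)) classes)
      Blocked : Fin 3 → Fin n → Set
      Blocked m′ u = needed m′ u ∧ (unlike u ∧ not (boxOK yb t V X u)) ≡ true
      contra : ∀ {u} a → i a ≡ u → a ≢ ya → same (exactRow u (config yb t V X)) classes ≡ false → boxOK yb t V X u ≡ false → ⊥
      contra {u} a e ne f f′ = decide (F.any? (Box? a))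
        (λ bx → contradiction (trans (sym (boxOKt bx ne)) (trans (cong (boxOK yb t V X) e) f′)) λ ())
        (λ nb → contradiction (trans (sym (exactOK (λ b → [ (λ w → ne (W-same w wκ)) , [ noE a b , (λ bx → nb (b , bx)) ]′ ]′)))
          (trans (cong (λ w → same (exactRow w (config yb t V X)) classes) e) f)) λ ())
      -- In an exchanged column every cell but that of `ya` is exact, so a symbol of class
      -- `A u (J m′)` there reveals a row labelled `u`.
      supply : ∀ m′ b u → At m′ b → (if A u (J m′) == new yb m′ then 2 else 1) ≤ HA.Nh (A u (J m′)) → ∃[ a ] (i a ≡ u × a ≢ ya)
      supply m′ b u q le = found (A u (J m′) == new yb m′) refl le
        where
        w : W ya b
        w = wAt q
        back : ∀ {a} → cl (m a b) ≡ A u (J m′) → a ≢ ya → i a ≡ u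
        back {a} e ne = AC.col (J m′) (trans (trans (cong (A (i a)) (sym (cong proj₁ q))) (clean (proj₂ (oneW w) a ne))) e)
        cnt≡ : HA.Nh (A u (J m′)) ≡ # (λ a → cl (m a b) ≟ A u (J m′))
        cnt≡ = sym (HA.col# (λ d → cl d ≟ A u (J m′)) b)
        found : ∀ x′ → A u (J m′) == new yb m′ ≡ x′ → (if x′ then 2 else 1) ≤ HA.Nh (A u (J m′)) → ∃[ a ] (i a ≡ u × a ≢ ya)
        found true _ le = let (a , e , ni) = #-fresh (λ a → cl (m a b) ≟ A u (J m′)) (ya ∷ []) (subst (2 ≤_) cnt≡ le)
                              ne = λ f → ni (here f) in a , back e ne , ne
        found false f le = let (a , e) = #-pick (λ a → cl (m a b) ≟ A u (J m′)) (subst (1 ≤_) cnt≡ le)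
                               ne = λ g → contradiction (trans (sym (trans (cong (_== new yb m′) (trans (sym e) (trans (cong (λ u → cl (m u b)) g) (W-cl w q (noE ya b))))) (==-refl (new yb m′)))) f) λ ()
                           in a , back e ne , ne
      step₂ : ∀ m′ → t m′ ≡ true → ∃[ u ] Blocked m′ u → ⊥
      step₂ m′ tm (u , f) = contra (proj₁ su) (proj₁ (proj₂ su)) (proj₂ (proj₂ su)) (not-t (∧-l {unlike u} {not (boxOK yb t V X u)} (∧-r {needed m′ u} f))) (not-t (∧-r {unlike u} (∧-r {needed m′ u} f)))
        where
        su : ∃[ a ] (i a ≡ u × a ≢ ya)
        su = supply m′ _ u (proj₂ (present m′ tm)) (ℕ.≤-trans (≤ᵇ-sound _ _ (∧-l {needed m′ u} f)) (ℕ.≤-reflexive (classCount (A u (J m′)))))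
      step : ∃[ m′ ] (t m′ ∧ anyB n (λ u → ((if A u (J m′) == new yb m′ then 2 else 1) ≤ᵇ cnt (A u (J m′)) classes) ∧
        (not (same (exactRow u (config yb t V X)) classes) ∧ not (boxOK yb t V X u))) ≡ true) → ⊥
      step (m′ , f) = step₂ m′ (∧-l f) (anyB-sound _ (∧-r f))

  Excl : Bool → (Fin 3 → Bool) → Maybe (Fin n) → Maybe (Fin n × Fin n) → Set
  Excl y t V X = y ≡ true × (∃[ v ] (V ≡ just v × v ≢ zero)) × X ≡ nothing × t 0F ≡ false × t 1F ≡ false × t 2F ≡ true

  excl : ∀ y t V X → exception y t V X ≡ true → Excl y t V X
  excl true t (just (suc v)) nothing e = refl , (suc v , refl , λ ()) , refl , not-t (∧-l e) , not-t (∧-l (∧-r {not (t 0F)} e)) , ∧-r {not (t 1F)} (∧-r {not (t 0F)} e)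
  excl true t nothing X ()
  excl true t (just zero) X ()
  excl true t (just (suc v)) (just _) ()
  excl false t V X ()

  -- S has order two and avoids block column zero, so its L-labels are exact but for the exchanged
  -- cell, which shows `L (R false) (K 2F)`: an intercalate of the matrix considered in condition
  -- (iii).
  module Intercalate (y≡ : yb ≡ true) {g b₂ : Fin k} (jg : j g ≢ zero) (cg : CleanC g) (q₂ : At 2F b₂) (all : ∀ b → b ≡ b₂ ⊎ b ≡ g) where
    k≡2 : k ≡ 2
    k≡2 = ℕ.≤-antisym (subst (_≤ 2) total (#-cover {P = λ _ → ⊤} (λ _ → yes tt) (b₂ ∷ g ∷ []) (λ b _ → [ here , (λ e → there (here e)) ]′ (all b)))) 2≤k

    pair : ∀ {t u v : Fin k} → u ≢ t → v ≢ t → u ≡ v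
    pair = pairEq {P = λ _ → ⊤} (λ _ → yes tt) (ℕ.≤-reflexive (trans total k≡2)) tt tt tt

    b₂≢g : b₂ ≢ g
    b₂≢g e = at-clean q₂ (subst CleanC (sym e) cg)

    j≢0 : ∀ b → j b ≢ zero
    j≢0 b = [ (λ e p → 2≢0 (J-inj 2F 0F (trans (sym (trans (cong j e) (cong proj₁ q₂))) (trans p (sym J₀))))) , (λ e p → jg (trans (sym (cong j e)) p)) ]′ (all b)
      where
      2≢0 : _≢_ {A = Fin 3} 2F 0F
      2≢0 ()

    zex : ∀ a b → ¬ W a b → L (x a) (y b) ≡ z (m a b)
    zex a b nw = exL nw (λ (_ , p) → j≢0 b p)

    xR : x ya ≡ R true
    xR = trans xy (cong R y≡)
    yK : y b₂ ≡ K 2F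
    yK = cong proj₂ q₂
    z₂ : z (m ya b₂) ≡ Z 0F
    z₂ = trans (W-z (wAt q₂) q₂) (cong (λ b → if b then Z 0F else Z 2F) y≡)
    zg : z (m ya g) ≡ L (R true) (y g)
    zg = sym (trans (cong (λ u → L u (y g)) (sym xR)) (zex ya g (λ w → cg ya (inj₁ w))))

    Z≢₀₂ : Z 2F ≢ Z 0F
    Z≢₀₂ e = 1≢2 (K-inj 1F 2F (LC.row (R false) (trans (L₂ 1F) (trans e (sym (L₂ 2F))))))
      where
      1≢2 : _≢_ {A = Fin 3} 1F 2F
      1≢2 ()

    module Other {a : Fin k} (ne : a ≢ ya) where
      nw : ∀ b → ¬ W a b
      nw b w = ne (W-same w wκ)
      m₂ : m a b₂ ≡ m ya g
      m₂ = pair {t = m a g} (λ e → b₂≢g (mC.row a e)) (λ e → ne (mC.col g (sym e)))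
      mg : m a g ≡ m ya b₂
      mg = pair {t = m ya g} (λ e → ne (mC.col g e)) (λ e → b₂≢g (mC.row ya e))
      v₂ : L (x a) (K 2F) ≡ L (R true) (y g)
      v₂ = trans (cong (L (x a)) (sym yK)) (trans (zex a b₂ (nw b₂)) (trans (cong z m₂) zg))
      vg : L (x a) (y g) ≡ Z 0F
      vg = trans (zex a g (nw g)) (trans (cong z mg) z₂)
      x≢ : x a ≢ R true
      x≢ e = Z≢₀₂ (trans (trans Z₂ (cong (L (R true)) K≡)) (trans (cong (λ u → L u (y g)) (sym e)) vg))
        where
        K≡ : K 2F ≡ y g
        K≡ = LC.row (R true) (trans (cong (λ u → L u (K 2F)) (sym e)) v₂)
      y≢ : y g ≢ K 2F
      y≢ e = x≢ (LC.col (K 2F) (trans v₂ (cong (L (R true)) e)))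
      z≢ : z (m ya b₂) ≢ z (m ya g)
      z≢ e = y≢ (LC.row (x a) (trans vg (trans (sym z₂) (trans e (trans zg (sym v₂))))))

    abstract
      o : ∃[ a ] a ≢ ya
      o = let (a , ni) = freshFin (ya ∷ []) 2≤k in a , λ e → ni (here e)

    xinj : ∀ a a′ → x a ≡ x a′ → a ≡ a′
    xinj a a′ e = decide (a ≟ ya)
      (λ p → decide (a′ ≟ ya) (λ p′ → trans p (sym p′)) (λ ne → ⊥-elim (Other.x≢ ne (trans (sym e) (trans (cong x p) xR)))))
      (λ ne → decide (a′ ≟ ya) (λ p′ → ⊥-elim (Other.x≢ ne (trans e (trans (cong x p′) xR)))) (λ ne′ → pair ne ne′))

    yinj : ∀ b b′ → y b ≡ y b′ → b ≡ b′
    yinj b b′ e = [ (λ p → [ (λ p′ → trans p (sym p′)) , (λ p′ → ⊥-elim (ne (trans (cong y (sym p′)) (trans (sym e) (trans (cong y p) yK))))) ]′ (all b′)) ,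
      (λ p → [ (λ p′ → ⊥-elim (ne (trans (cong y (sym p)) (trans e (trans (cong y p′) yK))))) , (λ p′ → trans p (sym p′)) ]′ (all b′)) ]′ (all b)
      where
      ne : y g ≢ K 2F
      ne = Other.y≢ (proj₂ o)

    zinj : ∀ t t′ → z t ≡ z t′ → t ≡ t′
    zinj t t′ e = decide (t ≟ m ya g)
      (λ p → decide (t′ ≟ m ya g) (λ p′ → trans p (sym p′)) (λ ne → ⊥-elim (z≢ (trans (cong z (pair {t = m ya g} (λ f → b₂≢g (mC.row ya f)) ne)) (trans (sym e) (cong z p))))))
      (λ ne → decide (t′ ≟ m ya g) (λ p′ → ⊥-elim (z≢ (trans (cong z (pair {t = m ya g} (λ f → b₂≢g (mC.row ya f)) ne)) (trans e (cong z p′))))) (λ ne′ → pair ne ne′))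
      where
      z≢ : z (m ya b₂) ≢ z (m ya g)
      z≢ = Other.z≢ (proj₂ o)

    value : ∀ a b → replace L (R true) (K 2F) (L (R false) (K 2F)) (x a) (y b) ≡ z (m a b)
    value a b = replace-elim L (R true) (K 2F) (L (R false) (K 2F)) (_≡ z (m a b))
      (λ p q → trans (L₂ 2F) (trans (sym z₂) (cong₂ (λ u v → z (m u v)) (xinj ya a (trans xR (sym p))) (yinj b₂ b (trans yK (sym q))))))
      (λ ne → zex a b (λ w → ne (trans (cong x (W-same w wκ)) xR , trans (cong y (at b w)) yK)))
      where
      at : ∀ b → W a b → b ≡ b₂
      at b w = [ id , (λ e → ⊥-elim (cg a (inj₁ (subst (W a) e w)))) ]′ (all b)

    intercalate : ⊥
    intercalate = no2 (subst (HasSubsquare (replace L (R true) (K 2F) (L (R false) (K 2F)))) k≡2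
      (x , y , z , (λ {a} {a′} → xinj a a′) , (λ {b} {b′} → yinj b b′) , cancel→latin _ z m mC zinj value))

  exceptional : exception yb t V X ≡ true → ⊥
  exceptional e = go (excl yb t V X e) some? refl
    where
    go : Excl yb t V X → (d : Dec (∃ CleanC)) → d ≡ some? → ⊥
    go (y≡ , (v , V≡ , v≢) , X≡ , f₀ , f₁ , f₂) d eq = goV d eq (trans (cong vOf eq) V≡)
      where
      noBox : (e : Dec (∃ AnyBox)) → xOf e ≡ nothing → ¬ ∃ AnyBox
      noBox (no nb) _ = nb
      b₂ : Fin k
      b₂ = proj₁ (present 2F f₂)
      q₂ : At 2F b₂
      q₂ = proj₂ (present 2F f₂)
      goV : (d : Dec (∃ CleanC)) → d ≡ some? → vOf d ≡ just v → ⊥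
      goV (yes (g , cg)) _ refl = Intercalate.intercalate y≡ v≢ cg q₂ (λ b → kind b (kinds b))
        where
        kind : ∀ b → (∃[ m′ ] At m′ b) ⊎ (CleanC b ⊎ AnyBox b) → b ≡ b₂ ⊎ b ≡ g
        kind b (inj₁ (0F , q)) = ⊥-elim (absent 0F f₀ (b , q))
        kind b (inj₁ (1F , q)) = ⊥-elim (absent 1F f₁ (b , q))
        kind b (inj₁ (2F , q)) = inj₁ (at-uniq 2F b b₂ q q₂)
        kind b (inj₂ (inj₁ cc)) = inj₂ (cleanUnique cc cg)
        kind b (inj₂ (inj₂ bx)) = ⊥-elim (noBox anyBox? X≡ (b , bx))

  absurd : ⊥
  absurd = go (exception yb t V X) refl
    where
    go : ∀ e → exception yb t V X ≡ e → ⊥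
    go true e = exceptional e
    go false e = notStuck (isStuck yb (does (at? 0F)) (does (at? 1F)) (does (at? 2F)) V X isValid e)

-- Subarrays with a raised cell

most : {k : ℕ} {P Q : Fin k → Set} (P? : Decidable P) (Q? : Decidable Q) (xs : List (Fin k)) → # Q? ≤ 2 →
       (∀ b → ¬ P b → Q b ⊎ b ∈ xs) → k ≤ # P? + (2 + length xs)
most {k} P? Q? xs q f = begin
  k ≡⟨ #-compl P? ⟨
  # P? + # (λ b → ¬? (P? b)) ≤⟨ ℕ.+-monoʳ-≤ (# P?) (#-union Q? in? (λ b → ¬? (P? b)) f) ⟩
  # P? + (# Q? + # in?) ≤⟨ ℕ.+-monoʳ-≤ (# P?) (ℕ.+-mono-≤ q (#-cover in? xs (λ _ p → p))) ⟩
  # P? + (2 + length xs) ∎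
  where
  open ℕ.≤-Reasoning
  in? : Decidable (_∈ xs)
  in? b = any? (b ≟_) xs

record EConf (D : Design) (Λ : Lat D) : Set₁ where
  field
    𝔾 : GConf D Λ
  open GConf 𝔾
  open Base.Sub Σ₀
  field
    ea eb : Fin k
    eE : E ea eb
    8≤k : 8 ≤ k
    k≤9 : k ≤ 9

module Raised (D : Design) (Λ : Lat D) (ℂ : EConf D Λ) where
  open Base D Λ
  open EConf ℂ
  open GConf 𝔾
  open SubNotation Σ₀
  open Cells D Λ 𝔾
  open LCoordinates D Λ lconf using (w₀; exL; shL; goodR₀; goodC₀; Nh≡Ng; Nh≡Nf; Thin₀; boxUnique; module Wide)

  -- The bound `10 ≤ μ` enters: a subarray with a raised cell is too small to meet every label of L.
  μ≰k : ¬ μ ≤ k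
  μ≰k le = ℕ.<⇒≱ 10≤μ (ℕ.≤-trans le k≤9)

  ≤k : ∀ {l} → l ≤ 8 → l ≤ k
  ≤k le = ℕ.≤-trans le 8≤k

  AnyBox AnyBoxR : Fin k → Set
  AnyBox b = ∃[ a ] Box a b
  AnyBoxR a = ∃[ b ] Box a b

  anyBox? : Decidable AnyBox
  anyBox? b = F.any? (λ a → Box? a b)
  anyBoxR? : Decidable AnyBoxR
  anyBoxR? a = F.any? (Box? a)

  module NoSwitch (nw : ∀ a b → ¬ W a b) where
    zL : ∀ a b → ¬ (i a ≡ zero × j b ≡ zero) → HL.Ex a b
    zL a b = exL (nw a b)

    -- With multiplicity at least two on several labels, N∞ would give all μ labels. On one label
    -- only, S lies over the copy of B; three columns other than the raised one make it the whole
    -- copy, whose corner contradicts the shift.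
    thin : Thin₀
    thin {a₁} {b₁} ni xa nj yb₀ = decide (2 ≤? HL.Nf zero) (λ two → ⊥-elim (thick two (2 ≤? # Wd.Di.Df?))) (λ ≰ → s≤s⁻¹ (ℕ.≰⇒> ≰))
      where
      module Wd = Wide ni xa nj yb₀
      module RS = LSide LC HL i j σ σ-inj rinj cinj zL (λ a b → shL (nw a b)) (goodR₀ ni xa) (goodC₀ nj yb₀)
      module CS = LSide (flipC LC) (flipH HL) j i σ σ-inj cinj rinj (λ b a ne → zL a b (λ (p , q) → ne (q , p))) (λ b a p q → shL (nw a b) q p) (goodC₀ nj yb₀) (goodR₀ ni xa)
      thick : 2 ≤ HL.Nf zero → Dec (2 ≤ # Wd.Di.Df?) → ⊥
      thick two (yes D≥2) = μ≰k (onto⇒≤ x (λ u → #-pick (λ a → x a ≟ u) (subst (1 ≤_) (sym (#-full Wd.Di.Df? (Wd.Di.dichotomy (Wd.sat two′ (inj₁ (λ {a} {b} w → ⊥-elim (nw a b w)))) D≥2) u)) (ℕ.≤-trans (s≤s z≤n) two′))))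
        where
        two′ : 2 ≤ Wd.Di.d
        two′ = subst (2 ≤_) (sym Wd.d≡) two
      thick two (no D≱2) = nocorner (proj₁ (I.f-onto zero)) (proj₁ (I.g-onto zero)) (proj₂ (I.f-onto zero)) (proj₂ (I.g-onto zero))
        where
        two′ : 2 ≤ Wd.Di.d
        two′ = subst (2 ≤_) (sym Wd.d≡) two
        le : # Wd.Di.Df? ≤ 1
        le = s≤s⁻¹ (ℕ.≰⇒> D≱2)
        d′≡d : HL.Ng (y b₁) ≡ Wd.Di.d
        d′≡d = Wd.Di.d-col (goodC₀ nj yb₀)
        le′ : # CS.Df? ≤ 1
        le′ = subst (_≤ 1) (sym (trans (#-cong CS.Df? Wd.Di.Dg? (λ v e → trans e d′≡d) (λ v e → trans e (sym d′≡d))) (trans (sym Wd.Di.#Dh≡#Dg) Wd.Di.#Dh≡#Df))) le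
        x0 : ∀ a → x a ≡ zero
        x0 a = trans (RS.oneRow two′ le a) xa
        y0 : ∀ b → y b ≡ zero
        y0 b = trans (CS.oneRow (subst (2 ≤_) (sym d′≡d) two′) le′ b) yb₀
        allz : ∀ t → z t ≡ w₀
        allz = #-full (λ t → z t ≟ w₀) (ℕ.≤-reflexive (sym (trans (Nh≡Nf nj yb₀) (#-all _ x0))))
        nocorner : ∀ a b → i a ≡ zero → j b ≡ zero → ⊥
        nocorner a b p q = σ-moves w₀ (trans (cong σ (cong₂ L (sym (x0 a)) (sym (y0 b)))) (trans (sym (shL (nw a b) p q)) (allz (m a b))))
        iinj : ∀ a a′ → i a ≡ i a′ → a ≡ a′
        iinj a a′ e = rinj a a′ e (trans (x0 a) (sym (x0 a′)))
        jinj : ∀ b b′ → j b ≡ j b′ → b ≡ b′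
        jinj b b′ e = cinj b b′ e (trans (y0 b) (sym (y0 b′)))
        HB : Hom k B
        HB = record { f = i ; g = j ; h = cl ; m = m ; mC = mC }
        good : ∀ {b} → b ≢ eb → Hom.GoodC HB b
        good {b} ne a = trans (sym (Az-box a b ((x0 a , y0 b) , λ (p , q) → nocorner a b p q))) (sym (clP a b (nw a b) (λ e → ne (proj₂ (E-uniq e eE)))))
        f₁ : ∃[ b ] b ∉ eb ∷ []
        f₁ = freshFin (eb ∷ []) (≤k (s≤s (s≤s z≤n)))
        f₂ : ∃[ b ] b ∉ proj₁ f₁ ∷ eb ∷ []
        f₂ = freshFin (proj₁ f₁ ∷ eb ∷ []) (≤k (s≤s (s≤s (s≤s z≤n))))
        f₃ : ∃[ b ] b ∉ proj₁ f₂ ∷ proj₁ f₁ ∷ eb ∷ []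
        f₃ = freshFin (proj₁ f₂ ∷ proj₁ f₁ ∷ eb ∷ []) (≤k (s≤s (s≤s (s≤s (s≤s z≤n)))))
        module I = InBox BC B-rigid₃ HB iinj jinj {proj₁ f₁} {proj₁ f₂} {proj₁ f₃} (λ e → proj₂ f₂ (here (sym e))) (λ e → proj₂ f₃ (there (here (sym e)))) (λ e → proj₂ f₃ (here (sym e)))
          (good (λ e → proj₂ f₁ (here e))) (good (λ e → proj₂ f₂ (there (here e)))) (good (λ e → proj₂ f₃ (there (there (here e)))))

    boxU : ∀ {a b a′ b′} → Box a b → Box a′ b′ → a ≡ a′ × b ≡ b′
    boxU = boxUnique thin

    inColumn : (∀ a b → Box a b → b ≡ eb) → ∀ a₀ → (∀ a b → Box a b → a ≡ a₀) → ⊥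
    inColumn oc a₀ or = fewR {ea} {eb} (inj₂ (inj₁ eE) , λ b ne → [ nw ea b , [ (λ e → ne (proj₂ (E-uniq e eE))) , (λ bx → ne (oc ea b bx)) ]′ ]′)
      (ea ∷ a₀ ∷ []) (λ a ni b → [ nw a b , [ (λ e → ni (here (proj₁ (E-uniq e eE)))) , (λ bx → ni (there (here (or a b bx)))) ]′ ]′) (≤k (s≤s (s≤s (s≤s (s≤s (s≤s z≤n))))))

    -- A box outside the raised column leaves the raised cell as the only fault of its column.
    -- Otherwise all boxes lie in that column, and the raised cell is the only faulty cell of its
    -- row.
    absurd : ⊥
    absurd = decide (F.any? (λ a → F.any? (λ b → Box? a b ×-dec ¬? (b ≟ eb))))
      (λ (a₀ , b₀ , bx₀ , ne₀) → fewC {ea} {eb}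
        (inj₂ (inj₁ eE) , λ a ne → [ nw a eb , [ (λ e → ne (proj₁ (E-uniq e eE))) , (λ bx → ne₀ (proj₂ (boxU bx₀ bx))) ]′ ]′)
        (eb ∷ b₀ ∷ []) (λ b ni a → [ nw a b , [ (λ e → ni (here (proj₂ (E-uniq e eE)))) , (λ bx → ni (there (here (proj₂ (boxU bx bx₀))))) ]′ ]′)
        (≤k (s≤s (s≤s (s≤s (s≤s (s≤s z≤n)))))))
      (λ none → let oc = λ a b bx → stable (b ≟ eb) (λ ne → none (a , b , bx , ne)) in
        decide (F.any? anyBoxR?)
          (λ (a₀ , b₀ , bx₀) → inColumn oc a₀ (λ a b bx → proj₁ (boxU bx bx₀)))
          (λ nb → inColumn oc ea (λ a b bx → ⊥-elim (nb (a , b , bx)))))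

  module Switch {ya bκ : Fin k} (wκ : W ya bκ) where
    xy≢0 : x ya ≢ zero
    xy≢0 = W-x wκ

    At : Fin 3 → Fin k → Set
    At m′ b = c b ≡ col m′
    at? : ∀ m′ → Dec (∃ (At m′))
    at? m′ = F.any? (λ b → c b ≟× col m′)
    wAt : ∀ {m′ b} → At m′ b → W ya b
    wAt q = W-full wκ _ _ q
    at-uniq : ∀ m′ b b′ → At m′ b → At m′ b′ → b ≡ b′
    at-uniq m′ b b′ p q = c-inj b b′ (trans p (sym q))

    W-block : ∀ {a b a′ b′} → W a b → W a′ b′ → j b ≡ j b′ → b ≡ b′
    W-block w w′ e = c-inj _ _ (trans (proj₂ (W-col w)) (trans (cong col (J-inj _ _ (trans (sym (cong proj₁ (proj₂ (W-col w)))) (trans e (cong proj₁ (proj₂ (W-col w′))))))) (sym (proj₂ (W-col w′)))))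

    abstract
      -- Where `boxUnique` does not apply, `d ≥ 3` would spread to all columns of L and exceed the
      -- order, so label zero has multiplicity at most two.
      fewBoxes : # anyBoxR? ≤ 2 × # anyBox? ≤ 2
      fewBoxes = decide (F.any? (λ a → ¬? (i a ≟ zero) ×-dec (x a ≟ zero)))
        (λ (a₁ , ni , xa) → decide (F.any? (λ b → ¬? (j b ≟ zero) ×-dec (y b ≟ zero)))
          (λ (b₁ , nj , y0) → Both.bound ni xa nj y0)
          (λ none → unique (λ _ _ nj y0 → ⊥-elim (none (_ , nj , y0)))))
        (λ none → unique (λ ni xa _ _ → ⊥-elim (none (_ , ni , xa))))
        where
        unique : Thin₀ → # anyBoxR? ≤ 2 × # anyBox? ≤ 2
        unique thin = ℕ.≤-trans (≡⇒≤1 anyBoxR? (λ a a′ (_ , p) (_ , q) → proj₁ (boxUnique thin p q))) (s≤s z≤n) ,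
                      ℕ.≤-trans (≡⇒≤1 anyBox? (λ b b′ (_ , p) (_ , q) → proj₂ (boxUnique thin p q))) (s≤s z≤n)
        module Both {a₁ b₁ : Fin k} (ni : i a₁ ≢ zero) (xa : x a₁ ≡ zero) (nj : j b₁ ≢ zero) (y0 : y b₁ ≡ zero) where
          module Wd = Wide ni xa nj y0
          d≤2 : Wd.Di.d ≤ 2
          d≤2 = decide (3 ≤? Wd.Di.d) (λ three → ⊥-elim (μ≰k (onto⇒≤ y (λ v → #-pick (λ b → y b ≟ v)
            (subst (1 ≤_) (sym (Wd.spread (ℕ.≤-trans (s≤s (s≤s z≤n)) three) (inj₂ three) wκ v)) (ℕ.≤-trans (s≤s z≤n) three)))))) (λ ≰ → s≤s⁻¹ (ℕ.≰⇒> ≰))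
          bound : # anyBoxR? ≤ 2 × # anyBox? ≤ 2
          bound = ℕ.≤-trans (#-mono anyBoxR? (λ a → x a ≟ zero) (λ a (_ , (p , _) , _) → p)) (subst (_≤ 2) Wd.d≡ d≤2) ,
                  ℕ.≤-trans (#-mono anyBox? (λ b → y b ≟ zero) (λ b (_ , (_ , q) , _) → q)) (subst (_≤ 2) (sym Wd.Ng₀) d≤2)

    overKind : ∀ {a b b′} → W a b → j b′ ≡ j b → b′ ≡ b ⊎ (b′ ≡ eb ⊎ AnyBox b′)
    overKind {a} {b} {b′} w e = decide (F.any? (λ a′ → W? a′ b′)) (λ (_ , w′) → inj₁ (W-block w′ w e))
      (λ nw → decide (b′ ≟ eb) (λ f → inj₂ (inj₁ f)) (λ ne → decide (anyBox? b′) (λ bx → inj₂ (inj₂ bx))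
        (λ nb → ⊥-elim (apart w (λ a′ → [ (λ w′ → nw (a′ , w′)) , [ (λ f → ne (proj₂ (E-uniq f eE))) , (λ bx → nb (a′ , bx)) ]′ ]′) e))))

    abstract
      -- By `apart` the block of an exchanged column holds besides it only the raised column and box
      -- columns, and of these just one, as their L-label is zero.
      over : ∀ {a b} → W a b → (xs : List (Fin k)) → (j eb ≡ j b → eb ∈ xs) → HA.Ng (j b) ≤ 2 + length xs
      over {a} {b} w xs f = decide (F.any? (λ b′ → (j b′ ≟ j b) ×-dec (y b′ ≟ zero)))
        (λ (b₀ , p , q) → #-cover (λ b′ → j b′ ≟ j b) (b ∷ b₀ ∷ xs) (λ b′ e → [ here , [ (λ g → there (there (subst (_∈ xs) (sym g) (f (trans (cong j (sym g)) e))))) ,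
          (λ (_ , (_ , q′) , _) → there (here (cinj b′ b₀ (trans e (sym p)) (trans q′ (sym q))))) ]′ ]′ (overKind w e)))
        (λ none → ℕ.m≤n⇒m≤1+n (#-cover (λ b′ → j b′ ≟ j b) (b ∷ xs) (λ b′ e → [ here , [ (λ g → there (subst (_∈ xs) (sym g) (f (trans (cong j (sym g)) e)))) ,
          (λ (_ , (_ , q′) , _) → ⊥-elim (none (b′ , e , q′))) ]′ ]′ (overKind w e))))

    over₃ : ∀ {a b} → W a b → HA.Ng (j b) ≤ 3
    over₃ w = over w (eb ∷ []) (λ _ → here refl)

    over₂ : ∀ {a b} → W a b → j eb ≢ j b → HA.Ng (j b) ≤ 2
    over₂ w ne = over w [] (λ e → ⊥-elim (ne e))

    dirtyRow : ∀ {a} → ¬ CleanR a → AnyBoxR a ⊎ (a ≡ ya ⊎ a ≡ ea)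
    dirtyRow {a} nc = decide (anyBoxR? a) inj₁ (λ nb → decide (a ≟ ya) (λ e → inj₂ (inj₁ e)) (λ n₁ → decide (a ≟ ea) (λ e → inj₂ (inj₂ e))
      (λ n₂ → ⊥-elim (nc (λ b → [ (λ w → n₁ (W-same w wκ)) , [ (λ e → n₂ (proj₁ (E-uniq e eE))) , (λ bx → nb (b , bx)) ]′ ]′)))))

    -- A row with one fault puts the clean rows under one label of A. There are at least four: of
    -- eight rows, two may meet the box, and `ya` and `ea` are lost. Read in column `bκ` against a
    -- clean row, they force four columns into its block, against `over₃`.
    byRow : ∀ {a₀ b₀} → OneR a₀ b₀ → ⊥
    byRow o = ℕ.<⇒≱ (ℕ.≤-trans four many) (over₃ wκ)
      where
      four : 4 ≤ # cleanR?
      four = ℕ.+-cancelʳ-≤ 4 4 (# cleanR?) (ℕ.≤-trans 8≤k (most cleanR? anyBoxR? (ya ∷ ea ∷ []) (proj₁ fewBoxes)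
        (λ a nc → [ inj₁ , [ (λ e → inj₂ (here e)) , (λ e → inj₂ (there (here e))) ]′ ]′ (dirtyRow nc))))
      abstract
        cr : ∃ CleanR
        cr = #-pick cleanR? (ℕ.≤-trans (s≤s z≤n) four)
      many : # cleanR? ≤ HA.Ng (j bκ)
      many = ℕ.≤-trans (#-mono cleanR? (λ a → cl (m a bκ) ≟ A (i (proj₁ cr)) (j bκ)) (λ a c′ → trans (sym (clean (c′ bκ))) (cong (λ u → A u (j bκ)) (sameR o c′ (proj₂ cr)))))
        (ℕ.≤-reflexive (trans (HA.col# (λ t → cl t ≟ A (i (proj₁ cr)) (j bκ)) bκ) (CA.goodR (goodR (proj₂ cr)) (j bκ))))

    -- A column with one fault puts the `nv` clean columns into one block, and then every occurring
    -- block has at least `nv` columns. Counting to eight leaves `nv = 2` with all three exchanged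
    -- columns present.
    module ByCol {a₀ b₀ : Fin k} (o : OneC a₀ b₀) (eaOK : ea ≡ ya ⊎ AnyBoxR ea) where
      dirtyRow′ : ∀ {a} → ¬ CleanR a → AnyBoxR a ⊎ a ≡ ya
      dirtyRow′ nc = [ inj₁ , [ inj₂ , (λ e → [ (λ f → inj₂ (trans e f)) , (λ bx → inj₁ (subst AnyBoxR (sym e) bx)) ]′ eaOK) ]′ ]′ (dirtyRow nc)

      5≤rows : 5 ≤ # cleanR?
      5≤rows = ℕ.+-cancelʳ-≤ 3 5 (# cleanR?) (ℕ.≤-trans 8≤k (most cleanR? anyBoxR? (ya ∷ []) (proj₁ fewBoxes)
        (λ a nc → [ inj₁ , (λ e → inj₂ (here e)) ]′ (dirtyRow′ nc))))

      abstract
        cr : ∃ CleanR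
        cr = #-pick cleanR? (ℕ.≤-trans (s≤s z≤n) 5≤rows)
      a₁ : Fin k
      a₁ = proj₁ cr

      nv : ℕ
      nv = # cleanC?

      ats : List (Fin k)
      ats = add (at? 0F) (add (at? 1F) (add (at? 2F) (eb ∷ [])))

      dirtyCol : ∀ b → ¬ CleanC b → AnyBox b ⊎ ((∃[ m′ ] At m′ b) ⊎ b ≡ eb)
      dirtyCol b nc = decide (anyBox? b) inj₁ (λ nb → decide (b ≟ eb) (λ e → inj₂ (inj₂ e)) (λ ne → decide (F.any? (λ a → W? a b)) (λ (_ , w) → inj₂ (inj₁ (W-col w)))
        (λ nw → ⊥-elim (nc (λ a → [ (λ w → nw (a , w)) , [ (λ e → ne (proj₂ (E-uniq e eE))) , (λ bx → nb (a , bx)) ]′ ]′)))))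

      ats-cover : ∀ b → (∃[ m′ ] At m′ b) ⊎ b ≡ eb → b ∈ ats
      ats-cover b (inj₁ (0F , q)) = add-here (at? 0F) (at-uniq 0F) q
      ats-cover b (inj₁ (1F , q)) = add-there (at? 0F) (add-here (at? 1F) (at-uniq 1F) q)
      ats-cover b (inj₁ (2F , q)) = add-there (at? 0F) (add-there (at? 1F) (add-here (at? 2F) (at-uniq 2F) q))
      ats-cover b (inj₂ e) = add-there (at? 0F) (add-there (at? 1F) (add-there (at? 2F) (here e)))

      cols : 8 ≤ nv + (2 + length ats)
      cols = ℕ.≤-trans 8≤k (most cleanC? anyBox? ats (proj₂ fewBoxes) (λ b nc → [ inj₁ , (λ p → inj₂ (ats-cover b p)) ]′ (dirtyCol b nc)))

      add≤ : {P : Fin k → Set} (d : Dec (∃ P)) (xs : List (Fin k)) → length (add d xs) ≤ suc (length xs)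
      add≤ (yes _) xs = ℕ.≤-refl
      add≤ (no _) xs = ℕ.n≤1+n _

      add-no : {P : Fin k → Set} (d : Dec (∃ P)) (xs : List (Fin k)) → ¬ ∃ P → length (add d xs) ≤ length xs
      add-no (yes p) xs np = ⊥-elim (np p)
      add-no (no _) xs _ = ℕ.≤-refl

      -- At most six columns are not clean: two of boxes, three exchanged, one raised.
      2≤nv : 2 ≤ nv
      2≤nv = ℕ.+-cancelʳ-≤ 6 2 nv (ℕ.≤-trans cols (ℕ.+-monoʳ-≤ nv (s≤s (s≤s (ℕ.≤-trans (add≤ (at? 0F) _) (s≤s (ℕ.≤-trans (add≤ (at? 1F) _) (s≤s (add≤ (at? 2F) _)))))))))

      abstract
        cg : ∃ CleanC
        cg = #-pick cleanC? (ℕ.≤-trans (s≤s z≤n) 2≤nv)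
      g : Fin k
      g = proj₁ cg
      v : Fin n
      v = j g

      nv≤Nf : ∀ a → nv ≤ HA.Nf (i a)
      nv≤Nf a = ℕ.≤-trans (#-mono cleanC? (λ b → cl (m a b) ≟ A (i a) v) (λ b c′ → trans (sym (clean (c′ a))) (cong (A (i a)) (sameC o c′ (proj₂ cg)))))
        (ℕ.≤-reflexive (trans (HA.row# (λ t → cl t ≟ A (i a) v) a) (CA.goodC (goodC (proj₂ cg)) (i a))))

      nv≤Ng : ∀ b → nv ≤ HA.Ng (j b)
      nv≤Ng b = subst (nv ≤_) (trans (cong HA.Nf (proj₂ row′)) Nf≡) (nv≤Nf (proj₁ row′))
        where
        u : ∃[ u ] A u v ≡ A (i a₁) (j b)
        u = AC.colS v (A (i a₁) (j b))
        Nf≡ : HA.Nf (proj₁ u) ≡ HA.Ng (j b)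
        Nf≡ = trans (sym (CA.goodC (goodC (proj₂ cg)) (proj₁ u))) (trans (cong HA.Nh (proj₂ u)) (CA.goodR (goodR (proj₂ cr)) (j b)))
        abstract
          row′ : ∃[ a ] i a ≡ proj₁ u
          row′ = #-pick (λ a → i a ≟ proj₁ u) (subst (1 ≤_) (sym Nf≡) (1≤# (λ b′ → j b′ ≟ j b) b refl))

      -- With three clean columns each exchanged block must contain the raised column, by `over₂`,
      -- so only one column is exchanged. Then at least 8 - 4 columns are clean, more than `over₃`
      -- admits.
      nv≤2 : nv ≤ 2
      nv≤2 = decide (3 ≤? nv) (λ three → ⊥-elim (ℕ.<⇒≱ (ℕ.≤-trans (four three) (nv≤Ng bκ)) (over₃ wκ))) (λ ≰ → s≤s⁻¹ (ℕ.≰⇒> ≰))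
        where
        only : 3 ≤ nv → ∀ {b} → W ya b → b ≡ bκ
        only three {b} w = W-block w wκ (trans (sym (shared w)) (shared wκ))
          where
          shared : ∀ {b} → W ya b → j eb ≡ j b
          shared {b} w = stable (j eb ≟ j b) (λ ne → ℕ.<⇒≱ (ℕ.≤-trans three (nv≤Ng b)) (over₂ w ne))
        four : 3 ≤ nv → 4 ≤ nv
        four three = ℕ.+-cancelʳ-≤ 4 4 nv (ℕ.≤-trans 8≤k (most cleanC? anyBox? (bκ ∷ eb ∷ []) (proj₂ fewBoxes)
          (λ b nc → [ inj₁ , [ (λ (_ , q) → inj₂ (here (only three (wAt q)))) , (λ e → inj₂ (there (here e))) ]′ ]′ (dirtyCol b nc))))

      abstract
        present : ∀ m′ → ∃ (At m′)
        present m′ = stable (at? m′) (λ none → ℕ.1+n≰n (ℕ.≤-trans cols (ℕ.+-mono-≤ nv≤2 (s≤s (s≤s (short m′ none))))))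
          where
          short : ∀ m′ → ¬ ∃ (At m′) → length ats ≤ 3
          short 0F none = ℕ.≤-trans (add-no (at? 0F) _ none) (ℕ.≤-trans (add≤ (at? 1F) _) (s≤s (add≤ (at? 2F) _)))
          short 1F none = ℕ.≤-trans (add≤ (at? 0F) _) (s≤s (ℕ.≤-trans (add-no (at? 1F) _ none) (add≤ (at? 2F) _)))
          short 2F none = ℕ.≤-trans (add≤ (at? 0F) _) (s≤s (ℕ.≤-trans (add≤ (at? 1F) _) (s≤s (add-no (at? 2F) _ none))))

      pw : ∀ m′ → W ya (proj₁ (present m′))
      pw m′ = wAt (proj₂ (present m′))
      pj : ∀ m′ → j (proj₁ (present m′)) ≡ J m′
      pj m′ = cong proj₁ (proj₂ (present m′))

      Extra : Fin k → Set
      Extra b = b ≡ eb ⊎ AnyBox b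
      extra? : Decidable Extra
      extra? b = (b ≟ eb) ⊎-dec anyBox? b

      abstract
        ext : ∀ m′ → ∃[ b ] (j b ≡ J m′ × Extra b)
        ext m′ = let (b , e , ni) = #-fresh (λ b → j b ≟ j (proj₁ (present m′))) (proj₁ (present m′) ∷ []) (ℕ.≤-trans 2≤nv (nv≤Ng (proj₁ (present m′))))
                 in b , trans e (pj m′) , [ (λ f → ⊥-elim (ni (here f))) , id ]′ (overKind (pw m′) e)

        fewExtra : # extra? ≤ 3
        fewExtra = ℕ.≤-trans (#-union (λ b → b ≟ eb) anyBox? extra? (λ _ → id)) (ℕ.+-mono-≤ (≡⇒≤1 (λ b → b ≟ eb) (λ _ _ p q → trans p (sym q))) (proj₂ fewBoxes))

        -- Each of the three exchanged blocks needs a second column, raised or of a box. At most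
        -- three such columns exist, so none is left for another block.
        extraBlock : ∀ b → Extra b → ∃[ m′ ] j b ≡ J m′
        extraBlock b eb′ = stable (F.any? (λ m′ → j b ≟ J m′)) (λ none → ℕ.<⇒≱ (#-list extra? (b ∷ proj₁ (ext 0F) ∷ proj₁ (ext 1F) ∷ proj₁ (ext 2F) ∷ [])
          ((λ { (here e) → none (0F , trans (cong j e) (proj₁ (proj₂ (ext 0F)))) ; (there (here e)) → none (1F , trans (cong j e) (proj₁ (proj₂ (ext 1F)))) ; (there (there (here e))) → none (2F , trans (cong j e) (proj₁ (proj₂ (ext 2F)))) }) ,
           (λ { (here e) → 0≢1 (diff e) ; (there (here e)) → 0≢2 (diff e) }) , (λ { (here e) → 1≢2 (diff e) }) , (λ ()) , tt)
          (λ { _ (here refl) → eb′ ; _ (there (here refl)) → proj₂ (proj₂ (ext 0F)) ; _ (there (there (here refl))) → proj₂ (proj₂ (ext 1F)) ; _ (there (there (there (here refl)))) → proj₂ (proj₂ (ext 2F)) })) fewExtra)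
          where
          diff : ∀ {m₁ m₂} → proj₁ (ext m₁) ≡ proj₁ (ext m₂) → m₁ ≡ m₂
          diff {m₁} {m₂} e = J-inj m₁ m₂ (trans (sym (proj₁ (proj₂ (ext m₁)))) (trans (cong j e) (proj₁ (proj₂ (ext m₂)))))
          0≢1 : _≢_ {A = Fin 3} 0F 1F
          0≢1 ()
          0≢2 : _≢_ {A = Fin 3} 0F 2F
          0≢2 ()
          1≢2 : _≢_ {A = Fin 3} 1F 2F
          1≢2 ()

      blocks : ∀ b → CleanC b ⊎ (∃[ m′ ] j b ≡ J m′)
      blocks b = decide (cleanC? b) inj₁ (λ nc → inj₂ ([ (λ bx → extraBlock b (inj₂ bx)) , [ (λ (m′ , q) → m′ , cong proj₁ q) , (λ e → extraBlock b (inj₁ e)) ]′ ]′ (dirtyCol b nc)))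

      v≢J : ∀ m′ → v ≢ J m′
      v≢J m′ e = apart (pw m′) (proj₂ cg) (trans e (sym (pj m′)))

      Nf≤2 : HA.Nf (i a₁) ≤ 2
      Nf≤2 = ℕ.≤-trans (ℕ.≤-reflexive (trans (sym (CA.goodC (goodC (proj₂ cg)) (i a₁))) (CA.goodR (goodR (proj₂ cr)) v)))
        (ℕ.≤-trans (#-mono (λ b → j b ≟ v) cleanC? (λ b e → [ id , (λ (m′ , f) → ⊥-elim (v≢J m′ (trans (sym e) f))) ]′ (blocks b))) nv≤2)

      abstract
        second : ∃[ a ] (CleanR a × i a ≢ i a₁)
        second = decide (F.any? (λ a → cleanR? a ×-dec ¬? (i a ≟ i a₁))) id (λ none → ⊥-elim (ℕ.<⇒≱ (ℕ.≤-trans (s≤s (s≤s (s≤s z≤n))) 5≤rows)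
          (ℕ.≤-trans (#-mono cleanR? (λ a → i a ≟ i a₁) (λ a c′ → stable (i a ≟ i a₁) (λ ne → none (a , c′ , ne)))) Nf≤2)))

      toG : ∀ b → ∃[ e ] j b ≡ G v e
      toG b = [ (λ c′ → zero , sameC o c′ (proj₂ cg)) , (λ (m′ , e) → suc m′ , e) ]′ (blocks b)

      fromG : ∀ e → ∃[ b ] j b ≡ G v e
      fromG zero = g , refl
      fromG (suc m′) = proj₁ (present m′) , pj m′

      -- All columns lie over `v` and the `J m′`. Five clean rows with labels of multiplicity at
      -- most two include two different labels, and their rows contain the same symbols, against
      -- `fourCols`.
      absurd : ⊥
      absurd = go (proj₁ second) (proj₁ (proj₂ second)) (proj₂ (proj₂ second))
        where
        go : ∀ a → CleanR a → i a ≢ i a₁ → ⊥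
        go a c′ ne = let (e , f) = fourCols v (i a) (i a₁) ne v≢J ; (b , p) = fromG e ; (b′ , q) = mC.rowS a₁ (m a b) ; (e′ , p′) = toG b′ in
          f e′ (trans (cong (A (i a)) (sym p)) (trans (clean (c′ b)) (trans (cong cl (sym q)) (trans (sym (clean (proj₂ cr b′))) (cong (A (i a₁)) p′)))))

    absurd : ⊥
    absurd = decide (ea ≟ ya)
      (λ e → ByCol.absurd {ya} {bκ} (inj₁ wκ , λ a ne → [ (λ w → ne (W-same w wκ)) , [ (λ f → ne (trans (proj₁ (E-uniq f eE)) e)) , (λ ((_ , q) , _) → W-y wκ q) ]′ ]′) (inj₁ e))
      (λ ne → decide (anyBoxR? ea)
        (λ bx → decide (F.any? (λ b → W? ya b ×-dec ¬? (b ≟ eb)))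
          (λ (b , w , nb) → ByCol.absurd {ya} {b} (inj₁ w , λ a na → [ (λ w′ → na (W-same w′ wκ)) , [ (λ f → nb (proj₂ (E-uniq f eE))) , (λ ((_ , q) , _) → W-y w q) ]′ ]′) (inj₂ bx))
          (λ none → let at = λ b w → stable (b ≟ eb) (λ nb → none (b , w , nb)) in
            byRow {ya} {bκ} (inj₁ wκ , λ b nb → [ (λ w → nb (trans (at b w) (sym (at bκ wκ)))) , [ (λ f → ne (sym (proj₁ (E-uniq f eE)))) , (λ ((p , _) , _) → xy≢0 p) ]′ ]′)))
        (λ nbx → byRow {ea} {eb} (inj₂ (inj₁ eE) , λ b nb → [ (λ w → ne (W-same w wκ)) , [ (λ f → nb (proj₂ (E-uniq f eE))) , (λ bx → nbx (b , bx)) ]′ ]′)))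

  raised : ⊥
  raised = decide (F.any? (λ a → F.any? (W? a)))
    (λ (a , b , w) → Switch.absurd w)
    (λ none → NoSwitch.absurd (λ a b w → none (a , b , w)))

-- Switching a row cycle

prv : Fin 3 → Fin 3
prv m = nxt (nxt m)

nxt-prv : ∀ m → nxt (prv m) ≡ m
nxt-prv 0F = refl
nxt-prv 1F = refl
nxt-prv 2F = refl

prv-nxt : ∀ m → prv (nxt m) ≡ m
prv-nxt 0F = refl
prv-nxt 1F = refl
prv-nxt 2F = refl

nxt-inj : ∀ m m′ → nxt m ≡ nxt m′ → m ≡ m′
nxt-inj m m′ e = trans (sym (prv-nxt m)) (trans (cong prv e) (prv-nxt m′))

-- old y and cur y index the symbols of row y in the switch columns of P₀ and of P.
old cur : Bool → Fin 3 → Fin 3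
old true m = m
old false m = nxt m
cur y = old (not y)

-- In the rows row y, P arises from P₀ by a cyclic shift of the switch columns.
shift : Bool → Fin 3 → Fin 3
shift true = nxt
shift false = prv

old-shift : ∀ y m → old y (shift y m) ≡ cur y m
old-shift true m = refl
old-shift false m = nxt-prv m

-- The exchanged column in which row `y` carries the symbol that the other row has in column `m`.
Back : Bool → Fin 3 → Fin 3
Back y m = shift (not y) m

cur-back : ∀ y m → cur y (Back y m) ≡ cur (not y) m
cur-back true m = nxt-prv m
cur-back false m = refl

cyc₂ : ∀ y m → cur y m ≢ cur (not y) (Back y m)
cyc₂ true 0F ()
cyc₂ true 1F ()
cyc₂ true 2F ()
cyc₂ false 0F ()
cyc₂ false 1F ()
cyc₂ false 2F ()
cyc₃ : ∀ y m → cur (not y) (Back y (Back y m)) ≡ cur y m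
cyc₃ true 0F = refl
cyc₃ true 1F = refl
cyc₃ true 2F = refl
cyc₃ false 0F = refl
cyc₃ false 1F = refl
cyc₃ false 2F = refl
cyc : ∀ y m → Back y (Back y (Back y m)) ≡ m
cyc true 0F = refl
cyc true 1F = refl
cyc true 2F = refl
cyc false 0F = refl
cyc false 1F = refl
cyc false 2F = refl

orbit : ∀ y m₀ m′ → m′ ≡ m₀ ⊎ (m′ ≡ Back y m₀ ⊎ m′ ≡ Back y (Back y m₀))
orbit true 0F 0F = inj₁ refl
orbit true 0F 1F = inj₂ (inj₂ refl)
orbit true 0F 2F = inj₂ (inj₁ refl)
orbit true 1F 0F = inj₂ (inj₁ refl)
orbit true 1F 1F = inj₁ refl
orbit true 1F 2F = inj₂ (inj₂ refl)
orbit true 2F 0F = inj₂ (inj₂ refl)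
orbit true 2F 1F = inj₂ (inj₁ refl)
orbit true 2F 2F = inj₁ refl
orbit false 0F 0F = inj₁ refl
orbit false 0F 1F = inj₂ (inj₁ refl)
orbit false 0F 2F = inj₂ (inj₂ refl)
orbit false 1F 0F = inj₂ (inj₂ refl)
orbit false 1F 1F = inj₁ refl
orbit false 1F 2F = inj₂ (inj₁ refl)
orbit false 2F 0F = inj₂ (inj₁ refl)
orbit false 2F 1F = inj₂ (inj₂ refl)
orbit false 2F 2F = inj₁ refl

module Square (D : Design) (Λ : Lat D) where
  open Base D Λ

  Z-inj : ∀ m m′ → Z m ≡ Z m′ → m ≡ m′
  Z-inj m m′ e = trans (sym (nxt-prv m)) (trans (cong nxt (K-inj (prv m) (prv m′) (LC.row (R false)
    (trans (L₂ (prv m)) (trans (cong Z (nxt-prv m)) (trans e (sym (trans (L₂ (prv m′)) (cong Z (nxt-prv m′)))))))))) (nxt-prv m′))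

  up-moves : ∀ (c : Fin n) → up c ≢ c
  up-moves = +ₛ-moves 1 (s≤s z≤n) (s≤s⁻¹ (ℕ.≤-trans (s≤s (s≤s z≤n)) 8≤n))

  row-≢ : ∀ y → row (not y) ≢ row y
  row-≢ true e = R≢ (sym (cong proj₂ e))
  row-≢ false e = R≢ (cong proj₂ e)

  col-inj : ∀ m m′ → col m ≡ col m′ → m ≡ m′
  col-inj m m′ e = J-inj m m′ (cong proj₁ e)

  -- Here the near row cycle closes: its first column lies over `J 0F ≡ zero`, so in row `true` the
  -- shifted block turns σ into σ + s, the symbol at which the cycle in L breaks off. The labels in
  -- A run through a genuine row cycle of length 3.
  P₀-sw : ∀ y m → P₀ (row y) (col m) ≡ sy (old y m)
  P₀-sw true m = cong₂ _,_ (Az-off (λ (p , _) → R≢0 true p)) (lz m)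
    where
    off : ∀ {m} → m ≢ 0F → Lz (row true) (col m) ≡ L (R true) (K m)
    off ne = Lz-off (λ (_ , q) → ne (J-inj _ _ (trans q (sym J₀))))
    lz : ∀ m → Lz (row true) (col m) ≡ Z m
    lz 0F = trans (Lz-on refl J₀) (sym Z₀)
    lz 1F = trans (off (λ ())) (sym Z₁)
    lz 2F = trans (off (λ ())) (sym Z₂)
  P₀-sw false m = cong₂ _,_ (trans (Az-off (λ (p , _) → R≢0 false p)) (A₂ m)) (trans (Lz-off (λ (p , _) → i₂≢0 p)) (L₂ m))

  Az-row : ∀ {i x j j′ y} → Az (i , x) (j , y) ≡ Az (i , x) (j′ , y) → j ≡ j′
  Az-row {i} {x} {j} {j′} {y} e = decide ((x ≟ zero) ×-dec (y ≟ zero))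
    (λ (p , q) → Cancel.row BC i (trans (sym (Az-on p q)) (trans e (Az-on p q))))
    (λ ne → AC.row i (trans (sym (Az-off ne)) (trans e (Az-off ne))))

  Az-col : ∀ {i i′ x j y} → Az (i , x) (j , y) ≡ Az (i′ , x) (j , y) → i ≡ i′
  Az-col {i} {i′} {x} {j} {y} e = decide ((x ≟ zero) ×-dec (y ≟ zero))
    (λ (p , q) → Cancel.col BC j (trans (sym (Az-on p q)) (trans e (Az-on p q))))
    (λ ne → AC.col j (trans (sym (Az-off ne)) (trans e (Az-off ne))))

  -- In block row zero the class `A zero zero` marks block column zero, by `AB₀`; hence equal
  -- symbols of a row are both shifted or both unshifted.
  P₀-row : ∀ ρ κ κ′ → P₀ ρ κ ≡ P₀ ρ κ′ → κ ≡ κ′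
  P₀-row (i , x) (j , y) (j′ , y′) e = same-y (LC.row x (decide ((i ≟ zero) ×-dec (j ≟ zero))
      (λ (p , q) → σ-inj _ _ (trans (sym (Lz-on p q)) (trans (cong proj₂ e) (Lz-on p (corner p q (cong proj₁ e))))))
      (λ ne → trans (sym (Lz-off ne)) (trans (cong proj₂ e) (Lz-off (λ (p , q) → ne (p , corner p q (sym (cong proj₁ e)))))))))
    where
    corner : ∀ {j j′ y y′} → i ≡ zero → j ≡ zero → Az (i , x) (j , y) ≡ Az (i , x) (j′ , y′) → j′ ≡ zero
    corner {j} {j′} {y} {y′} p q f = Az-row {i} {x} {j′} {zero} {y′} (trans (sym f) (trans (Az-00 p q) (trans (cong (A i) q) (sym (Az-00 {y = y′} p refl)))))
    same-y : y ≡ y′ → (j , y) ≡ (j′ , y′)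
    same-y refl = cong (_, y) (Az-row (cong proj₁ e))

  P₀-col : ∀ κ ρ ρ′ → P₀ ρ κ ≡ P₀ ρ′ κ → ρ ≡ ρ′
  P₀-col (j , y) (i , x) (i′ , x′) e = same-x (LC.col y (decide ((i ≟ zero) ×-dec (j ≟ zero))
      (λ (p , q) → σ-inj _ _ (trans (sym (Lz-on p q)) (trans (cong proj₂ e) (Lz-on (corner p q (cong proj₁ e)) q))))
      (λ ne → trans (sym (Lz-off ne)) (trans (cong proj₂ e) (Lz-off (λ (p , q) → ne (corner p q (sym (cong proj₁ e)) , q)))))))
    where
    corner : ∀ {i i′ x x′} → i ≡ zero → j ≡ zero → Az (i , x) (j , y) ≡ Az (i′ , x′) (j , y) → i′ ≡ zero
    corner {i} {i′} {x} {x′} p q f = Az-col {i′} {zero} {x′} {j} {y} (trans (sym f) (trans (Az-00 p q) (trans (cong (λ u → A u j) p) (sym (Az-00 {x = x′} refl q)))))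
    same-x : x ≡ x′ → (i , x) ≡ (i′ , x′)
    same-x refl = cong (_, x) (Az-col (cong proj₁ e))

  swap : Pos → Pos
  swap ρ = if₂ (ρ ≟× row true) (row false) (if₂ (ρ ≟× row false) (row true) ρ)

  swap-row : ∀ y → swap (row y) ≡ row (not y)
  swap-row true = if-yes (row true ≟× row true) refl
  swap-row false = trans (if-no (row false ≟× row true) (row-≢ true)) (if-yes (row false ≟× row false) refl)

  swap-off : ∀ ρ → (∀ y → ρ ≢ row y) → swap ρ ≡ ρ
  swap-off ρ ne = trans (if-no (ρ ≟× row true) (ne true)) (if-no (ρ ≟× row false) (ne false))

  rowKind : ∀ ρ → (∃[ y ] ρ ≡ row y) ⊎ (∀ y → ρ ≢ row y)
  rowKind ρ = decide (ρ ≟× row true) (λ e → inj₁ (true , e)) (λ ne → decide (ρ ≟× row false) (λ e → inj₁ (false , e)) (λ ne′ → inj₂ (λ { true → ne ; false → ne′ })))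

  not-not : ∀ y → not (not y) ≡ y
  not-not true = refl
  not-not false = refl

  swap-swap : ∀ ρ → swap (swap ρ) ≡ ρ
  swap-swap ρ = [ (λ (y , e) → trans (cong (swap ∘ swap) e) (trans (cong swap (swap-row y)) (trans (swap-row (not y)) (trans (cong row (not-not y)) (sym e))))) ,
    (λ ne → trans (cong swap (swap-off ρ ne)) (swap-off ρ ne)) ]′ (rowKind ρ)

  swap-inj : ∀ ρ ρ′ → swap ρ ≡ swap ρ′ → ρ ≡ ρ′
  swap-inj ρ ρ′ e = trans (sym (swap-swap ρ)) (trans (cong swap e) (swap-swap ρ′))

  Switch : Pos → Set
  Switch κ = ∃[ m ] κ ≡ col m
  switch? : ∀ κ → Dec (Switch κ)
  switch? κ = F.any? (λ m → κ ≟× col m)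

  -- P₀ with the entries of the rows row true and row false exchanged in the columns col 0F, col 1F, col 2F.
  P : Pos → Pos → Pos
  P ρ κ = if₂ (switch? κ) (P₀ (swap ρ) κ) (P₀ ρ κ)

  Switched : Pos → Pos → Set
  Switched ρ κ = (∃[ y ] ρ ≡ row y) × Switch κ

  P-sw : ∀ y m → P (row y) (col m) ≡ sy (cur y m)
  P-sw y m = trans (if-yes (switch? (col m)) (m , refl)) (trans (cong (λ ρ → P₀ ρ (col m)) (swap-row y)) (P₀-sw (not y) m))

  P-off : ∀ ρ κ → ¬ Switched ρ κ → P ρ κ ≡ P₀ ρ κ
  P-off ρ κ ns = decide (switch? κ)
    (λ s → trans (if-yes (switch? κ) s) (cong (λ ρ → P₀ ρ κ) ([ (λ r → ⊥-elim (ns (r , s))) , swap-off ρ ]′ (rowKind ρ))))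
    (λ ns′ → if-no (switch? κ) ns′)

  P-col : ∀ κ ρ ρ′ → P ρ κ ≡ P ρ′ κ → ρ ≡ ρ′
  P-col κ ρ ρ′ e = decide (switch? κ)
    (λ s → swap-inj ρ ρ′ (P₀-col κ _ _ (trans (sym (if-yes (switch? κ) s)) (trans e (if-yes (switch? κ) s)))))
    (λ ns → P₀-col κ ρ ρ′ (trans (sym (if-no (switch? κ) ns)) (trans e (if-no (switch? κ) ns))))

  -- The two exchanged rows carry the same three symbols in the exchanged columns, so within one row
  -- the exchange only permutes columns, by `shift y`.
  P-row : ∀ ρ κ κ′ → P ρ κ ≡ P ρ κ′ → κ ≡ κ′
  P-row ρ κ κ′ e = [ onRow , (λ ne → P₀-row ρ κ κ′ (trans (sym (P-off ρ κ (λ ((y , q) , _) → ne y q))) (trans e (P-off ρ κ′ (λ ((y , q) , _) → ne y q))))) ]′ (rowKind ρ)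
    where
    onRow : ∃[ y ] ρ ≡ row y → κ ≡ κ′
    onRow (y , refl) = decide (switch? κ)
      (λ (m , q) → decide (switch? κ′)
        (λ (m′ , q′) → trans q (trans (cong col (shift-inj m m′ (col-inj _ _ (P₀-row (row y) _ _ (trans (sym (at m q)) (trans e (at m′ q′))))))) (sym q′)))
        (λ ns → ⊥-elim (ns (shift y m , P₀-row (row y) κ′ (col (shift y m)) (trans (sym (off ns)) (trans (sym e) (at m q)))))))
      (λ ns → decide (switch? κ′)
        (λ (m′ , q′) → ⊥-elim (ns (shift y m′ , P₀-row (row y) κ (col (shift y m′)) (trans (sym (off ns)) (trans e (at m′ q′))))))
        (λ ns′ → P₀-row (row y) κ κ′ (trans (sym (off ns)) (trans e (off ns′)))))
      where
      at : ∀ {κ} m → κ ≡ col m → P (row y) κ ≡ P₀ (row y) (col (shift y m))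
      at m refl = trans (P-sw y m) (sym (trans (P₀-sw y (shift y m)) (cong sy (old-shift y m))))
      off : ∀ {κ} → ¬ Switch κ → P (row y) κ ≡ P₀ (row y) κ
      off ns = P-off (row y) _ (λ (_ , s) → ns s)
      shift-inj : ∀ m m′ → shift y m ≡ shift y m′ → m ≡ m′
      shift-inj m m′ e = by y e
        where
        by : ∀ y → shift y m ≡ shift y m′ → m ≡ m′
        by true e = nxt-inj m m′ e
        by false e = nxt-inj m m′ (nxt-inj _ _ e)

  -- A subarray of P in which the class of the cell E, if any, is raised by one.
  record PSub : Set₁ where
    field
      Σ₀ : Sub
    open Sub Σ₀
    field
      E : Fin k → Fin k → Set
      E? : ∀ a b → Dec (E a b)
      E-uniq : ∀ {a b a′ b′} → E a b → E a′ b′ → a ≡ a′ × b ≡ b′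
      zV : ∀ a b → proj₂ (h (m a b)) ≡ proj₂ (P (r a) (c b))
      clV : ∀ a b → ¬ E a b → proj₁ (h (m a b)) ≡ proj₁ (P (r a) (c b))
      clVE : ∀ a b → E a b → proj₁ (h (m a b)) ≡ up (proj₁ (P (r a) (c b)))

  module Reduce (T : PSub) where
    open PSub T
    open Sub Σ₀
    module mC = Cancel mC

    hV : ∀ {a b} → ¬ E a b → h (m a b) ≡ P (r a) (c b)
    hV ne = cong₂ _,_ (clV _ _ ne) (zV _ _)

    module Both (ar : Bool → Fin k) (arR : ∀ y → r (ar y) ≡ row y) where
      ar-≢ : ∀ y → ar (not y) ≢ ar y
      ar-≢ y e = row-≢ y (trans (sym (arR (not y))) (trans (cong r e) (arR y)))

      swV : ∀ {y b m′} → c b ≡ col m′ → ¬ E (ar y) b → h (m (ar y) b) ≡ sy (cur y m′)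
      swV {y} {b} {m′} q ne = trans (hV ne) (trans (cong₂ P (arR y) q) (P-sw y m′))

      abstract
        -- Each row of S contains every symbol of S, so the exchanged symbol of one row forces the
        -- column where the other row has it into S, unless the raised cell supplies the symbol.
        step : ∀ y {b m′} → c b ≡ col m′ → ¬ E (ar (not y)) b → ∃[ b′ ] (m (ar y) b′ ≡ m (ar (not y)) b × (E (ar y) b′ ⊎ c b′ ≡ col (Back y m′)))
        step y {b} {m′} q ne = let (b′ , e) = mC.rowS (ar y) (m (ar (not y)) b) in b′ , e , decide (E? (ar y) b′) inj₁
          (λ ne′ → inj₂ (P-row (row y) _ _ (trans (cong (λ ρ → P ρ (c b′)) (sym (arR y))) (trans (sym (hV ne′)) (trans (cong h e)
            (trans (swV q ne) (trans (cong sy (sym (cur-back y m′))) (sym (P-sw y (Back y m′))))))))))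

      -- A raised switch cell destroys a symbol that the other switched row forces back in.
      raisedSwitch : ∀ {ea eb} → E ea eb → ∀ y m′ → r ea ≡ row y → c eb ≡ col m′ → ⊥
      raisedSwitch {ea} {eb} eE y m′ p q = go₁ (step y q calm)
        where
        ea≡ : ea ≡ ar y
        ea≡ = r-inj _ _ (trans p (sym (arR y)))
        calm : ∀ {b} → ¬ E (ar (not y)) b
        calm e = ar-≢ y (trans (proj₁ (E-uniq e eE)) ea≡)
        here′ : ∀ {b} → E (ar y) b → b ≡ eb
        here′ e = proj₂ (E-uniq e eE)
        Next : ∀ {b} → Fin 3 → Set
        Next {b} m″ = ∃[ b′ ] (m (ar y) b′ ≡ m (ar (not y)) b × (E (ar y) b′ ⊎ c b′ ≡ col (Back y m″)))
        zE : proj₂ (h (m (ar y) eb)) ≡ Z (cur y m′)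
        zE = trans (zV _ _) (cong proj₂ (trans (cong₂ P (arR y) q) (P-sw y m′)))
        clE : proj₁ (h (m (ar y) eb)) ≡ up (S (cur y m′))
        clE = trans (clVE _ _ (subst (λ a → E a eb) ea≡ eE)) (cong (up ∘ proj₁) (trans (cong₂ P (arR y) q) (P-sw y m′)))
        last : ∀ {b₂ b₃} → c b₂ ≡ col (Back y (Back y m′)) → m (ar y) b₃ ≡ m (ar (not y)) b₂ → b₃ ≡ eb → ⊥
        last q₂ e refl = up-moves _ (trans (sym clE) (trans (cong (proj₁ ∘ h) e) (cong proj₁ (trans (swV q₂ calm) (cong sy (cyc₃ y m′))))))
        go₃ : ∀ {b₂} → c b₂ ≡ col (Back y (Back y m′)) → Next {b₂} (Back y (Back y m′)) → ⊥
        go₃ q₂ (b₃ , e , alt) = last q₂ e ([ here′ , (λ q₃ → c-inj _ _ (trans q₃ (trans (cong col (cyc y m′)) (sym q)))) ]′ alt)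
        go₂ : ∀ {b₁} → c b₁ ≡ col (Back y m′) → Next {b₁} (Back y m′) → ⊥
        go₂ q₁ (b₂ , e , inj₁ f₁) = cyc₂ y m′ (Z-inj _ _ (trans (sym zE) (trans (cong (λ b → proj₂ (h (m (ar y) b))) (sym (here′ f₁))) (trans (cong (proj₂ ∘ h) e) (cong proj₂ (swV q₁ calm))))))
        go₂ q₁ (b₂ , e , inj₂ q₂) = go₃ q₂ (step y q₂ calm)
        go₁ : Next {eb} m′ → ⊥
        go₁ (b₁ , e , inj₁ f₁) = ar-≢ y (mC.col eb (sym (trans (cong (m (ar y)) (sym (here′ f₁))) e)))
        go₁ (b₁ , e , inj₂ q₁) = go₂ q₁ (step y q₁ calm)

      module Closed (noE : ∀ y {b} → Switch (c b) → ¬ E (ar y) b) {b₀ : Fin k} (s₀ : Switch (c b₀)) where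
        abstract
          -- The raised cell lies in at most one of the two rows; in the other one, repeated use of
          -- `Back` visits all three columns.
          allCols : ∀ m′ → ∃[ b ] c b ≡ col m′
          allCols m′ = decide (F.any? (E? (ar true)))
            (λ (_ , e) → from false (λ e′ → ar-≢ true (proj₁ (E-uniq e′ e))))
            (λ none → from true (λ e → none (_ , e)))
            where
            from : ∀ y → (∀ {b} → ¬ E (ar y) b) → ∃[ b ] c b ≡ col m′
            from y calm = pick (orbit y (proj₁ s₀) m′)
              where
              move : ∀ {m″} → ∃[ b ] c b ≡ col m″ → ∃[ b ] c b ≡ col (Back y m″)
              move (b , q) = let (b′ , _ , alt) = step y q (noE (not y) (_ , q)) in b′ , [ (λ e → ⊥-elim (calm e)) , id ]′ alt
              first : ∃[ b ] c b ≡ col (proj₁ s₀)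
              first = b₀ , proj₂ s₀
              pick : m′ ≡ proj₁ s₀ ⊎ (m′ ≡ Back y (proj₁ s₀) ⊎ m′ ≡ Back y (Back y (proj₁ s₀))) → ∃[ b ] c b ≡ col m′
              pick (inj₁ e) = subst (λ m″ → ∃[ b ] c b ≡ col m″) (sym e) first
              pick (inj₂ (inj₁ e)) = subst (λ m″ → ∃[ b ] c b ≡ col m″) (sym e) (move first)
              pick (inj₂ (inj₂ e)) = subst (λ m″ → ∃[ b ] c b ≡ col m″) (sym e) (move (move first))

        mate : Fin k → Fin k
        mate a = if₂ (a ≟ ar true) (ar false) (if₂ (a ≟ ar false) (ar true) a)

        mate-ar : ∀ y → mate (ar y) ≡ ar (not y)
        mate-ar true = if-yes (ar true ≟ ar true) refl
        mate-ar false = trans (if-no (ar false ≟ ar true) (ar-≢ true)) (if-yes (ar false ≟ ar false) refl)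

        mate-off : ∀ {a} → (∀ y → a ≢ ar y) → mate a ≡ a
        mate-off {a} ne = trans (if-no (a ≟ ar true) (ne true)) (if-no (a ≟ ar false) (ne false))

        kind : ∀ a → (∃[ y ] a ≡ ar y) ⊎ (∀ y → a ≢ ar y)
        kind a = decide (a ≟ ar true) (λ e → inj₁ (true , e)) (λ ne → decide (a ≟ ar false) (λ e → inj₁ (false , e)) (λ ne′ → inj₂ (λ { true → ne ; false → ne′ })))

        mate-mate : ∀ a → mate (mate a) ≡ a
        mate-mate a = [ (λ (y , e) → trans (cong (mate ∘ mate) e) (trans (cong mate (mate-ar y)) (trans (mate-ar (not y)) (trans (cong ar (not-not y)) (sym e))))) ,
          (λ ne → trans (cong mate (mate-off ne)) (mate-off ne)) ]′ (kind a)

        -- The exchange undone inside S. It remains Latin because, by `partner`, both rows have the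
        -- same symbols in the exchanged columns.
        m′ : Matrix k
        m′ a b = if₂ (switch? (c b)) (m (mate a) b) (m a b)

        m′-on : ∀ {a b} → Switch (c b) → m′ a b ≡ m (mate a) b
        m′-on {a} {b} s = if-yes (switch? (c b)) s
        m′-off : ∀ {a b} → ¬ Switch (c b) → m′ a b ≡ m a b
        m′-off {a} {b} ns = if-no (switch? (c b)) ns
        m′-fix : ∀ {a b} → (∀ y → a ≢ ar y) → m′ a b ≡ m a b
        m′-fix {a} {b} ne = decide (switch? (c b)) (λ s → trans (m′-on s) (cong (λ u → m u b) (mate-off ne))) m′-off

        partner : ∀ y {b} → Switch (c b) → ∃[ b′ ] (Switch (c b′) × m (ar (not y)) b ≡ m (ar y) b′)
        partner y {b} (m″ , q) = let (b′ , q′) = allCols (Back y m″) in b′ , (Back y m″ , q′) ,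
          h-inj _ _ (trans (swV q (noE (not y) (m″ , q))) (trans (cong sy (sym (cur-back y m″))) (sym (swV q′ (noE y (Back y m″ , q′))))))

        mC′ : Cancel m′
        mC′ = record { row = rowC ; col = colC }
          where
          colC : ∀ b {a a′} → m′ a b ≡ m′ a′ b → a ≡ a′
          colC b {a} {a′} e = decide (switch? (c b))
            (λ s → trans (sym (mate-mate a)) (trans (cong mate (mC.col b (trans (sym (m′-on s)) (trans e (m′-on s))))) (mate-mate a′)))
            (λ ns → mC.col b (trans (sym (m′-off ns)) (trans e (m′-off ns))))
          mixed : ∀ y {b b′} → Switch (c b) → ¬ Switch (c b′) → m′ (ar y) b ≢ m′ (ar y) b′
          mixed y {b} s ns e = let (b″ , s″ , f′) = partner y s in ns (subst (Switch ∘ c) (mC.row (ar y)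
            (trans (sym f′) (trans (cong (λ u → m u b) (sym (mate-ar y))) (trans (sym (m′-on s)) (trans e (m′-off ns)))))) s″)
          rowC : ∀ a {b b′} → m′ a b ≡ m′ a b′ → b ≡ b′
          rowC a {b} {b′} e = [ (λ (y , q) → onRow y (subst (λ a → m′ a b ≡ m′ a b′) q e)) , (λ ne → mC.row a (trans (sym (m′-fix ne)) (trans e (m′-fix ne)))) ]′ (kind a)
            where
            onRow : ∀ y → m′ (ar y) b ≡ m′ (ar y) b′ → b ≡ b′
            onRow y e = decide (switch? (c b))
              (λ s → decide (switch? (c b′)) (λ s′ → mC.row (mate (ar y)) (trans (sym (m′-on s)) (trans e (m′-on s′)))) (λ ns → ⊥-elim (mixed y s ns e)))
              (λ ns → decide (switch? (c b′)) (λ s′ → ⊥-elim (mixed y s′ ns (sym e))) (λ ns′ → mC.row (ar y) (trans (sym (m′-off ns)) (trans e (m′-off ns′)))))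

        onSw : ∀ y {b} → Switch (c b) → h (m′ (ar y) b) ≡ P₀ (r (ar y)) (c b)
        onSw y {b} s@(m″ , q) = trans (cong h (trans (m′-on s) (cong (λ u → m u b) (mate-ar y)))) (trans (swV q (noE (not y) s))
          (trans (cong (λ y → sy (old y m″)) (not-not y)) (sym (trans (cong₂ P₀ (arR y) q) (P₀-sw y m″)))))

        value : ∀ a b → (∃[ y ] a ≡ ar y × Switch (c b)) ⊎ (m′ a b ≡ m a b × P (r a) (c b) ≡ P₀ (r a) (c b))
        value a b = [ (λ (y , e) → decide (switch? (c b)) (λ s → inj₁ (y , e , s)) (λ ns → inj₂ (m′-off ns , P-off _ _ (λ (_ , s) → ns s)))) ,
          (λ ne → inj₂ (m′-fix ne , P-off _ _ (λ ((y , q) , _) → ne y (r-inj _ _ (trans q (sym (arR y))))))) ]′ (kind a)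

    record Flat : Set where
      field
        m₀ : Matrix k
        m₀C : Cancel m₀
        zF : ∀ a b → proj₂ (h (m₀ a b)) ≡ Lz (r a) (c b)
        clF : ∀ a b → ¬ E a b → proj₁ (h (m₀ a b)) ≡ Az (r a) (c b)
        clFE : ∀ a b → E a b → proj₁ (h (m₀ a b)) ≡ up (Az (r a) (c b))
        noBlock : (∃[ a ] r a ≡ row true) → (∃[ b ] c b ≡ col 0F) → ∃[ a ] r a ≡ row false

    record Part : Set where
      field
        yb : Bool
        ya bκ : Fin k
        rya : r ya ≡ row yb
        sκ : Switch (c bκ)
        alone : ∀ a → r a ≢ row (not yb)

    flat₁ : (∀ a b → ¬ Switched (r a) (c b)) → Flat
    flat₁ ns = record { m₀ = m ; m₀C = mC
      ; zF = λ a b → trans (zV a b) (cong proj₂ (P-off _ _ (ns a b)))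
      ; clF = λ a b ne → trans (clV a b ne) (cong proj₁ (P-off _ _ (ns a b)))
      ; clFE = λ a b e → trans (clVE a b e) (cong (up ∘ proj₁) (P-off _ _ (ns a b)))
      ; noBlock = λ (a , p) (b , q) → ⊥-elim (ns a b ((true , p) , (0F , q))) }

    flat₂ : (ar : Bool → Fin k) → (∀ y → r (ar y) ≡ row y) → ∀ {b₀} → Switch (c b₀) → Flat
    flat₂ ar arR s₀ = record { m₀ = C.m′ ; m₀C = C.mC′
      ; zF = λ a b → [ (λ { (y , refl , s) → cong proj₂ (C.onSw y s) }) , (λ (e , p) → trans (cong (proj₂ ∘ h) e) (trans (zV a b) (cong proj₂ p))) ]′ (C.value a b)
      ; clF = λ a b ne → [ (λ { (y , refl , s) → cong proj₁ (C.onSw y s) }) , (λ (e , p) → trans (cong (proj₁ ∘ h) e) (trans (clV a b ne) (cong proj₁ p))) ]′ (C.value a b)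
      ; clFE = λ a b eE → [ (λ { (y , refl , s) → ⊥-elim (noE y s eE) }) , (λ (e , p) → trans (cong (proj₁ ∘ h) e) (trans (clVE a b eE) (cong (up ∘ proj₁) p))) ]′ (C.value a b)
      ; noBlock = λ _ _ → ar false , arR false }
      where
      module Bo = Both ar arR
      noE : ∀ y {b} → Switch (c b) → ¬ E (ar y) b
      noE y (m′ , q) e = Bo.raisedSwitch e y m′ (arR y) q
      module C = Bo.Closed noE s₀

    hasRow? : ∀ y → Dec (∃[ a ] r a ≡ row y)
    hasRow? y = F.any? (λ a → r a ≟× row y)

    abstract
      reduce : Flat ⊎ Part
      reduce = decide (F.any? (λ b → switch? (c b)))
        (λ (b , s) → decide (hasRow? true)
          (λ (a , p) → decide (hasRow? false)
            (λ (a′ , p′) → inj₁ (flat₂ (λ y → if y then a else a′) (λ { true → p ; false → p′ }) s))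
            (λ none → inj₂ (record { yb = true ; ya = a ; bκ = b ; rya = p ; sκ = s ; alone = λ a q → none (a , q) })))
          (λ none → decide (hasRow? false)
            (λ (a′ , p′) → inj₂ (record { yb = false ; ya = a′ ; bκ = b ; rya = p′ ; sκ = s ; alone = λ a q → none (a , q) }))
            (λ none′ → inj₁ (flat₁ (λ { a b ((true , q) , _) → none (a , q) ; a b ((false , q) , _) → none′ (a , q) })))))
        (λ none → inj₁ (flat₁ (λ a b (_ , s) → none (b , s))))

    flatG : Flat → GConf D Λ
    flatG F = record { Σ₀ = record { k = k ; r = r ; c = c ; h = h ; r-inj = r-inj ; c-inj = c-inj ; h-inj = h-inj ; m = m₀ ; mC = m₀C }
      ; yb = true ; W = λ _ _ → ⊥ ; W? = λ _ _ → no id ; E = E ; E? = E? ; E-uniq = E-uniq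
      ; zP = λ a b _ → zF a b ; clP = λ a b _ → clF a b ; clE = λ a b _ → clFE a b
      ; W-row = λ () ; W-col = λ () ; W-full = λ () ; W-z = λ () ; W-cl = λ () ; W-clE = λ () }
      where open Flat F

    partG : Part → GConf D Λ
    partG Q = record { Σ₀ = Σ₀ ; yb = yb ; W = λ a b → r a ≡ row yb × Switch (c b) ; W? = λ a b → (r a ≟× row yb) ×-dec switch? (c b) ; E = E ; E? = E? ; E-uniq = E-uniq
      ; zP = λ a b nw → trans (zV a b) (cong proj₂ (off a b nw)) ; clP = λ a b nw ne → trans (clV a b ne) (cong proj₁ (off a b nw)) ; clE = λ a b nw e → trans (clVE a b e) (cong (up ∘ proj₁) (off a b nw))
      ; W-row = proj₁ ; W-col = proj₂ ; W-full = λ (p , _) b′ m′ q → p , (m′ , q)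
      ; W-z = λ {a} {b} {m′} (p , _) q → trans (zV a b) (trans (cong proj₂ (trans (cong₂ P p q) (P-sw yb m′))) (newZ≡ yb m′))
      ; W-cl = λ {a} {b} {m′} (p , _) q ne → trans (clV a b ne) (trans (cong proj₁ (trans (cong₂ P p q) (P-sw yb m′))) (new≡ yb m′))
      ; W-clE = λ {a} {b} {m′} (p , _) q e → trans (clVE a b e) (cong up (trans (cong proj₁ (trans (cong₂ P p q) (P-sw yb m′))) (new≡ yb m′))) }
      where
      open Part Q
      newZ≡ : ∀ y m′ → Z (cur y m′) ≡ (if y then Z (nxt m′) else Z m′)
      newZ≡ true m′ = refl
      newZ≡ false m′ = refl
      new≡ : ∀ y m′ → S (cur y m′) ≡ new y m′
      new≡ true m′ = refl
      new≡ false m′ = refl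
      off : ∀ a b → ¬ (r a ≡ row yb × Switch (c b)) → P (r a) (c b) ≡ P₀ (r a) (c b)
      off a b nw = P-off _ _ (λ ((y , q) , s) → [ (λ e → nw (trans q (cong row e) , s)) , (λ e → alone a (trans q (cong row e))) ]′ (two y yb))
        where
        two : ∀ u v → u ≡ v ⊎ u ≡ not v
        two true true = inj₁ refl
        two true false = inj₂ refl
        two false true = inj₂ refl
        two false false = inj₁ refl

    noSub : (∀ a b → ¬ E a b) → 2 ≤ k → k < n * μ → ⊥
    noSub ne 2≤k k<nμ = [ (λ F → let open Flat F in Plain.absurd₀ D Λ (record
        { Σ₀ = record { k = k ; r = r ; c = c ; h = h ; r-inj = r-inj ; c-inj = c-inj ; h-inj = h-inj ; m = m₀ ; mC = m₀C }
        ; val = λ a b → cong₂ _,_ (clF a b (ne a b)) (zF a b) ; 2≤k = 2≤k ; k<nμ = k<nμ ; noBlock = noBlock })) ,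
      (λ Q → let open Part Q in Finish.absurd D Λ (record { 𝔾 = partG Q ; noE = ne ; ya = ya ; bκ = bκ ; wκ = rya , sκ ; 2≤k = 2≤k })) ]′ reduce

    noRaised : ∀ {ea eb} → E ea eb → 8 ≤ k → k ≤ 9 → ⊥
    noRaised eE 8≤k k≤9 = [ (λ F → Raised.raised D Λ (record { 𝔾 = flatG F ; eE = eE ; 8≤k = 8≤k ; k≤9 = k≤9 })) ,
      (λ Q → Raised.raised D Λ (record { 𝔾 = partG Q ; eE = eE ; 8≤k = 8≤k ; k≤9 = k≤9 })) ]′ reduce

-- The conditions on the product

record Opened {N : ℕ} (Q : Matrix N) (k : ℕ) : Set where
  field
    ri ci si : Fin k → Fin N
    ri-inj : ∀ a a′ → ri a ≡ ri a′ → a ≡ a′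
    ci-inj : ∀ b b′ → ci b ≡ ci b′ → b ≡ b′
    si-inj : ∀ t t′ → si t ≡ si t′ → t ≡ t′
    m : Matrix k
    mC : Cancel m
    value : ∀ a b → Q (ri a) (ci b) ≡ si (m a b)

openSub : {N : ℕ} {Q : Matrix N} {k : ℕ} → HasSubsquare Q k → Opened Q k
openSub (r , c , s , ri , ci , si , val , _ , rowI , _ , colI) = record
  { ri = r ; ci = c ; si = s ; ri-inj = λ a a′ → ri ; ci-inj = λ b b′ → ci ; si-inj = λ t t′ → si
  ; m = λ a b → proj₁ (val a b)
  ; mC = record { row = λ a {b} {b′} e → rowI a b b′ (trans (proj₂ (val a b)) (trans (cong s e) (sym (proj₂ (val a b′)))))
                ; col = λ b {a} {a′} e → colI b a a′ (trans (proj₂ (val a b)) (trans (cong s e) (sym (proj₂ (val a′ b))))) }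
  ; value = λ a b → proj₂ (val a b) }

closeSub : {N : ℕ} {Q Q′ : Matrix N} {k : ℕ} (O : Opened Q k) → (∀ a b → Q′ (Opened.ri O a) (Opened.ci O b) ≡ Q (Opened.ri O a) (Opened.ci O b)) → HasSubsquare Q′ k
closeSub O e = ri , ci , si , (λ {a} {a′} → ri-inj a a′) , (λ {b} {b′} → ci-inj b b′) , cancel→latin _ si m mC si-inj (λ a b → trans (e a b) (value a b))
  where open Opened O

replace-at : {N : ℕ} (Q : Matrix N) (u w v : Fin N) → replace Q u w v u w ≡ v
replace-at Q u w v = replace-elim Q u w v (_≡ v) (λ _ _ → refl) (λ ne → ⊥-elim (ne (refl , refl)))

replace-off : {N : ℕ} (Q : Matrix N) (u w v : Fin N) {a b : Fin N} → ¬ (a ≡ u × b ≡ w) → replace Q u w v a b ≡ Q a b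
replace-off Q u w v {a} {b} ne = replace-elim Q u w v (_≡ Q a b) (λ p q → ⊥-elim (ne (p , q))) (λ _ → refl)

Crossing : {N : ℕ} (Q : Matrix N) (u w v : Fin N) → Set
Crossing {N} Q u w v = ∃[ u′ ] ∃[ w′ ] (u′ ≢ u × w′ ≢ w × Q u′ w′ ≡ v × Q u w′ ≡ Q u′ w)

-- A new intercalate uses the altered cell, and its other three cells are old entries. Together with
-- `crossing→sub` this translates between intercalates of L and of the product.
crossing : {N : ℕ} (Q : Matrix N) (u w v : Fin N) → ¬ HasSubsquare Q 2 → HasSubsquare (replace Q u w v) 2 → Crossing Q u w v
crossing {N} Q u w v none hs = decide (F.any? (λ a → F.any? (λ b → (ri a ≟ u) ×-dec (ci b ≟ w))))
  (λ (a , b , p , q) → at a b p q)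
  (λ avoid → ⊥-elim (none (closeSub {Q′ = Q} O (λ a b → sym (replace-off Q u w v (λ (p , q) → avoid (a , b , p , q)))))))
  where
  O : Opened (replace Q u w v) 2
  O = openSub hs
  open Opened O
  cross : ∀ {a a′ b b′} → a ≢ a′ → b ≢ b′ → m a b ≡ m a′ b′
  cross {a} {a′} {b} {b′} na nb = pairEq {P = λ _ → ⊤} (λ _ → yes tt) (subst (_≤ 2) (sym total) ℕ.≤-refl) {t = m a b′} tt tt tt
    (λ e → nb (Cancel.row mC a e)) (λ e → na (sym (Cancel.col mC b′ e)))
  at : ∀ a b → ri a ≡ u → ci b ≡ w → Crossing Q u w v
  at a b p q = ri a′ , ci b′ , (λ e → ne (ri-inj _ _ (trans e (sym p)))) , (λ e → ne′ (ci-inj _ _ (trans e (sym q)))) ,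
    trans (sym (off a′ b′ (λ (e , _) → ne (ri-inj _ _ (trans e (sym p)))))) (trans (value a′ b′) (trans (cong si (cross ne ne′)) (trans (sym (value a b)) (trans (cong₂ (replace Q u w v) p q) (replace-at Q u w v))))) ,
    trans (cong (λ e → Q e (ci b′)) (sym p)) (trans (sym (off a b′ (λ (_ , e) → ne′ (ci-inj _ _ (trans e (sym q)))))) (trans (value a b′) (trans (cong si (cross (≢-sym ne) ne′))
      (trans (sym (value a′ b)) (trans (off a′ b (λ (e , _) → ne (ri-inj _ _ (trans e (sym p))))) (cong (Q (ri a′)) q))))))
    where
    off : ∀ a b → ¬ (ri a ≡ u × ci b ≡ w) → replace Q u w v (ri a) (ci b) ≡ Q (ri a) (ci b)
    off a b ne = replace-off Q u w v ne
    other : ∀ (x : Fin 2) → ∃[ y ] y ≢ x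
    other 0F = 1F , λ ()
    other 1F = 0F , λ ()
    a′ b′ : Fin 2
    a′ = proj₁ (other a)
    b′ = proj₁ (other b)
    ne : a′ ≢ a
    ne = proj₂ (other a)
    ne′ : b′ ≢ b
    ne′ = proj₂ (other b)

crossing→sub : {N : ℕ} (Q : Matrix N) (u w v : Fin N) {u′ w′ : Fin N} → u′ ≢ u → w′ ≢ w → Q u′ w′ ≡ v → Q u w′ ≡ Q u′ w → v ≢ Q u w′ →
               HasSubsquare (replace Q u w v) 2
crossing→sub {N} Q u w v {u′} {w′} nu nw e e′ nv = two u u′ , two w w′ , two v (Q u w′) , (λ {a} {a′} → two-inj (≢-sym nu) a a′) , (λ {b} {b′} → two-inj (≢-sym nw) b b′) ,
  cancel→latin _ (two v (Q u w′)) xor (record { row = xor-row ; col = xor-col }) (two-inj nv) val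
  where
  two : {X : Set} → X → X → Fin 2 → X
  two p q 0F = p
  two p q 1F = q
  two-inj : {X : Set} {p q : X} → p ≢ q → ∀ a a′ → two p q a ≡ two p q a′ → a ≡ a′
  two-inj ne 0F 0F _ = refl
  two-inj ne 0F 1F f = ⊥-elim (ne f)
  two-inj ne 1F 0F f = ⊥-elim (ne (sym f))
  two-inj ne 1F 1F _ = refl
  xor : Matrix 2
  xor 0F b = b
  xor 1F 0F = 1F
  xor 1F 1F = 0F
  xor-row : ∀ a {b b′} → xor a b ≡ xor a b′ → b ≡ b′
  xor-row 0F f = f
  xor-row 1F {0F} {0F} f = refl
  xor-row 1F {1F} {1F} f = refl
  xor-row 1F {0F} {1F} ()
  xor-row 1F {1F} {0F} ()
  xor-col : ∀ b {a a′} → xor a b ≡ xor a′ b → a ≡ a′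
  xor-col 0F {0F} {0F} f = refl
  xor-col 0F {1F} {1F} f = refl
  xor-col 1F {0F} {0F} f = refl
  xor-col 1F {1F} {1F} f = refl
  xor-col 0F {0F} {1F} ()
  xor-col 0F {1F} {0F} ()
  xor-col 1F {0F} {1F} ()
  xor-col 1F {1F} {0F} ()
  val : ∀ a b → replace Q u w v (two u u′ a) (two w w′ b) ≡ two v (Q u w′) (xor a b)
  val 0F 0F = replace-at Q u w v
  val 0F 1F = replace-off Q u w v (λ (_ , f) → nw f)
  val 1F 0F = trans (replace-off Q u w v (λ (f , _) → nu f)) (sym e′)
  val 1F 1F = trans (replace-off Q u w v (λ (f , _) → nu f)) e

module Product (D : Design) (Λ : Lat D) where
  open Base D Λ
  open Square D Λ

  N : ℕ
  N = n * μ

  enc : Pos → Fin N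
  enc (u , w) = combine u w

  abstract
    dec : Fin N → Pos
    dec = remQuot {n} μ
    dec-enc : ∀ u w → dec (combine u w) ≡ (u , w)
    dec-enc u w = F.remQuot-combine {n} u w
    enc-dec : ∀ u → enc (dec u) ≡ u
    enc-dec u = F.combine-remQuot {n} μ u

  dec-inj : ∀ u v → dec u ≡ dec v → u ≡ v
  dec-inj u v e = trans (sym (enc-dec u)) (trans (cong enc e) (enc-dec v))
  enc-inj : ∀ {ρ κ} → enc ρ ≡ enc κ → ρ ≡ κ
  enc-inj {u , w} {u′ , w′} e = let (p , q) = F.combine-injective u w u′ w′ e in cong₂ _,_ p q

  M : Matrix N
  M u w = enc (P (dec u) (dec w))

  MC : Cancel M
  MC = record { row = λ u e → dec-inj _ _ (P-row (dec u) _ _ (enc-inj e)) ; col = λ w e → dec-inj _ _ (P-col (dec w) _ _ (enc-inj e)) }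

  80≤N : 80 ≤ N
  80≤N = ℕ.*-mono-≤ 8≤n 10≤μ

  psub : ∀ {Q k} (O : Opened Q k) (E : Fin k → Fin k → Set) → (∀ a b → Dec (E a b)) →
         (∀ {a b a′ b′} → E a b → E a′ b′ → a ≡ a′ × b ≡ b′) →
         (∀ a b → ¬ E a b → Q (Opened.ri O a) (Opened.ci O b) ≡ M (Opened.ri O a) (Opened.ci O b)) →
         (∀ a b → E a b → Q (Opened.ri O a) (Opened.ci O b) ≡ M (Opened.ri O a) (Opened.ci O b) +ₛ (1 * μ)) → PSub
  psub {Q} {k} O E E? E-uniq V VE = record
    { Σ₀ = record { k = k ; r = dec ∘ ri ; c = dec ∘ ci ; h = dec ∘ si ; r-inj = λ a a′ e → ri-inj a a′ (dec-inj _ _ e)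
                  ; c-inj = λ a a′ e → ci-inj a a′ (dec-inj _ _ e) ; h-inj = λ a a′ e → si-inj a a′ (dec-inj _ _ e) ; m = m ; mC = mC }
    ; E = E ; E? = E? ; E-uniq = E-uniq
    ; zV = λ a b → decide (E? a b) (λ e → cong proj₂ (on a b e)) (λ ne → cong proj₂ (off a b ne))
    ; clV = λ a b ne → cong proj₁ (off a b ne)
    ; clVE = λ a b e → cong proj₁ (on a b e) }
    where
    open Opened O
    off : ∀ a b → ¬ E a b → dec (si (m a b)) ≡ P (dec (ri a)) (dec (ci b))
    off a b ne = trans (cong dec (trans (sym (value a b)) (V a b ne))) (dec-enc _ _)
    on : ∀ a b → E a b → dec (si (m a b)) ≡ (up (proj₁ (P (dec (ri a)) (dec (ci b)))) , proj₂ (P (dec (ri a)) (dec (ci b))))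
    on a b e = trans (cong dec (trans (sym (value a b)) (trans (VE a b e) (combine-+ₛ (proj₁ (P (dec (ri a)) (dec (ci b)))) (proj₂ (P (dec (ri a)) (dec (ci b)))))))) (dec-enc _ _)

  M∞ : IsNinf M
  M∞ k 2≤k k<N hs = Reduce.noSub (psub O (λ _ _ → ⊥) (λ _ _ → no id) (λ ()) (λ _ _ _ → refl) (λ _ _ ())) (λ _ _ ()) 2≤k k<N
    where
    O : Opened M k
    O = openSub hs

  -- A subsquare through the altered cell is a subarray with one raised class; any other is a
  -- subsquare of the product itself.
  M-strong : ∀ α → 8 ≤ α → α ≤ 9 → StrongAllowableShift M (1 * μ) α
  M-strong α 8≤α α≤9 u w hs = decide (F.any? (λ a → F.any? (E? a)))
    (λ (a , b , e) → Reduce.noRaised T {a} {b} e 8≤α α≤9)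
    (λ none → Reduce.noSub T (λ a b e → none (a , b , e)) (ℕ.≤-trans (s≤s (s≤s z≤n)) 8≤α) (ℕ.≤-trans (s≤s α≤9) (ℕ.≤-trans (ℕ.m≤m+n 10 70) 80≤N)))
    where
    v : Fin N
    v = M u w +ₛ (1 * μ)
    O : Opened (replace M u w v) α
    O = openSub hs
    open Opened O
    E : Fin α → Fin α → Set
    E a b = ri a ≡ u × ci b ≡ w
    E? : ∀ a b → Dec (E a b)
    E? a b = (ri a ≟ u) ×-dec (ci b ≟ w)
    T : PSub
    T = psub O E E? (λ (p , q) (p′ , q′) → ri-inj _ _ (trans p (sym p′)) , ci-inj _ _ (trans q (sym q′)))
      (λ a b ne → replace-off M u w v ne)
      (λ a b (p , q) → trans (cong₂ (replace M u w v) p q) (trans (replace-at M u w v) (cong (_+ₛ (1 * μ)) (sym (cong₂ M p q)))))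

  M-enc : ∀ {i x j y} → M (combine i x) (combine j y) ≡ enc (P (i , x) (j , y))
  M-enc {i} {x} {j} {y} = cong enc (cong₂ P (dec-enc i x) (dec-enc j y))

  P-calmRow : ∀ {i x} → (∀ y → i ≢ blk y) → x ≢ zero → ∀ κ → P (i , x) κ ≡ (A i (proj₁ κ) , L x (proj₂ κ))
  P-calmRow {i} {x} ni nx (j , y) = trans (P-off _ _ (λ ((y′ , e) , _) → ni y′ (cong proj₁ e)))
    (cong₂ _,_ (Az-off (λ (p , _) → nx p)) (Lz-off (λ (p , _) → ni true p)))

  P-calmCol : ∀ {j y} → (∀ m → j ≢ J m) → y ≢ zero → ∀ ρ → P ρ (j , y) ≡ (A (proj₁ ρ) j , L (proj₂ ρ) y)
  P-calmCol {j} {y} nj ny (i , x) = trans (P-off _ _ (λ (_ , (m′ , e)) → nj m′ (cong proj₁ e)))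
    (cong₂ _,_ (Az-off (λ (_ , q) → ny q)) (Lz-off (λ (_ , q) → nj 0F (trans q (sym J₀)))))

  M-row : ∀ {i x} → (∀ y → i ≢ blk y) → x ≢ zero → ∀ j y → M (combine i x) (combine j y) ≡ combine (A i j) (L x y)
  M-row {i} {x} ni nx j y = trans (M-enc {i} {x} {j} {y}) (cong enc (P-calmRow ni nx (j , y)))

  M-zero : M zero zero ≡ combine (A zero zero) (σ (L zero zero))
  M-zero = trans (M-enc {zero} {zero} {zero} {zero}) (cong enc (trans (P-off (zero , zero) (zero , zero) (λ (_ , (m′ , e)) → K≢0 m′ (sym (cong proj₂ e)))) (cong₂ _,_ (Az-00 {x = zero} {zero} refl refl) (Lz-on {x = zero} {zero} refl refl))))

  enc≢0 : ∀ {i x} → i ≢ zero → combine i x ≢ zero {n = _}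
  enc≢0 {i} {x} ni e = ni (proj₁ (F.combine-injective {n} {μ} i x zero zero e))

  Az-cases : ∀ i x j y → Az (i , x) (j , y) ≡ A i j ⊎ (Az (i , x) (j , y) ≡ B i j × ¬ (i ≡ zero × j ≡ zero) × x ≡ zero × y ≡ zero)
  Az-cases i x j y = decide ((i ≟ zero) ×-dec (j ≟ zero)) (λ (p , q) → inj₁ (Az-00 p q))
    (λ nc → decide ((x ≟ zero) ×-dec (y ≟ zero)) (λ (p , q) → inj₂ (Az-on p q , nc , p , q)) (λ ne → inj₁ (Az-off ne)))

  -- The coordinates of a crossing through the altered cell. Its far corner may be read in `P₀`,
  -- because `cs` is not the class of an exchanged symbol.
  Separate : (i₀ j₀ cs : Fin n) (x₀ y₀ zs : Fin μ) → Set
  Separate i₀ j₀ cs x₀ y₀ zs = ∀ i x j y → ¬ (i ≡ i₀ × x ≡ x₀) → ¬ (j ≡ j₀ × y ≡ y₀) → A i₀ j ≡ A i j₀ → L x₀ y ≡ L x y₀ →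
                               Az (i , x) (j , y) ≡ cs → Lz (i , x) (j , y) ≡ zs → ⊥

  module Near {i₀ j₀ : Fin n} {x₀ y₀ : Fin μ} (ni : ∀ y → i₀ ≢ blk y) (nx : x₀ ≢ zero) (nj : ∀ m → j₀ ≢ J m) (ny : y₀ ≢ zero)
              {cs : Fin n} {zs : Fin μ} (ns : ∀ m → cs ≢ S m) (impossible : Separate i₀ j₀ cs x₀ y₀ zs) where
    noInt : ¬ HasSubsquare (replace M (combine i₀ x₀) (combine j₀ y₀) (combine cs zs)) 2
    noInt hs = go (crossing M _ _ _ (M∞ 2 ℕ.≤-refl (ℕ.≤-trans (ℕ.m≤m+n 3 77) 80≤N)) hs)
      where
      go : Crossing M (combine i₀ x₀) (combine j₀ y₀) (combine cs zs) → ⊥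
      go (u , w , nu , nw , e , e′) = impossible (proj₁ (dec u)) (proj₂ (dec u)) (proj₁ (dec w)) (proj₂ (dec w))
        (λ (p , q) → nu (trans (sym (enc-dec u)) (cong₂ combine p q))) (λ (p , q) → nw (trans (sym (enc-dec w)) (cong₂ combine p q)))
        (cong proj₁ corners) (cong proj₂ corners) (trans (sym (cong proj₁ off)) (cong proj₁ far)) (trans (sym (cong proj₂ off)) (cong proj₂ far))
        where
        corners : (A i₀ (proj₁ (dec w)) , L x₀ (proj₂ (dec w))) ≡ (A (proj₁ (dec u)) j₀ , L (proj₂ (dec u)) y₀)
        corners = trans (sym (P-calmRow ni nx (dec w))) (trans (cong (λ ρ → P ρ (dec w)) (sym (dec-enc i₀ x₀))) (trans (enc-inj e′) (trans (cong (P (dec u)) (dec-enc j₀ y₀)) (P-calmCol nj ny (dec u)))))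
        far : P (dec u) (dec w) ≡ (cs , zs)
        far = enc-inj e
        off : P (dec u) (dec w) ≡ P₀ (dec u) (dec w)
        off = P-off _ _ (λ ((y′ , p) , (m′ , q)) → ns _ (sym (cong proj₁ (trans (sym (P-sw y′ m′)) (trans (sym (cong₂ P p q)) far)))))

  -- The row cycle of L is placed over the block `(i₃ , j₄)`, which none of the changes affects on
  -- its rows and columns.
  condII : CondII L s → CondII M (1 * μ)
  condII (x₁ , x₂ , y₁ , y₂ , y₃ , z₁ , z₂ , z₃ , (x≢ , (z₁₂ , z₁₃ , z₂₃) , (y₁₂ , y₁₃ , y₂₃) , τ₁ , τ₂ , τ₃ , cyc) , (x₁≢ , x₂≢ , y₁≢ , y₂≢ , y₃≢) , (s₁ , s₂ , s₃) , noI) =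
    combine i₃ x₁ , combine i₃ x₂ , Y y₁ , Y y₂ , Y y₃ , V z₁ , V z₂ , V z₃ ,
    ((λ e → x≢ (cong proj₂ (enc-inj {i₃ , x₁} {i₃ , x₂} e))) , (V≢ z₁₂ , V≢ z₁₃ , V≢ z₂₃) , (Y≢ y₁₂ , Y≢ y₁₃ , Y≢ y₂₃) , lift τ₁ , lift τ₂ , lift τ₃ ,
      (λ w → mk⇔ (to w) (from w))) ,
    (enc≢0 i₃≢0 , enc≢0 i₃≢0 , enc≢0 j₄≢0 , enc≢0 j₄≢0 , enc≢0 j₄≢0) ,
    (off s₁ , off s₂ , off s₃) ,
    subst (λ v → ¬ HasSubsquare (replace M (combine i₃ x₁) (Y y₃) v) 2) (sym (M-row i₃-ok x₂≢ j₄ y₃)) noInt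
    where
    Y V : Fin μ → Fin N
    Y y = combine j₄ y
    V z = combine (A i₃ j₄) z
    i₃≢0 : i₃ ≢ zero
    i₃≢0 = i₃-ok true
    j₄≢0 : j₄ ≢ zero
    j₄≢0 e = j₄-ok 0F (trans e (sym J₀))
    V≢ : ∀ {z z′} → z ≢ z′ → V z ≢ V z′
    V≢ ne e = ne (cong proj₂ (enc-inj {A i₃ j₄ , _} {A i₃ j₄ , _} e))
    Y≢ : ∀ {y y′} → y ≢ y′ → Y y ≢ Y y′
    Y≢ ne e = ne (cong proj₂ (enc-inj {j₄ , _} {j₄ , _} e))
    lift : ∀ {z z′} → RowPerm L x₁ x₂ z z′ → RowPerm M (combine i₃ x₁) (combine i₃ x₂) (V z) (V z′)
    lift (y , p , q) = Y y , trans (M-row i₃-ok x₁≢ j₄ y) (cong V p) , trans (M-row i₃-ok x₂≢ j₄ y) (cong V q)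
    map₃ : {P Q R P′ Q′ R′ : Set} → (P → P′) → (Q → Q′) → (R → R′) → P ⊎ Q ⊎ R → P′ ⊎ Q′ ⊎ R′
    map₃ f g h = [ (λ p → inj₁ (f p)) , [ (λ q → inj₂ (inj₁ (g q))) , (λ r → inj₂ (inj₂ (h r))) ]′ ]′
    split : ∀ w → w ≡ combine (proj₁ (dec w)) (proj₂ (dec w))
    split w = sym (enc-dec w)
    val : ∀ w → M (combine i₃ x₁) w ≡ combine (A i₃ (proj₁ (dec w))) (L x₁ (proj₂ (dec w)))
    val w = trans (cong (M (combine i₃ x₁)) (split w)) (M-row i₃-ok x₁≢ (proj₁ (dec w)) (proj₂ (dec w)))
    read : ∀ w z → M (combine i₃ x₁) w ≡ V z → proj₁ (dec w) ≡ j₄ × L x₁ (proj₂ (dec w)) ≡ z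
    read w z e = let q = enc-inj {A i₃ (proj₁ (dec w)) , L x₁ (proj₂ (dec w))} {A i₃ j₄ , z} (trans (sym (val w)) e) in AC.row i₃ (cong proj₁ q) , cong proj₂ q
    to : ∀ w → M (combine i₃ x₁) w ≡ V z₁ ⊎ M (combine i₃ x₁) w ≡ V z₂ ⊎ M (combine i₃ x₁) w ≡ V z₃ → w ≡ Y y₁ ⊎ w ≡ Y y₂ ⊎ w ≡ Y y₃
    to w alt = map₃ wr wr wr (Equivalence.to (cyc (proj₂ (dec w))) (map₃ (λ e → proj₂ (read w z₁ e)) (λ e → proj₂ (read w z₂ e)) (λ e → proj₂ (read w z₃ e)) alt))
      where
      j≡ : proj₁ (dec w) ≡ j₄
      j≡ = [ (λ e → proj₁ (read w z₁ e)) , [ (λ e → proj₁ (read w z₂ e)) , (λ e → proj₁ (read w z₃ e)) ]′ ]′ alt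
      wr : ∀ {y} → proj₂ (dec w) ≡ y → w ≡ Y y
      wr e = trans (split w) (cong₂ combine j≡ e)
    from : ∀ w → w ≡ Y y₁ ⊎ w ≡ Y y₂ ⊎ w ≡ Y y₃ → M (combine i₃ x₁) w ≡ V z₁ ⊎ M (combine i₃ x₁) w ≡ V z₂ ⊎ M (combine i₃ x₁) w ≡ V z₃
    from w = [ at inj₁ , [ at (inj₂ ∘ inj₁) , at (inj₂ ∘ inj₂) ]′ ]′
      where
      at : ∀ {y} → (∀ {k} → k ≡ y → k ≡ y₁ ⊎ k ≡ y₂ ⊎ k ≡ y₃) → w ≡ Y y → M (combine i₃ x₁) w ≡ V z₁ ⊎ M (combine i₃ x₁) w ≡ V z₂ ⊎ M (combine i₃ x₁) w ≡ V z₃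
      at {y} inj e = map₃ mk mk mk (Equivalence.from (cyc y) (inj refl))
        where
        mk : ∀ {z} → L x₁ y ≡ z → M (combine i₃ x₁) w ≡ V z
        mk f = trans (cong (M (combine i₃ x₁)) e) (trans (M-row i₃-ok x₁≢ j₄ y) (cong V f))
    -- The corner entry raised by μ still has L-label `L zero zero +ₛ s`, so this part is inherited
    -- from L.
    off : ∀ {z} → L zero zero +ₛ s ≢ z → M zero zero +ₛ (1 * μ) ≢ V z
    off {z} ne e = ne (cong proj₂ (enc-inj {up (A zero zero) , σ (L zero zero)} {A i₃ j₄ , z} (trans (sym (trans (cong (_+ₛ (1 * μ)) M-zero) (combine-+ₛ (A zero zero) (σ (L zero zero))))) e)))
    -- A far corner in the same block row gives a crossing in L. In another block row it gives an
    -- intercalate of A, or lies in the copy of B, which `c₃-box` excludes.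
    separate : Separate i₃ j₄ (A i₃ j₄) x₁ y₃ (L x₂ y₃)
    separate i x j y nr nc eA eL eAz eLz = decide (i ≟ i₃)
        (λ { refl → noI (crossing→sub L x₁ y₃ (L x₂ y₃) {x} {y} (λ e → nr (refl , e)) (λ e → nc (AC.row i₃ eA , e))
              (trans (sym (Lz-off (λ (p , _) → i₃≢0 p))) eLz) eL
              (λ e → nr (refl , LC.col y (trans (trans (sym (Lz-off (λ (p , _) → i₃≢0 p))) eLz) e)))) })
        (λ ne → [ (λ f → A-noInt i₃ i j₄ j (≢-sym ne) (trans (sym eAz) f) eA) ,
                  (λ (f , corner , _) → c₃-box i j ne corner eA (trans (sym f) eAz)) ]′ (Az-cases i x j y))
    open Near {i₃} {j₄} {x₁} {y₃} i₃-ok x₁≢ j₄-ok y₃≢ {A i₃ j₄} {L x₂ y₃} c₃-ok separate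

  -- The near row cycle now comes from A, placed over one cell of L: for the shift μ, the symbol σ +
  -- s of the condition has the class `up (A n₁ (nk 0F))` of `near₃`.
  condIII : CondIII M (1 * μ)
  condIII =
    combine n₁ X , combine n₂ X , C 0F , C 1F , C 2F , V 0F , V 1F , V 2F ,
    (λ e → n₁≢n₂ (cong proj₁ (enc-inj {n₁ , X} {n₂ , X} e))) , (C≢ (λ ()) , C≢ (λ ()) , C≢ (λ ())) ,
    (C 0F , row₁ , trans row₂ (cong (λ u → combine u w) near₁)) , (C 1F , row₁ , trans row₂ (cong (λ u → combine u w) near₂)) ,
    (enc≢0 (n₁-ok true) , enc≢0 (n₂-ok true) , enc≢0 nk≢0 , enc≢0 nk≢0 , enc≢0 nk≢0) ,
    (row₁ , trans row₂ (cong (λ u → combine u w) near₁) , row₁ , trans row₂ (cong (λ u → combine u w) near₂) , row₁ ,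
      trans row₂ (trans (cong (λ u → combine u w) near₃) (sym (combine-+ₛ (A n₁ (nk 0F)) w)))) ,
    subst (λ v → ¬ HasSubsquare (replace M (combine n₁ X) (C 2F) v) 2) (sym row₂) noInt ,
    (off₀ (A n₁ (nk 0F)) , off₀ (A n₁ (nk 1F)) , off₀ (A n₁ (nk 2F)) , (λ e → off₀ (up (A n₁ (nk 0F))) (trans e (combine-+ₛ (A n₁ (nk 0F)) w)))) ,
    (off₁ (A n₁ (nk 0F)) , off₁ (A n₁ (nk 1F)) , off₁ (A n₁ (nk 2F)) , (λ e → off₁ (up (A n₁ (nk 0F))) (trans e (combine-+ₛ (A n₁ (nk 0F)) w))))
    where
    X : Fin μ
    X = R true
    v₁ : ∃[ y ] L X y ≡ L zero zero
    v₁ = LC.rowS X (L zero zero)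
    v₂ : ∃[ y ] L X y ≡ σ (L zero zero)
    v₂ = LC.rowS X (σ (L zero zero))
    -- `w` has to avoid `L zero zero` and its shift, so that neither the copy of B nor the corner
    -- entry has L-label `w`.
    fr : ∃[ y ] y ∉ zero ∷ proj₁ v₁ ∷ proj₁ v₂ ∷ []
    fr = freshFin (zero ∷ proj₁ v₁ ∷ proj₁ v₂ ∷ []) (ℕ.≤-trans (ℕ.m≤m+n 4 6) 10≤μ)
    y₀ w : Fin μ
    y₀ = proj₁ fr
    w = L X y₀
    y₀≢0 : y₀ ≢ zero
    y₀≢0 e = proj₂ fr (here e)
    w≢₁ : w ≢ L zero zero
    w≢₁ e = proj₂ fr (there (here (LC.row X (trans e (sym (proj₂ v₁))))))
    w≢₂ : w ≢ σ (L zero zero)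
    w≢₂ e = proj₂ fr (there (there (here (LC.row X (trans e (sym (proj₂ v₂)))))))
    C V : Fin 3 → Fin N
    C e = combine (nk e) y₀
    V e = combine (A n₁ (nk e)) w
    nk≢0 : ∀ {e} → nk e ≢ zero
    nk≢0 {e} f = nk-ok e 0F (trans f (sym J₀))
    C≢ : ∀ {e e′} → e ≢ e′ → C e ≢ C e′
    C≢ {e} {e′} ne f = ne (nk-inj e e′ (cong proj₁ (enc-inj {nk e , y₀} {nk e′ , y₀} f)))
    row₁ : ∀ {e} → M (combine n₁ X) (C e) ≡ combine (A n₁ (nk e)) w
    row₁ {e} = M-row n₁-ok (R≢0 true) (nk e) y₀
    row₂ : ∀ {e} → M (combine n₂ X) (C e) ≡ combine (A n₂ (nk e)) w
    row₂ {e} = M-row n₂-ok (R≢0 true) (nk e) y₀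
    off₀ : ∀ u → M zero zero ≢ combine u w
    off₀ u e = w≢₂ (sym (cong proj₂ (enc-inj {A zero zero , σ (L zero zero)} {u , w} (trans (sym M-zero) e))))
    off₁ : ∀ u → M zero zero +ₛ (1 * μ) ≢ combine u w
    off₁ u e = w≢₂ (sym (cong proj₂ (enc-inj {up (A zero zero) , σ (L zero zero)} {u , w}
      (trans (sym (trans (cong (_+ₛ (1 * μ)) M-zero) (combine-+ₛ (A zero zero) (σ (L zero zero))))) e))))
    notBox : ∀ {i j x y} → x ≡ zero → y ≡ zero → Lz (i , x) (j , y) ≢ w
    notBox {i} {j} p q e = decide ((i ≟ zero) ×-dec (j ≟ zero))
      (λ (f , g) → w≢₂ (trans (sym e) (trans (Lz-on f g) (cong σ (cong₂ L p q)))))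
      (λ ne → w≢₁ (trans (sym e) (trans (Lz-off ne) (cong₂ L p q))))
    separate : Separate n₁ (nk 2F) (A n₂ (nk 2F)) X y₀ w
    separate i x j y nr nc eA eL eAz eLz = [ (λ f → decide (i ≟ n₁)
          (λ g → n₁≢n₂ (AC.col (nk 2F) (trans (cong₂ A (sym g) (sym (AC.row n₁ (trans eA (cong (λ u → A u (nk 2F)) g))))) (trans (sym f) eAz))))
          (λ ne → near-noInt i j ne eA (trans (sym f) eAz))) ,
        (λ (_ , _ , p , q) → notBox p q eLz) ]′ (Az-cases i x j y)
    open Near {n₁} {nk 2F} {X} {y₀} n₁-ok (R≢0 true) (nk-ok 2F) y₀≢0 {A n₂ (nk 2F)} {w} near-ok separate

  inX : CondII L s → InX N M (1 * μ)
  inX c₂ = ℕ.≤-trans (ℕ.m≤m+n 10 70) 80≤N , cancel→latin M id M MC (λ _ _ → id) (λ _ _ → refl) , M∞ ,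
    (ℕ.≤-trans (ℕ.≤-trans (s≤s z≤n) 10≤μ) (ℕ.≤-reflexive (sym (ℕ.*-identityˡ μ))) , ℕ.*-monoˡ-< μ (ℕ.≤-trans (s≤s (s≤s z≤n)) 8≤n)) ,
    M-strong 8 ℕ.≤-refl (ℕ.n≤1+n 8) , M-strong 9 (ℕ.n≤1+n 8) ℕ.≤-refl , condII c₂ , condIII

latin→cancel : {N : ℕ} {L : Matrix N} → IsLatinSquare L → Cancel L
latin→cancel (_ , _ , _ , rowI , _ , colI) = record { row = λ i → rowI i _ _ ; col = λ j → colI j _ _ }

pick₃ : {P : Fin 3 → Set} → P 0F → P 1F → P 2F → ∀ m → P m
pick₃ p q r 0F = p
pick₃ p q r 1F = q
pick₃ p q r 2F = r

pick₃-inj : {X : Set} {p q r : X} → p ≢ q → p ≢ r → q ≢ r → ∀ m m′ → pick₃ {λ _ → X} p q r m ≡ pick₃ p q r m′ → m ≡ m′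
pick₃-inj pq pr qr 0F 0F _ = refl
pick₃-inj pq pr qr 0F 1F e = ⊥-elim (pq e)
pick₃-inj pq pr qr 0F 2F e = ⊥-elim (pr e)
pick₃-inj pq pr qr 1F 0F e = ⊥-elim (pq (sym e))
pick₃-inj pq pr qr 1F 1F _ = refl
pick₃-inj pq pr qr 1F 2F e = ⊥-elim (qr e)
pick₃-inj pq pr qr 2F 0F e = ⊥-elim (pr (sym e))
pick₃-inj pq pr qr 2F 1F e = ⊥-elim (qr (sym e))
pick₃-inj pq pr qr 2F 2F _ = refl

bool : {P : Bool → Set} → P true → P false → ∀ b → P b
bool p q true = p
bool p q false = q

lat : (D : Design) {μ′ : ℕ} (L : Matrix (suc μ′)) (s : ℕ) → 10 ≤ suc μ′ → IsLatinSquare L → IsNinf L → 1 ≤ s → s ≤ μ′ →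
      StrongAllowableShift L s (Design.n D) → CondIII L s → Lat D
lat D {μ′} L s 10≤ ls l∞ 1≤s s≤ st (r₁ , r₂ , c₁ , c₂ , c₃ , σ , τσ , τ²σ , r≢ , (c₁₂ , c₁₃ , c₂₃) , _ , _ , (r₁≢ , r₂≢ , c₁≢ , c₂≢ , c₃≢) ,
  (e₁ , e₂ , e₃ , e₄ , e₅ , e₆) , noI , (_ , w₂ , w₃ , w₄) , _) = record
  { μ′ = μ′ ; L = L ; LC = latin→cancel ls ; L∞ = l∞ ; s = s ; 1≤s = 1≤s ; s≤μ′ = s≤ ; 10≤μ = 10≤ ; strong = st
  ; R = bool r₁ r₂ ; K = pick₃ c₁ c₂ c₃ ; Z = pick₃ (σ +ₛ s) τσ τ²σ
  ; R≢0 = bool r₁≢ r₂≢ ; R≢ = r≢ ; K≢0 = pick₃ c₁≢ c₂≢ c₃≢ ; K-inj = pick₃-inj c₁₂ c₁₃ c₂₃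
  ; Z₀ = cong (_+ₛ s) (sym e₁) ; Z₁ = sym e₃ ; Z₂ = sym e₅ ; L₂ = pick₃ e₂ e₄ e₆
  ; Z≢ = pick₃ (≢-sym w₄) (≢-sym w₂) (≢-sym w₃) ; no2 = noI }

enlarge : (D : Design) (μ : ℕ) → (∀ {N} (L : Matrix N) s → StrongAllowableShift L s 8 → StrongAllowableShift L s 9 → StrongAllowableShift L s (Design.n D)) →
          InNX μ → InNX (Design.n D * μ)
enlarge D zero _ (_ , _ , () , _)
enlarge D (suc μ′) pick (L , s , 10≤ , ls , l∞ , (1≤s , s≤s s≤) , s₈ , s₉ , ii , iii) = Product.M D Λ , 1 * suc μ′ , Product.inX D Λ ii
  where
  Λ : Lat D
  Λ = lat D L s 10≤ ls l∞ 1≤s s≤ (pick L s s₈ s₉) iii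

-- The squares of orders 8 and 9

fromRows : {n : ℕ} → Vec (Vec (Fin n) n) n → Matrix n
fromRows M i j = lookup (lookup M i) j

cancel? : {n : ℕ} (Q : Matrix n) → Dec ((∀ i j j′ → Q i j ≡ Q i j′ → j ≡ j′) × (∀ j i i′ → Q i j ≡ Q i′ j → i ≡ i′))
cancel? Q = (F.all? λ i → F.all? λ j → F.all? λ j′ → (Q i j ≟ Q i j′) →-dec (j ≟ j′)) ×-dec
            (F.all? λ j → F.all? λ i → F.all? λ i′ → (Q i j ≟ Q i′ j) →-dec (i ≟ i′))

toCancel : {n : ℕ} {Q : Matrix n} → (∀ i j j′ → Q i j ≡ Q i j′ → j ≡ j′) × (∀ j i i′ → Q i j ≡ Q i′ j → i ≡ i′) → Cancel Q
toCancel (r , c) = record { row = λ i → r i _ _ ; col = λ j → c j _ _ }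

noInt? : {n : ℕ} (Q : Matrix n) → Dec (NoIntercalate Q)
noInt? Q = F.all? λ i → F.all? λ i′ → F.all? λ j → F.all? λ j′ → ¬? (i ≟ i′) →-dec ((Q i j ≟ Q i′ j′) →-dec ¬? (Q i j′ ≟ Q i′ j))

all-Bool? : {P : Bool → Set} → (∀ b → Dec (P b)) → Dec (∀ b → P b)
all-Bool? P? = map′ (λ { (t , f) true → t ; (t , f) false → f }) (λ g → g true , g false) (P? true ×-dec P? false)

all-Maybe? : {X : Set} → ({P : X → Set} → (∀ x → Dec (P x)) → Dec (∀ x → P x)) → {P : Maybe X → Set} → (∀ x → Dec (P x)) → Dec (∀ x → P x)
all-Maybe? all? P? = map′ (λ { (p , g) nothing → p ; (p , g) (just x) → g x }) (λ g → g nothing , λ x → g (just x)) (P? nothing ×-dec all? (λ x → P? (just x)))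

module Verify {n′ : ℕ} (A B : Matrix (suc n′)) (i₂ : Fin (suc n′)) (J : Fin 3 → Fin (suc n′)) where
  open Finite A B i₂ J public

  00? : (i j : Fin n) → Dec (i ≡ zero × j ≡ zero)
  00? i j = (i ≟ zero) ×-dec (j ≟ zero)

  diff? : Dec (∀ i j → ¬ (i ≡ zero × j ≡ zero) → A i j ≢ B i j)
  diff? = F.all? λ i → F.all? λ j → ¬? (00? i j) →-dec ¬? (A i j ≟ B i j)

  up-new? : Dec (∀ y m → up (new y m) ≢ A (blk y) (J m))
  up-new? = all-Bool? λ y → F.all? λ m → ¬? (up (new y m) ≟ A (blk y) (J m))

  up-B? : Dec (∀ i j → ¬ (i ≡ zero × j ≡ zero) → up (B i j) ≢ A i j)
  up-B? = F.all? λ i → F.all? λ j → ¬? (00? i j) →-dec ¬? (up (B i j) ≟ A i j)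

  near? : Dec (∀ u₀ v₀ u v → ¬ (u₀ ≡ zero × v₀ ≡ zero) → u₀ ≡ zero ⊎ u ≡ zero → v₀ ≡ zero ⊎ v ≡ zero → u ≢ u₀ → v ≢ v₀ →
              A u v₀ ≡ A u₀ v → A u v ≢ B u₀ v₀)
  near? = F.all? λ u₀ → F.all? λ v₀ → F.all? λ u → F.all? λ v → ¬? (00? u₀ v₀) →-dec
    (((u₀ ≟ zero) ⊎-dec (u ≟ zero)) →-dec (((v₀ ≟ zero) ⊎-dec (v ≟ zero)) →-dec (¬? (u ≟ u₀) →-dec (¬? (v ≟ v₀) →-dec
    ((A u v₀ ≟ A u₀ v) →-dec ¬? (A u v ≟ B u₀ v₀))))))

  fourCols? : Dec (∀ v i i′ → i ≢ i′ → (∀ m → v ≢ J m) → ∃[ e ] (∀ e′ → A i (G v e) ≢ A i′ (G v e′)))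
  fourCols? = F.all? λ v → F.all? λ i → F.all? λ i′ → ¬? (i ≟ i′) →-dec ((F.all? λ m → ¬? (v ≟ J m)) →-dec
    (F.any? λ e → F.all? λ e′ → ¬? (A i (G v e) ≟ A i′ (G v e′))))

  c₃-box? : ∀ i₃ j₄ → Dec (∀ i j → i ≢ i₃ → ¬ (i ≡ zero × j ≡ zero) → A i₃ j ≡ A i j₄ → B i j ≢ A i₃ j₄)
  c₃-box? i₃ j₄ = F.all? λ i → F.all? λ j → ¬? (i ≟ i₃) →-dec (¬? (00? i j) →-dec ((A i₃ j ≟ A i j₄) →-dec ¬? (B i j ≟ A i₃ j₄)))

  nearNoInt? : ∀ n₁ k c → Dec (∀ i j → i ≢ n₁ → A n₁ j ≡ A i k → A i j ≢ c)
  nearNoInt? n₁ k c = F.all? λ i → F.all? λ j → ¬? (i ≟ n₁) →-dec ((A n₁ j ≟ A i k) →-dec ¬? (A i j ≟ c))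

  offBlk? : ∀ i → Dec (∀ y → i ≢ blk y)
  offBlk? i = all-Bool? λ y → ¬? (i ≟ blk y)

  offJ? : ∀ j → Dec (∀ m → j ≢ J m)
  offJ? j = F.all? λ m → ¬? (j ≟ J m)

  offS? : ∀ c → Dec (∀ m → c ≢ S m)
  offS? c = F.all? λ m → ¬? (c ≟ S m)

  inj? : (f : Fin 3 → Fin n) → Dec (∀ m m′ → f m ≡ f m′ → m ≡ m′)
  inj? f = F.all? λ m → F.all? λ m′ → (f m ≟ f m′) →-dec (m ≟ m′)

  bx : Fin n → Fin n → List (Fin n)
  bx i j = if (i == zero) ∧ (j == zero) then [] else (B i j ∷ up (B i j) ∷ [])

  sws : Fin n → Fin n → List (Bool × Fin 3) → List (Fin n)
  sws i j [] = []
  sws i j ((y , m) ∷ ks) = if (i == blk y) ∧ (j == J m) then new y m ∷ up (new y m) ∷ sws i j ks else sws i j ks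

  kinds : List (Bool × Fin 3)
  kinds = (true , 0F) ∷ (true , 1F) ∷ (true , 2F) ∷ (false , 0F) ∷ (false , 1F) ∷ (false , 2F) ∷ []

  kind∈ : ∀ y m → (y , m) ∈ kinds
  kind∈ true 0F = here refl
  kind∈ true 1F = there (here refl)
  kind∈ true 2F = there (there (here refl))
  kind∈ false 0F = there (there (there (here refl)))
  kind∈ false 1F = there (there (there (there (here refl))))
  kind∈ false 2F = there (there (there (there (there (here refl)))))

  al : Fin n → Fin n → List (Fin n)
  al i j = up (A i j) ∷ bx i j ++ sws i j kinds

  inSws : ∀ y m ks → (y , m) ∈ ks → let s = sws (blk y) (J m) ks in new y m ∈ s × up (new y m) ∈ s
  inSws y m (_ ∷ ks) (here refl) rewrite ==-refl (blk y) | ==-refl (J m) = here refl , there (here refl)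
  inSws y m ((y′ , m′) ∷ ks) (there p) with (blk y == blk y′) ∧ (J m == J m′)
  ... | true = there (there (proj₁ (inSws y m ks p))) , there (there (proj₂ (inSws y m ks p)))
  ... | false = inSws y m ks p

  al-complete : ∀ {i j y} → Al i j y → y ∈ al i j
  al-complete {i} {j} shifted = here refl
  al-complete {i} {j} (box ne) with i ≟ zero | j ≟ zero
  ... | yes refl | yes refl = contradiction (refl , refl) ne
  ... | no p | _ rewrite ≢⇒==false p = there (here refl)
  ... | yes refl | no q rewrite ≢⇒==false q = there (here refl)
  al-complete {i} {j} (box↑ ne) with i ≟ zero | j ≟ zero
  ... | yes refl | yes refl = contradiction (refl , refl) ne
  ... | no p | _ rewrite ≢⇒==false p = there (there (here refl))
  ... | yes refl | no q rewrite ≢⇒==false q = there (there (here refl))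
  al-complete {i} {j} (sw y m refl refl) = there (∈-++⁺ʳ (bx i j) (proj₁ (inSws y m kinds (kind∈ y m))))
  al-complete {i} {j} (sw↑ y m refl refl) = there (∈-++⁺ʳ (bx i j) (proj₂ (inSws y m kinds (kind∈ y m))))

  stuckB : Bool → Bool → Bool → Bool → Maybe (Fin n) → Maybe (Fin n × Fin n) → Bool
  stuckB y b₀ b₁ b₂ V X = let t = mask b₀ b₁ b₂ in not (valid y t V X) ∨ (exception y t V X ∨ stuck y t V X)

  allStuck? : Dec (∀ y b₀ b₁ b₂ V X → stuckB y b₀ b₁ b₂ V X ≡ true)
  allStuck? = all-Bool? λ y → all-Bool? λ b₀ → all-Bool? λ b₁ → all-Bool? λ b₂ → all-Maybe? F.all? λ V → all-Maybe? all-Pair? λ X →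
              stuckB y b₀ b₁ b₂ V X B.≟ true
    where
    all-Pair? : {P : Fin n × Fin n → Set} → (∀ e → Dec (P e)) → Dec (∀ e → P e)
    all-Pair? P? = map′ (λ g e → g (proj₁ e) (proj₂ e)) (λ g i j → g (i , j)) (F.all? λ i → F.all? λ j → P? (i , j))

  allStuck-sound : (∀ y b₀ b₁ b₂ V X → stuckB y b₀ b₁ b₂ V X ≡ true) → ∀ y b₀ b₁ b₂ V X → let t = mask b₀ b₁ b₂ in
                   valid y t V X ≡ true → exception y t V X ≡ false → stuck y t V X ≡ true
  allStuck-sound g y b₀ b₁ b₂ V X v x = strip v x (g y b₀ b₁ b₂ V X)
    where
    strip : ∀ {p q r} → p ≡ true → q ≡ false → not p ∨ (q ∨ r) ≡ true → r ≡ true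
    strip {true} {false} {true} _ _ _ = refl

-- The squares of orders 8 and 9 were found by a computer search.
module Order8 where
  A B : Matrix 8
  A = fromRows (
    (2F ∷ 1F ∷ 4F ∷ 6F ∷ 7F ∷ 0F ∷ 3F ∷ 5F ∷ []) ∷
    (4F ∷ 2F ∷ 7F ∷ 3F ∷ 0F ∷ 1F ∷ 5F ∷ 6F ∷ []) ∷
    (7F ∷ 0F ∷ 3F ∷ 5F ∷ 6F ∷ 4F ∷ 2F ∷ 1F ∷ []) ∷
    (0F ∷ 5F ∷ 1F ∷ 2F ∷ 3F ∷ 6F ∷ 4F ∷ 7F ∷ []) ∷
    (6F ∷ 4F ∷ 5F ∷ 7F ∷ 2F ∷ 3F ∷ 1F ∷ 0F ∷ []) ∷
    (5F ∷ 6F ∷ 2F ∷ 4F ∷ 1F ∷ 7F ∷ 0F ∷ 3F ∷ []) ∷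
    (1F ∷ 3F ∷ 6F ∷ 0F ∷ 4F ∷ 5F ∷ 7F ∷ 2F ∷ []) ∷
    (3F ∷ 7F ∷ 0F ∷ 1F ∷ 5F ∷ 2F ∷ 6F ∷ 4F ∷ []) ∷ [])
  B = fromRows (
    (2F ∷ 6F ∷ 1F ∷ 3F ∷ 4F ∷ 5F ∷ 0F ∷ 7F ∷ []) ∷
    (7F ∷ 5F ∷ 0F ∷ 4F ∷ 1F ∷ 2F ∷ 6F ∷ 3F ∷ []) ∷
    (1F ∷ 4F ∷ 5F ∷ 6F ∷ 3F ∷ 0F ∷ 7F ∷ 2F ∷ []) ∷
    (5F ∷ 0F ∷ 4F ∷ 7F ∷ 6F ∷ 3F ∷ 2F ∷ 1F ∷ []) ∷
    (3F ∷ 2F ∷ 7F ∷ 0F ∷ 5F ∷ 1F ∷ 4F ∷ 6F ∷ []) ∷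
    (0F ∷ 7F ∷ 6F ∷ 1F ∷ 2F ∷ 4F ∷ 3F ∷ 5F ∷ []) ∷
    (6F ∷ 1F ∷ 3F ∷ 2F ∷ 0F ∷ 7F ∷ 5F ∷ 4F ∷ []) ∷
    (4F ∷ 3F ∷ 2F ∷ 5F ∷ 7F ∷ 6F ∷ 1F ∷ 0F ∷ []) ∷ [])
  J k : Fin 3 → Fin 8
  J = lookup (0F ∷ 5F ∷ 3F ∷ [])
  k = lookup (4F ∷ 6F ∷ 7F ∷ [])
  open Verify A B 3F J public

module Order9 where
  A B : Matrix 9
  A = fromRows (
    (6F ∷ 0F ∷ 3F ∷ 2F ∷ 5F ∷ 8F ∷ 7F ∷ 4F ∷ 1F ∷ []) ∷
    (0F ∷ 4F ∷ 2F ∷ 7F ∷ 3F ∷ 6F ∷ 5F ∷ 1F ∷ 8F ∷ []) ∷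
    (3F ∷ 6F ∷ 0F ∷ 8F ∷ 4F ∷ 1F ∷ 2F ∷ 7F ∷ 5F ∷ []) ∷
    (2F ∷ 7F ∷ 1F ∷ 0F ∷ 6F ∷ 5F ∷ 8F ∷ 3F ∷ 4F ∷ []) ∷
    (5F ∷ 8F ∷ 7F ∷ 4F ∷ 0F ∷ 3F ∷ 1F ∷ 6F ∷ 2F ∷ []) ∷
    (1F ∷ 5F ∷ 4F ∷ 3F ∷ 2F ∷ 0F ∷ 6F ∷ 8F ∷ 7F ∷ []) ∷
    (8F ∷ 1F ∷ 6F ∷ 5F ∷ 7F ∷ 4F ∷ 0F ∷ 2F ∷ 3F ∷ []) ∷
    (4F ∷ 2F ∷ 5F ∷ 1F ∷ 8F ∷ 7F ∷ 3F ∷ 0F ∷ 6F ∷ []) ∷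
    (7F ∷ 3F ∷ 8F ∷ 6F ∷ 1F ∷ 2F ∷ 4F ∷ 5F ∷ 0F ∷ []) ∷ [])
  B = fromRows (
    (6F ∷ 1F ∷ 4F ∷ 3F ∷ 0F ∷ 2F ∷ 5F ∷ 7F ∷ 8F ∷ []) ∷
    (2F ∷ 0F ∷ 7F ∷ 4F ∷ 5F ∷ 1F ∷ 8F ∷ 6F ∷ 3F ∷ []) ∷
    (1F ∷ 3F ∷ 2F ∷ 0F ∷ 8F ∷ 7F ∷ 4F ∷ 5F ∷ 6F ∷ []) ∷
    (7F ∷ 4F ∷ 6F ∷ 5F ∷ 3F ∷ 0F ∷ 2F ∷ 8F ∷ 1F ∷ []) ∷
    (8F ∷ 5F ∷ 1F ∷ 2F ∷ 7F ∷ 6F ∷ 3F ∷ 4F ∷ 0F ∷ []) ∷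
    (3F ∷ 2F ∷ 8F ∷ 7F ∷ 6F ∷ 4F ∷ 1F ∷ 0F ∷ 5F ∷ []) ∷
    (4F ∷ 8F ∷ 0F ∷ 1F ∷ 2F ∷ 5F ∷ 6F ∷ 3F ∷ 7F ∷ []) ∷
    (5F ∷ 7F ∷ 3F ∷ 6F ∷ 1F ∷ 8F ∷ 0F ∷ 2F ∷ 4F ∷ []) ∷
    (0F ∷ 6F ∷ 5F ∷ 8F ∷ 4F ∷ 3F ∷ 7F ∷ 1F ∷ 2F ∷ []) ∷ [])
  J k : Fin 3 → Fin 9
  J = lookup (0F ∷ 2F ∷ 1F ∷ [])
  k = lookup (4F ∷ 5F ∷ 7F ∷ [])
  open Verify A B 2F J public

abstract
  A-cancel-8 : Cancel Order8.A
  A-cancel-8 = toCancel (from-yes (cancel? Order8.A))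
  B-cancel-8 : Cancel Order8.B
  B-cancel-8 = toCancel (from-yes (cancel? Order8.B))
  A-rigid₃-8 : Rigid₃ Order8.A
  A-rigid₃-8 = Check.rigid₃-sound Order8.A refl
  Aᵀ-rigid₃-8 : Rigid₃ (flip Order8.A)
  Aᵀ-rigid₃-8 = Check.rigid₃-sound (flip Order8.A) refl
  B-rigid₃-8 : Rigid₃ Order8.B
  B-rigid₃-8 = Check.rigid₃-sound Order8.B refl
  A-rigid₂-8 : Rigid₂ Order8.A Order8.Al
  A-rigid₂-8 = Check.rigid₂-sound Order8.A Order8.al Order8.Al Order8.al-complete refl
  Aᵀ-rigid₂-8 : Rigid₂ (flip Order8.A) (flip Order8.Al)
  Aᵀ-rigid₂-8 = Check.rigid₂-sound (flip Order8.A) (flip Order8.al) (flip Order8.Al) Order8.al-complete refl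
  isStuck-8 : ∀ y b₀ b₁ b₂ V X → let t = mask b₀ b₁ b₂ in
                Order8.valid y t V X ≡ true → Order8.exception y t V X ≡ false → Order8.stuck y t V X ≡ true
  isStuck-8 = Order8.allStuck-sound (from-yes Order8.allStuck?)

design8 : Design
design8 = record
  { n′ = 7 ; A = Order8.A ; B = Order8.B ; i₂ = 3F ; J = Order8.J
  ; 8≤n = from-yes (8 ≤? 8)
  ; AC = A-cancel-8 ; BC = B-cancel-8
  ; AB₀ = refl ; AB = from-yes Order8.diff? ; i₂≢0 = λ () ; J₀ = refl ; J-inj = from-yes (Order8.inj? Order8.J)
  ; A₂ = from-yes (F.all? λ m → Order8.A 3F (Order8.J m) ≟ Order8.S (nxt m))
  ; up-new = from-yes Order8.up-new? ; up-B = from-yes Order8.up-B?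
  ; A-rigid₃ = A-rigid₃-8 ; Aᵀ-rigid₃ = Aᵀ-rigid₃-8 ; B-rigid₃ = B-rigid₃-8
  ; A-rigid₂ = A-rigid₂-8 ; Aᵀ-rigid₂ = Aᵀ-rigid₂-8
  ; A-noInt = from-yes (noInt? Order8.A) ; B-noInt = from-yes (noInt? Order8.B)
  ; nearInt = from-yes Order8.near? ; isStuck = isStuck-8 ; fourCols = from-yes Order8.fourCols?
  ; i₃ = 4F ; j₄ = 2F ; i₃-ok = from-yes (Order8.offBlk? 4F) ; j₄-ok = from-yes (Order8.offJ? 2F)
  ; c₃-ok = from-yes (Order8.offS? (Order8.A 4F 2F)) ; c₃-box = from-yes (Order8.c₃-box? 4F 2F)
  ; n₁ = 4F ; n₂ = 5F ; nk = Order8.k ; n₁-ok = from-yes (Order8.offBlk? 4F) ; n₂-ok = from-yes (Order8.offBlk? 5F)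
  ; n₁≢n₂ = λ () ; nk-ok = from-yes (F.all? λ e → Order8.offJ? (Order8.k e)) ; nk-inj = from-yes (Order8.inj? Order8.k)
  ; near₁ = refl ; near₂ = refl ; near₃ = refl ; near-ok = from-yes (Order8.offS? (Order8.A 5F (Order8.k 2F)))
  ; near-noInt = from-yes (Order8.nearNoInt? 4F (Order8.k 2F) (Order8.A 5F (Order8.k 2F)))
  }

abstract
  A-cancel-9 : Cancel Order9.A
  A-cancel-9 = toCancel (from-yes (cancel? Order9.A))
  B-cancel-9 : Cancel Order9.B
  B-cancel-9 = toCancel (from-yes (cancel? Order9.B))
  A-rigid₃-9 : Rigid₃ Order9.A
  A-rigid₃-9 = Check.rigid₃-sound Order9.A refl
  Aᵀ-rigid₃-9 : Rigid₃ (flip Order9.A)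
  Aᵀ-rigid₃-9 = Check.rigid₃-sound (flip Order9.A) refl
  B-rigid₃-9 : Rigid₃ Order9.B
  B-rigid₃-9 = Check.rigid₃-sound Order9.B refl
  A-rigid₂-9 : Rigid₂ Order9.A Order9.Al
  A-rigid₂-9 = Check.rigid₂-sound Order9.A Order9.al Order9.Al Order9.al-complete refl
  Aᵀ-rigid₂-9 : Rigid₂ (flip Order9.A) (flip Order9.Al)
  Aᵀ-rigid₂-9 = Check.rigid₂-sound (flip Order9.A) (flip Order9.al) (flip Order9.Al) Order9.al-complete refl
  isStuck-9 : ∀ y b₀ b₁ b₂ V X → let t = mask b₀ b₁ b₂ in
                Order9.valid y t V X ≡ true → Order9.exception y t V X ≡ false → Order9.stuck y t V X ≡ true
  isStuck-9 = Order9.allStuck-sound (from-yes Order9.allStuck?)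

design9 : Design
design9 = record
  { n′ = 8 ; A = Order9.A ; B = Order9.B ; i₂ = 2F ; J = Order9.J
  ; 8≤n = from-yes (8 ≤? 9)
  ; AC = A-cancel-9 ; BC = B-cancel-9
  ; AB₀ = refl ; AB = from-yes Order9.diff? ; i₂≢0 = λ () ; J₀ = refl ; J-inj = from-yes (Order9.inj? Order9.J)
  ; A₂ = from-yes (F.all? λ m → Order9.A 2F (Order9.J m) ≟ Order9.S (nxt m))
  ; up-new = from-yes Order9.up-new? ; up-B = from-yes Order9.up-B?
  ; A-rigid₃ = A-rigid₃-9 ; Aᵀ-rigid₃ = Aᵀ-rigid₃-9 ; B-rigid₃ = B-rigid₃-9
  ; A-rigid₂ = A-rigid₂-9 ; Aᵀ-rigid₂ = Aᵀ-rigid₂-9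
  ; A-noInt = from-yes (noInt? Order9.A) ; B-noInt = from-yes (noInt? Order9.B)
  ; nearInt = from-yes Order9.near? ; isStuck = isStuck-9 ; fourCols = from-yes Order9.fourCols?
  ; i₃ = 1F ; j₄ = 6F ; i₃-ok = from-yes (Order9.offBlk? 1F) ; j₄-ok = from-yes (Order9.offJ? 6F)
  ; c₃-ok = from-yes (Order9.offS? (Order9.A 1F 6F)) ; c₃-box = from-yes (Order9.c₃-box? 1F 6F)
  ; n₁ = 4F ; n₂ = 1F ; nk = Order9.k ; n₁-ok = from-yes (Order9.offBlk? 4F) ; n₂-ok = from-yes (Order9.offBlk? 1F)
  ; n₁≢n₂ = λ () ; nk-ok = from-yes (F.all? λ e → Order9.offJ? (Order9.k e)) ; nk-inj = from-yes (Order9.inj? Order9.k)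
  ; near₁ = refl ; near₂ = refl ; near₃ = refl ; near-ok = from-yes (Order9.offS? (Order9.A 1F (Order9.k 2F)))
  ; near-noInt = from-yes (Order9.nearNoInt? 4F (Order9.k 2F) (Order9.A 1F (Order9.k 2F)))
  }

theorem3p7 : (μ : ℕ) → InNX μ → InNX (8 * μ) × InNX (9 * μ)
theorem3p7 μ X = enlarge design8 μ (λ _ _ s₈ _ → s₈) X , enlarge design9 μ (λ _ _ _ s₉ → s₉) X
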